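{- Let $(S,T)$ be a pair of semistandard shifted Young tableaux such that $T$ extends $S$, and let the modified shifted tableau switching send $(S,T)$ to $(\widetilde{{}^ST},\widetilde{S_T})$. Then: (a) $\widetilde{S_T}\cup\widetilde{{}^ST}$ has the same shape as $S\cup T$; moreover $\widetilde{S_T}$ has the same weight as $S$ and $\widetilde{{}^ST}$ has the same weight as $T$; (b) $\widetilde{S_T}$ extends $\widetilde{{}^ST}$, and $\widetilde{S_T}$ and $\widetilde{{}^ST}$ are semistandard shifted Young tableaux.
   Context: Shifted shapes: for a strict partition $\lambda$, $S(\lambda)=\{(i,j):1\le i\le\ell(\lambda),\ i\le j\le\lambda_i+i-1\}$ (matrix coordinates), main diagonal $\{(i,i)\}$, $\lambda/\mu=S(\lambda)\setminus S(\mu)$; $\lambda/\mu$ extends $\mu/\nu$ when $\nu\subseteq\mu\subseteq\lambda$; a filling extends another if its shape does. Letters $X=\{1'<1<2'<2<\cdots\}$; bold $\mathbf k$ means $k$ or $k'$. A shifted Young tableau (SYT): filling of a skew shifted shape by $X$, weakly increasing along rows and columns, each column with at most one unprimed $k$, each row with at most one $k'$; semistandard (SSYT) if no primed entry is on the main diagonal. Weight $\mathrm{wt}(T)=(\mathrm{wt}_1,\mathrm{wt}_2,\ldots)$, $\mathrm{wt}_i$ = number of entries $i$ or $i'$; $\max(T)$ the largest $i$ with $\mathrm{wt}_i>0$. Switches on fillings with boxes labelled $\mathbf a$-boxes (entries $a,a'$) or $\mathbf b$-boxes (entries $b,b'$), at an $\mathbf a$-box $c=(i,j)$ with entry $\alpha$,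 $E=(i,j+1)$, $S'=(i+1,j)$ (entries move with labels): (S3) $j=i$, $E$ a $\mathbf b$-box with entry $b'$, $(i+1,i+1)$ a $\mathbf b$-box with entry $\beta$: new entries $\beta$ at $(i,i)$, $b$ at $(i,i+1)$ ($\mathbf b$-boxes), $\alpha$ at $(i+1,i+1)$. (S4) $j=i+1$, $\alpha=a$, $(i,i)$ an $\mathbf a$-box with entry $\alpha_0$, $S'=(i+1,i+1)$ a $\mathbf b$-box with entry $\beta$, $E$ not a $\mathbf b$-box: new entries $\beta$ at $(i,i)$, $a'$ at $(i,i+1)$, $\alpha_0$ at $(i+1,i+1)$. (S7) as (S4) but $E$ a $\mathbf b$-box with entry $b$ (unchanged). (S5) $E,S'$ both $\mathbf b$-boxes, $E$ entry $b'$: interchange $c,E$. (S6) $E,S'$ both $\mathbf b$-boxes, $E$ entry $b$, not (S7): interchange $c,S'$. (S1) only $E$ a $\mathbf b$-box, not (S3): interchange $c,E$. (S2) only $S'$ a $\mathbf b$-box, not (S4): interchange $c,S'$. Modified switches: (S1$'$) $c=(i,i)$ with entry $a$, $E$ the only $\mathbf b$-neighbor with entry $b'$, not case (S3): new entries $b$ at $(i,i)$, $a'$ at $(i,i+1)$. (S2$'$) $c$ has entry $a'$, $S'=(i+1,i+1)$ on the main diagonal with entry $b$ is the only $\mathbf b$-neighbor: new entries $b'$ at $c$, $a$ at $S'$. (S6$'$) $c$ has entry $a'$, $E$ has entry $b$, $S'=(i+1,i+1)$ on the main diagonal has entry $b$: new entries $b'$ at $c$, $b$ at $E$, $a$ at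 $S'$. Fully switched: no $\mathbf a$-box has a $\mathbf b$-box as east or south neighbor. $\Box(U)$: easternmost $\mathbf a$-box with entry $a$ having a $\mathbf b$-box as east or south neighbor, or if none, the southernmost such with entry $a'$. Modified shifted switching process on a pair ($\mathbf a$-part, $\mathbf b$-part): apply at $\Box(U)$ the applicable switch (a modified one in the configurations of (S1$'$), (S2$'$), (S6$'$), otherwise one of (S1)–(S7)) until fully switched. Modified shifted tableau switching of $(S,T)$, $T$ extending $S$: label boxes by $S$ or $T$; with $m=\max(S)$, $n=\max(T)$, for $i=m,\ldots,1$ and for each $i$, $j=1,\ldots,n$, apply in the current filling the modified shifted switching process to (current $S$-boxes with entries $\mathbf i$, current $T$-boxes with entries $\mathbf j$). $\widetilde{S_T}$ is the final filling of the $S$-labelled boxes and $\widetilde{{}^ST}$ that of the $T$-labelled boxes; components are treated independently. -}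

module Defs where

open import Data.Nat using (ℕ; zero; suc; _+_; _*_; _∸_; _≤_; _<_; _⊔_; _≡ᵇ_; _≤ᵇ_; _<ᵇ_)
open import Data.Bool using (Bool; true; false; _∧_; _∨_; not; if_then_else_)
open import Data.Nat.ListAction using (sum)
open import Data.List using (List; []; _∷_; map; foldr; length; upTo; concatMap; filterᵇ)
open import Data.Maybe using (Maybe; just; nothing; maybe)
open import Data.Product using (_×_; _,_; proj₁; proj₂; Σ)
open import Data.Sum using (_⊎_)
open import Relation.Binary.PropositionalEquality using (_≡_; _≢_)
open import Relation.Nullary using (¬_)

-- Cells (matrix coordinates, 1-based as in the paper) and shifted shapes

Cell : Set
Cell = ℕ × ℕ

data Strict : List ℕ → Set where
  nil  : Strict []
  one  : ∀ {a} → 1 ≤ a → Strict (a ∷ [])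
  cons : ∀ {a b l} → b < a → Strict (b ∷ l) → Strict (a ∷ b ∷ l)

-- part la i = λ_i (1-indexed), 0 beyond the length
part : List ℕ → ℕ → ℕ
part [] _ = 0
part (x ∷ xs) zero = 0
part (x ∷ xs) (suc zero) = x
part (x ∷ xs) (suc (suc k)) = part xs (suc k)

inS : List ℕ → Cell → Bool
inS la (i , j) = (1 ≤ᵇ i) ∧ ((i ≤ᵇ j) ∧ (j <ᵇ i + part la i))

inSkew : List ℕ → List ℕ → Cell → Bool
inSkew la mu c = inS la c ∧ not (inS mu c)

InSkew : List ℕ → List ℕ → Cell → Set
InSkew la mu c = inSkew la mu c ≡ true

Sub : List ℕ → List ℕ → Set
Sub mu la = ∀ c → inS mu c ≡ true → inS la c ≡ true

-- all cells (i,j) with i,j < N ; for N = 1 + sum λ this contains S(λ)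
grid : ℕ → List Cell
grid N = concatMap (λ i → map (λ j → (i , j)) (upTo N)) (upTo N)

gridOf : List ℕ → List Cell
gridOf la = grid (suc (sum la))

-- Letters  1' < 1 < 2' < 2 < ...

record Letter : Set where
  constructor mkL
  field
    num    : ℕ
    primed : Bool
open Letter public

rank : Letter → ℕ
rank (mkL k p) = (2 * k) ∸ (if p then 1 else 0)

_≤L_ : Letter → Letter → Set
x ≤L y = rank x ≤ rank y

-- (semistandard) shifted Young tableaux of skew shape λ/μ
-- (a filling is a function on cells; only its values on λ/μ matter)

record SYT (f : Cell → Letter) (la mu : List ℕ) : Set where
  field
    positive : ∀ c → InSkew la mu c → 1 ≤ num (f c)
    rowWeak  : ∀ i j j' → InSkew la mu (i , j) → InSkew la mu (i , j') → j ≤ j'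
               → f (i , j) ≤L f (i , j')
    colWeak  : ∀ i i' j → InSkew la mu (i , j) → InSkew la mu (i' , j) → i ≤ i'
               → f (i , j) ≤L f (i' , j)
    colUnprimed : ∀ i i' j → InSkew la mu (i , j) → InSkew la mu (i' , j) → i ≢ i'
               → primed (f (i , j)) ≡ false → primed (f (i' , j)) ≡ false
               → num (f (i , j)) ≢ num (f (i' , j))
    rowPrimed : ∀ i j j' → InSkew la mu (i , j) → InSkew la mu (i , j') → j ≢ j'
               → primed (f (i , j)) ≡ true → primed (f (i , j')) ≡ true
               → num (f (i , j)) ≢ num (f (i , j'))

record SSYT (f : Cell → Letter) (la mu : List ℕ) : Set where
  field
    syt  : SYT f la mu
    diag : ∀ i → InSkew la mu (i , i) → primed (f (i , i)) ≡ false

wt : (Cell → Letter) → List ℕ → List ℕ → ℕ → ℕ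
wt f la mu k = length (filterᵇ (λ c → inSkew la mu c ∧ (num (f c) ≡ᵇ k)) (gridOf la))

maxEntry : (Cell → Letter) → List ℕ → List ℕ → ℕ
maxEntry f la mu = foldr _⊔_ 0 (map (λ c → num (f c)) (filterᵇ (inSkew la mu) (gridOf la)))

data Lab : Set where
  SL TL : Lab

labEq : Lab → Lab → Bool
labEq SL SL = true
labEq TL TL = true
labEq _ _ = false

State : Set
State = Cell → Maybe (Lab × Letter)

occupied : State → Cell → Bool
occupied st c = maybe (λ _ → true) false (st c)

hasLab : Lab → State → Cell → Bool
hasLab L st c = maybe (λ x → labEq L (proj₁ x)) false (st c)

isLN : Lab → ℕ → State → Cell → Bool
isLN L k st c = maybe (λ x → labEq L (proj₁ x) ∧ (num (proj₂ x) ≡ᵇ k)) false (st c)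

entry : State → Cell → Letter
entry st c = maybe proj₂ (mkL 0 false) (st c)

prim : State → Cell → Bool
prim st c = primed (entry st c)

upd : Cell → Maybe (Lab × Letter) → State → State
upd (i , j) v st (k , l) = if (i ≡ᵇ k) ∧ (j ≡ᵇ l) then v else st (k , l)

swapC : Cell → Cell → State → State
swapC c d st = upd c (st d) (upd d (st c) st)

initState : (S T : Cell → Letter) → List ℕ → List ℕ → List ℕ → State
initState S T la mu nu c =
  if inSkew la mu c then just (TL , T c)
  else if inSkew mu nu c then just (SL , S c)
  else nothing

-- One switch at stage (p,q) (a-boxes: label S, entry p/p';
-- b-boxes: label T, entry q/q') performed at the a-box c = (i,j).

module _ (p q : ℕ) (st : State) where
  isA isB : Cell → Bool
  isA = isLN SL p st
  isB = isLN TL q st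

  hasBnbr : Cell → Bool
  hasBnbr (i , j) = isB (i , suc j) ∨ isB (suc i , j)

  candU candP : Cell → Bool
  candU c = isA c ∧ (not (prim st c) ∧ hasBnbr c)
  candP c = isA c ∧ (prim st c ∧ hasBnbr c)

  switch : Cell → State
  switch (i , j) =
    if diag ∧ eB ∧ eBp ∧ dB then
      upd (i , i) (just (TL , entry st D))
        (upd (i , suc i) (just (TL , mkL q false))
          (upd D (just (SL , α)) st))
    else if diag ∧ not αp ∧ eB ∧ eBp ∧ not sB then
      upd (i , i) (just (TL , mkL q false))
        (upd (i , suc i) (just (SL , mkL p true)) st)
    else if nd ∧ αp ∧ eB ∧ not eBp ∧ sB ∧ not sBp then
      upd c (just (TL , mkL q true))
        (upd E (just (TL , mkL q false))
          (upd Sd (just (SL , mkL p false)) st))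
    else if nd ∧ αp ∧ sB ∧ not sBp ∧ not eB then
      upd c (just (TL , mkL q true))
        (upd Sd (just (SL , mkL p false)) st)
    else if nd ∧ not αp ∧ isA (i , i) ∧ sB ∧ (not eB ∨ not eBp) then
      upd (i , i) (just (TL , entry st Sd))
        (upd c (just (SL , mkL p true))
          (upd Sd (just (SL , entry st (i , i))) st))
    else if eB ∧ sB ∧ eBp then swapC c E st
    else if eB ∧ sB then swapC c Sd st
    else if eB then swapC c E st
    else if sB then swapC c Sd st
    else st
    where
      c E Sd D : Cell
      c = (i , j)
      E = (i , suc j)
      Sd = (suc i , j)
      D = (suc i , suc i)
      α : Letter
      α = entry st c
      αp eB eBp sB sBp dB diag nd : Bool
      αp = primed α
      eB = isB E
      eBp = prim st E
      sB = isB Sd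
      sBp = prim st Sd
      dB = isB D
      diag = i ≡ᵇ j
      nd = j ≡ᵇ suc i

  -- c = □(U): easternmost candU (ties: southernmost); if no candU,
  -- southernmost candP (ties: easternmost)
  lexLe : ℕ × ℕ → ℕ × ℕ → Set
  lexLe (a , b) (a' , b') = a < a' ⊎ (a ≡ a' × b ≤ b')

  data IsBox : Cell → Set where
    boxU : ∀ {i j} → candU (i , j) ≡ true
         → (∀ i' j' → candU (i' , j') ≡ true → lexLe (j' , i') (j , i))
         → IsBox (i , j)
    boxP : ∀ {i j} → (∀ c' → candU c' ≡ false) → candP (i , j) ≡ true
         → (∀ i' j' → candP (i' , j') ≡ true → lexLe (i' , j') (i , j))
         → IsBox (i , j)

  FullySwitched : Set
  FullySwitched = ∀ c → (isA c ∧ hasBnbr c) ≡ false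

data Proc (p q : ℕ) : State → State → Set where
  done : ∀ {st} → FullySwitched p q st → Proc p q st st
  step : ∀ {st st' c} → IsBox p q st c → Proc p q (switch p q st c) st'
       → Proc p q st st'

data RunRow (p : ℕ) : ℕ → State → State → Set where
  row0 : ∀ {st} → RunRow p 0 st st
  rowS : ∀ {n st st1 st2} → RunRow p n st st1 → Proc p (suc n) st1 st2
       → RunRow p (suc n) st st2

data RunAll (n : ℕ) : ℕ → State → State → Set where
  all0 : ∀ {st} → RunAll n 0 st st
  allS : ∀ {m st st1 st2} → RunRow (suc m) n st st1 → RunAll n m st1 st2
       → RunAll n (suc m) st st2

ModSwitch : (S T : Cell → Letter) → List ℕ → List ℕ → List ℕ → State → Set
ModSwitch S T la mu nu fin =
  RunAll (maxEntry T la mu) (maxEntry S mu nu) (initState S T la mu nu) fin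

wtLab : Lab → State → List ℕ → ℕ → ℕ
wtLab L st la k = length (filterᵇ (λ c → isLN L k st c) (gridOf la))

{-# OPTIONS --safe #-}
module Submission where

-- At a stage with letters a (in S) and b (in T), call an a-box unmoved, active or settled. At every moment the classes
-- "earlier letters" < unmoved < {b, active} < settled < "later letters" increase weakly along rows and columns, so the
-- state is a chain of shifted shapes with the active box as a hole among the b-boxes. For a single letter the tableau
-- conditions are local: a box with a west neighbour of the same letter is unprimed, one with a south neighbour is primed,
-- and the diagonal is unprimed. Hence a switch keeps the invariant as soon as it does so on a window of bounded size,
-- where each cell has finitely many values; these checks are done by evaluation. The only non-local ingredient is the
-- order of treatment (unprimed a-boxes from east to west, then primed ones from south to north), by which the settled
-- boxes stay strictly east, respectively south, of those still to be treated. Each switch exchanges an a-box with a b-box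
-- up to primes, so weights do not change. A finished stage transposes two adjacent letters in the chain of shapes, and
-- all stages together turn the order S_1 < … < S_m < T_1 < … < T_n into T_1 < … < T_n < S_1 < … < S_m.

open import Defs
open import Data.Bool using (Bool; true; false; _∧_; _∨_; not; if_then_else_; T)
open import Data.Bool.ListAction as List using ()
open import Data.Bool.Properties using (T?; ∧-zeroʳ)
open import Data.Empty using (⊥; ⊥-elim)
open import Data.List using (List; []; _∷_; map; foldr; _++_; upTo; concatMap; cartesianProduct; length; filterᵇ)
open import Data.List.Membership.Propositional using (_∈_)
open import Data.List.Membership.Propositional.Properties using (∈-upTo⁺; ∈-cartesianProduct⁺; ∈-filter⁺; ∈-filter⁻)
open import Data.List.Membership.Propositional.Properties.WithK using (unique∧set⇒bag)
open import Data.List.Relation.Binary.BagAndSetEquality using (∼bag⇒↭)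
open import Data.List.Relation.Binary.Permutation.Propositional.Properties using (↭-length)
open import Data.List.Relation.Unary.All as All using ()
open import Data.List.Relation.Unary.AllPairs using (_∷_)
open import Data.List.Relation.Unary.Any using (here; there)
open import Data.List.Relation.Unary.Unique.Propositional using (Unique)
import Data.List.Relation.Unary.Unique.Propositional.Properties as Uniq
open import Data.Maybe using (Maybe; just; nothing; maybe)
open import Data.Nat using (ℕ; zero; suc; 2+; _+_; _*_; _∸_; _⊔_; _≡ᵇ_; _≤ᵇ_; _<ᵇ_; _≤_; _<_; z≤n; s≤s)
open import Data.Nat.ListAction using (sum)
open import Data.Nat.Properties
open import Data.Product using (Σ; _×_; _,_; proj₁; proj₂)
open import Data.Product.Properties using (≡-dec)
open import Data.Sum using (_⊎_; inj₁; inj₂)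
open import Function.Base using (_∘_)
open import Function.Bundles using (mk⇔)
open import Relation.Binary.Definitions using (tri<; tri≈; tri>)
open import Relation.Binary.PropositionalEquality
open import Relation.Nullary using (Dec; yes; no; does)

-- The delicate point is the change of phase. (S1′), and likewise (S4) and (S7), prime the active
-- box in mid-course, so an unprimed treatment turns into a primed one. This agrees with the order
-- of treatment because the windows force the preceding diagonal cell to be `low`: an unprimed a-box
-- still unmoved would lie weakly north-west of that cell or, for (S4) and (S7), in the column of
-- the diagonal a-box, where `column-un` excludes it. So none is left, and the late phase begins
-- with the same box in motion. A window cannot see whether the column or row entered by the active
-- box holds a settled box further away. The critical pattern is a primed b-box east of an unprimed
-- a-box, or an unprimed b-box north of a primed one. Its exclusion is handed from each box to the
-- next: `na` when a box stops, `nn` while none is active, `nx` when the next one starts; in the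
-- late phase `na₁`, `nn`, `na₂`. Cells below the diagonal get a value of their own, so that the
-- diagonal condition becomes a condition on neighbours and needs no coordinates.

pattern 3+ n = suc (2+ n)
pattern 4+ n = suc (3+ n)

-- Windows of cells, and their finite checks

-- The value of a cell at a stage: void below the diagonal; low and high for the boxes whose letters come before and
-- after a and b (and for the cells inside ν and outside λ); un, ac, se for an a-box which is unmoved, active or
-- settled; be for a b-box. The Boolean tells whether the entry is primed.
data V : Set where
  void low high : V
  un ac se be  : Bool → V

-- early: unprimed a-boxes are being treated; late: only primed ones are left.
data Phase : Set where
  early late : Phase

isVoid isAc isSe isBe isUn primedV : V → Bool
isVoid void = true
isVoid _ = false
isAc (ac _) = true
isAc _ = false
isSe (se _) = true
isSe _ = false
isBe (be _) = true
isBe _ = false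
isUn (un _) = true
isUn _ = false
primedV (un p) = p
primedV (ac p) = p
primedV (se p) = p
primedV (be p) = p
primedV _ = false

-- The active box shares rank 2 with the b-boxes, so monotonicity of ranks is not disturbed wherever
-- it stands among them. Only when it settles does it rise above them.
rankV : V → ℕ
rankV void = 0
rankV low = 0
rankV (un _) = 1
rankV (ac _) = 2
rankV (be _) = 2
rankV (se _) = 3
rankV high = 4

inA : V → Bool
inA v = isUn v ∨ (isAc v ∨ isSe v)

sameFam : V → V → Bool
sameFam v w = (inA v ∧ inA w) ∨ (isBe v ∧ isBe w)

-- `hor` concerns a cell and its east neighbour, `ver` a cell and its south neighbour. A cell that
-- is not `void` but has `void` to its west or south lies on the diagonal, so the first branch says
-- that diagonal entries are unprimed.
hor ver : V → V → Bool
hor v w = if isVoid v then not (primedV w)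
  else (not (isVoid w) ∧ ((rankV v ≤ᵇ rankV w) ∧ not (primedV w ∧ sameFam v w)))
ver v w = if isVoid w then not (primedV v)
  else (not (isVoid v) ∧ ((rankV v ≤ᵇ rankV w) ∧ not (not (primedV v) ∧ sameFam v w)))

eqB : Bool → Bool → Bool
eqB true b = b
eqB false b = not b

-- The two excluded windows at the diagonal are the intermediate states which the combined switches (S4), (S7), (S3) skip.
corner : V → V → V → V → Bool
corner a b c d = eqB (isVoid a) (isVoid d) ∧
  (not (isVoid c ∧ ((isUn a ∨ isAc a) ∧ (isBe b ∧ (isSe d ∨ isAc d)))) ∧
   not (isVoid c ∧ (isBe a ∧ (isAc b ∧ isBe d))))

allowed : Phase → V → Bool
allowed early (se true) = false
allowed early (ac true) = false
allowed late (un false) = false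
allowed late (ac false) = false
allowed _ _ = true

-- Testing `allowed` at the north-west value suffices, because every cell is the north-west one of
-- some window.
win : Phase → V → V → V → V → Bool
win φ a b c d = allowed φ a ∧ (hor a b ∧ (hor c d ∧ (ver a c ∧ (ver b d ∧ corner a b c d))))

-- The tableau conditions for the b-boxes on both sides of the hole formed by the active box.
aroundH aroundV : V → V → Bool
aroundH w e = not (isBe w ∧ (isBe e ∧ primedV e))
aroundV n s = not (isBe n ∧ (isBe s ∧ not (primedV n)))

isAct : Phase → V → Bool
isAct φ v = allowed φ v ∧ isAc v

dom : Phase → V → Bool
dom φ v = allowed φ v ∧ not (isAc v)

-- Statements about windows are reified so that one evaluation decides them. Each hypothesis stands
-- directly after the variables it speaks of: `eval` then drops a branch at the first failure,
-- whereas listing all values of a dozen cells beforehand would be out of reach.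
data Formula : Set where
  all : (V → Bool) → (V → Formula) → Formula
  _⇒_ : Bool → Formula → Formula
  _&_ : Formula → Formula → Formula
  end : Bool → Formula

infixr 4 _&_
infixr 3 _⇒_

⟦_⟧ : Formula → Set
⟦ all P f ⟧ = ∀ v → P v ≡ true → ⟦ f v ⟧
⟦ h ⇒ f ⟧ = h ≡ true → ⟦ f ⟧
⟦ f & g ⟧ = ⟦ f ⟧ × ⟦ g ⟧
⟦ end h ⟧ = h ≡ true

univ : List V
univ = void ∷ low ∷ high ∷ un false ∷ un true ∷ be false ∷ be true ∷ se false ∷ se true ∷ ac false ∷ ac true ∷ []

∈-univ : ∀ v → v ∈ univ
∈-univ void = here refl
∈-univ low = there (here refl)
∈-univ high = there (there (here refl))
∈-univ (un false) = there (there (there (here refl)))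
∈-univ (un true) = there (there (there (there (here refl))))
∈-univ (be false) = there (there (there (there (there (here refl)))))
∈-univ (be true) = there (there (there (there (there (there (here refl))))))
∈-univ (se false) = there (there (there (there (there (there (there (here refl)))))))
∈-univ (se true) = there (there (there (there (there (there (there (there (here refl))))))))
∈-univ (ac false) = there (there (there (there (there (there (there (there (there (here refl)))))))))
∈-univ (ac true) = there (there (there (there (there (there (there (there (there (there (here refl))))))))))

eval : Formula → Bool
eval (all P f) = List.all (λ v → if P v then eval (f v) else true) univ
eval (h ⇒ f) = if h then eval f else true
eval (f & g) = eval f ∧ eval g
eval (end h) = h

∧-l : ∀ {a b} → a ∧ b ≡ true → a ≡ true
∧-l {true} _ = refl
∧-r : ∀ {a b} → a ∧ b ≡ true → b ≡ true
∧-r {true} e = e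

all-sound : ∀ {A : Set} (k : A → Bool) {v xs} → List.all k xs ≡ true → v ∈ xs → k v ≡ true
all-sound k e (here refl) = ∧-l e
all-sound k {xs = x ∷ _} e (there m) = all-sound k (∧-r {k x} e) m

sound : ∀ f → eval f ≡ true → ⟦ f ⟧
sound (all P f) e v d with all-sound (λ w → if P w then eval (f w) else true) e (∈-univ v)
... | e' rewrite d = sound (f v) e'
sound (true ⇒ f) e h = sound f e
sound (f & g) e = sound f (∧-l e) , sound g (∧-r {eval f} e)
sound (end h) e = e

-- Window checks for moving, settling and activating boxes

any : V → Bool
any _ = true

-- With `noSettled` and `unprimedSettled` below, these guards carry non-local facts into a window
-- check. They hold by the order of treatment, which compares columns in the early phase and rows in
-- the late one; each guard is trivially true in the other phase.
notUnprimed noUnmoved : Phase → V → Bool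
notUnprimed early v = not (isUn v ∧ not (primedV v))
notUnprimed late v = true
noUnmoved early v = true
noUnmoved late v = not (isUn v)

noSettled : Phase → V → Bool
noSettled early v = not (isSe v)
noSettled late v = true

unprimedSettled : Phase → V → Bool
unprimedSettled early v = true
unprimedSettled late v = not (isSe v ∧ primedV v)

-- The active box x moves east, by (S1) or (S5). The window around it is named by compass points, with d = south-east.
eastF : Phase → Formula
eastF φ =
  all (isAct φ) λ x →
  all (dom φ) λ e → isBe e ⇒ hor x e ⇒
  all (dom φ) λ s → ver x s ⇒ not (isVoid s ∧ primedV e) ⇒ not (isBe s ∧ not (primedV e)) ⇒ noSettled φ s ⇒
  all (dom φ) λ d → win φ x e s d ⇒ noSettled φ d ⇒
  all (dom φ) λ n → ver n x ⇒ aroundV n s ⇒ notUnprimed φ n ⇒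
  all (dom φ) λ ne → win φ n ne x e ⇒ notUnprimed φ ne ⇒
  all (dom φ) λ w → hor w x ⇒ aroundH w e ⇒ noUnmoved φ w ⇒
  all (dom φ) λ nw → win φ nw n w x ⇒
  all (dom φ) λ sw → win φ w x sw s ⇒
  all (dom φ) λ ee → hor e ee ⇒ unprimedSettled φ ee ⇒
  all (dom φ) λ nee → win φ ne nee e ee ⇒ notUnprimed φ nee ⇒
  all (dom φ) λ dee → win φ e ee d dee ⇒
   end (win φ nw n w e) & end (win φ n ne e x) & end (win φ ne nee x ee) &
   end (win φ w e sw s) & end (win φ e x s d) & end (win φ x ee d dee) &
   end (aroundH e ee) & end (aroundV ne d) & end (not (isBe ne ∧ not (primedV ne)))

eastL : ∀ φ → ⟦ eastF φ ⟧
eastL early = sound (eastF early) refl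
eastL late = sound (eastF late) refl

-- If the south-west cell is `void`, the box south of the active one is on the diagonal. Then an
-- early active box falls under (S4) or (S7) when its west neighbour is an unmoved a-box, and a late
-- one always under (S2′) or (S6′); all these are set aside here.
special : Phase → V → V → Bool
special early w sw = not (isVoid sw ∧ isUn w)
special late w sw = not (isVoid sw)

-- The active box moves south, by (S2) or (S6).
southF : Phase → Formula
southF φ =
  all (isAct φ) λ x →
  all (dom φ) λ s → isBe s ⇒ ver x s ⇒
  all (dom φ) λ e → hor x e ⇒ not (isBe e ∧ primedV e) ⇒
  all (dom φ) λ d → win φ x e s d ⇒ unprimedSettled φ d ⇒
  all (dom φ) λ w → hor w x ⇒ aroundH w e ⇒ noUnmoved φ w ⇒
  all (dom φ) λ sw → win φ w x sw s ⇒ special φ w sw ⇒ noUnmoved φ sw ⇒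
  all (dom φ) λ n → ver n x ⇒ aroundV n s ⇒ notUnprimed φ n ⇒
  all (dom φ) λ nw → win φ nw n w x ⇒
  all (dom φ) λ ne → win φ n ne x e ⇒ notUnprimed φ ne ⇒
  all (dom φ) λ ss → ver s ss ⇒ noSettled φ ss ⇒
  all (dom φ) λ ssw → win φ sw s ssw ss ⇒
  all (dom φ) λ ssd → win φ s d ss ssd ⇒
   end (win φ nw n w s) & end (win φ n ne s e) & end (win φ w s sw x) &
   end (win φ s e x d) & end (win φ sw x ssw ss) & end (win φ x d ss ssd) &
   end (aroundH sw d) & end (aroundV s ss) & end (not (isBe d)) & end (not ((isUn w ∧ not (primedV w)) ∧ primedV s))

southL : ∀ φ → ⟦ southF φ ⟧
southL early = sound (southF early) refl
southL late = sound (southF late) refl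

-- The cells around the square a b / c d are named p q r s on top, t .. u and v .. w at the sides, x y z o below.
frame : Phase → (a b c d : V) →
        ((p q r s t u v w : V) → Bool) → Phase → (a' b' c' d' : V) → ((p q r u : V) → Formula) → Formula
frame φ a b c d pre φ' a' b' c' d' post =
  all (dom φ) λ q → ver q a ⇒
  all (dom φ) λ r → win φ q r a b ⇒
  all (dom φ) λ t → hor t a ⇒
  all (dom φ) λ p → win φ p q t a ⇒
  all (dom φ) λ v → win φ t a v c ⇒
  all (dom φ) λ u → hor b u ⇒
  all (dom φ) λ s → win φ r s b u ⇒
  all (dom φ) λ w → win φ b u d w ⇒ pre p q r s t u v w ⇒
  all (dom φ) λ y → ver c y ⇒
  all (dom φ) λ x → win φ v c x y ⇒
  all (dom φ) λ z → win φ c d y z ⇒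
  all (dom φ) λ o → win φ d w z o ⇒
   end (win φ' p q t a') & end (win φ' q r a' b') & end (win φ' r s b' u) &
   end (win φ' t a' v c') & end (win φ' a' b' c' d') & end (win φ' b' u d' w) &
   end (win φ' v c' x y) & end (win φ' c' d' y z) & end (win φ' d' w z o) & post p q r u

isLow : V → Bool
isLow low = true
isLow _ = false

-- The switches at the diagonal: (S3), (S1′), then (S2′) and (S6′) together, then (S4) and (S7) together.
s3F s1′F s26′F s47F : Formula
s3F =
  all (isAct early) λ a →
  all (dom early) λ b → isBe b ⇒ primedV b ⇒
  all (dom early) λ c → isVoid c ⇒
  all (dom early) λ d → isBe d ⇒ win early a b c d ⇒
  frame early a b c d (λ p q r s t u v w → notUnprimed early q ∧ (notUnprimed early r ∧
      (notUnprimed early s ∧ aroundH t b)))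
        early d (be false) c (se false) (λ _ _ _ _ → end (not (primedV d)))
s1′F =
  all (isAct early) λ a →
  all (dom early) λ b → isBe b ⇒ primedV b ⇒
  all (dom early) λ c → isVoid c ⇒
  all (dom early) λ d → not (isBe d) ⇒ win early a b c d ⇒
  frame early a b c d (λ p q r s t u v w → notUnprimed early q ∧ (notUnprimed early r ∧
      (notUnprimed early s ∧ aroundH t b)))
        late (be false) (ac true) c d
        (λ p q r u → end (aroundH (be false) u) & end (isLow p) & end (not (isBe r ∧ not (primedV r))))
s26′F =
  all (isAct late) λ b →
  all (dom late) λ c → isVoid c ⇒
  all (dom late) λ d → isBe d ⇒
  all (dom late) λ a → win late a b c d ⇒ noUnmoved late a ⇒
  frame late a b c d (λ p q r s t u v w → not (isBe u ∧ primedV u) ∧ (aroundV r d ∧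
      (aroundH a u ∧ unprimedSettled late w)))
        late a (be true) c (se false) (λ p q r u → end true)
s47F =
  all (isAct early) λ b →
  all (dom early) λ c → isVoid c ⇒
  all (dom early) λ d → isBe d ⇒
  all (dom early) λ a → win early a b c d ⇒ isUn a ⇒
  frame early a b c d (λ p q r s t u v w → not (isBe u ∧ primedV u) ∧ (aroundV r d ∧
      (notUnprimed early r ∧ notUnprimed early s)))
        late d (ac true) c (se false)
        (λ p q r u → end (aroundH d u) & end (isLow p) & end (not (isUn q ∧ not (primedV q))) & end (not (isBe r ∧ not
            (primedV r))))

s3L : ⟦ s3F ⟧
s3L = sound s3F refl
s1′L : ⟦ s1′F ⟧
s1′L = sound s1′F refl
s26′L : ⟦ s26′F ⟧
s26′L = sound s26′F refl
s47L : ⟦ s47F ⟧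
s47L = sound s47F refl

-- `half` settles an unprimed box and lets a primed one wait: a box may be past its turn as an
-- unprimed box while the primed boxes around it have not had theirs.
data Mode : Set where
  keep half settle activate : Mode

mark : Mode → Bool → V
mark keep p = un p
mark half false = se false
mark half true = un true
mark settle p = se p
mark activate p = ac p

relabel : Mode → V → V
relabel m (un p) = mark m p
relabel m v = v

settles : Mode → V → Bool
settles m v = isUn v ∧ isSe (relabel m v)

_⟶_ : Bool → Bool → Bool
a ⟶ b = not a ∨ b

modeOK : Phase → Mode → V → Bool
modeOK φ' activate v = isUn v ∧ allowed φ' (relabel activate v)
modeOK φ' _ v = true

-- Settling lifts an a-box from rank 1 to rank 3, past the b-boxes. The guards with `settles`
-- exclude b-boxes to its east and south, where this would break monotonicity.
relF : Phase → Phase → Mode → Mode → Mode → Mode → Formula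
relF φ φ' m₁ m₂ m₃ m₄ =
  all (dom φ) λ a → modeOK φ' m₁ a ⇒
  all (dom φ) λ b → modeOK φ' m₂ b ⇒ (settles m₁ a ⟶ not (isBe b)) ⇒
  all (dom φ) λ c → modeOK φ' m₃ c ⇒ (settles m₁ a ⟶ not (isBe c)) ⇒
  all (dom φ) λ d → modeOK φ' m₄ d ⇒ (settles m₂ b ⟶ not (isBe d)) ⇒ (settles m₃ c ⟶ not (isBe d)) ⇒
  win φ a b c d ⇒ end (win φ' (relabel m₁ a) (relabel m₂ b) (relabel m₃ c) (relabel m₄ d))

retire : V → V
retire (ac p) = se p
retire v = v

-- The same for the active box, which rises from rank 2 to rank 3 when it has no b-neighbour any
-- more.
retF : Phase → Formula
retF φ =
  all (allowed φ) λ a →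
  all (allowed φ) λ b → (isAc a ⟶ not (isBe b)) ⇒
  all (allowed φ) λ c → (isAc a ⟶ not (isBe c)) ⇒
  all (allowed φ) λ d → (isAc b ⟶ not (isBe d)) ⇒ (isAc c ⟶ not (isBe d)) ⇒
  win φ a b c d ⇒ end (win φ (retire a) (retire b) (retire c) (retire d))

retireL : ∀ φ → ⟦ retF φ ⟧
retireL early = sound (retF early) refl
retireL late = sound (retF late) refl

-- Before a box is activated, the boxes which come later in the order of treatment have no b-neighbour, and are settled:
-- those in columns further east (early), or those in rows further south together with all unprimed ones (late).
-- EPat and LPat list the combinations of modes that occur in a window.
data EPat : Mode → Mode → Mode → Mode → Set where
  kkkk : EPat keep keep keep keep
  kk:h : EPat keep half keep half
  hhhh : EPat half half half half
  tl : EPat activate half keep half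
  tr : EPat keep activate keep keep
  bl : EPat keep half activate half
  br : EPat keep keep keep activate

data LPat : Mode → Mode → Mode → Mode → Set where
  hhhh : LPat half half half half
  hh:s : LPat half half settle settle
  ssss : LPat settle settle settle settle
  tl : LPat activate half settle settle
  tr : LPat half activate settle settle
  bl : LPat half half activate half
  br : LPat half half half activate

relabelE : ∀ {m₁ m₂ m₃ m₄} → EPat m₁ m₂ m₃ m₄ → ⟦ relF early early m₁ m₂ m₃ m₄ ⟧
relabelE kkkk = sound (relF early early keep keep keep keep) refl
relabelE kk:h = sound (relF early early keep half keep half) refl
relabelE hhhh = sound (relF early early half half half half) refl
relabelE tl = sound (relF early early activate half keep half) refl
relabelE tr = sound (relF early early keep activate keep keep) refl
relabelE bl = sound (relF early early keep half activate half) refl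
relabelE br = sound (relF early early keep keep keep activate) refl

relabelL : ∀ φ {m₁ m₂ m₃ m₄} → LPat m₁ m₂ m₃ m₄ → ⟦ relF φ late m₁ m₂ m₃ m₄ ⟧
relabelL early hhhh = sound (relF early late half half half half) refl
relabelL early hh:s = sound (relF early late half half settle settle) refl
relabelL early ssss = sound (relF early late settle settle settle settle) refl
relabelL early tl = sound (relF early late activate half settle settle) refl
relabelL early tr = sound (relF early late half activate settle settle) refl
relabelL early bl = sound (relF early late half half activate half) refl
relabelL early br = sound (relF early late half half half activate) refl
relabelL late hhhh = sound (relF late late half half half half) refl
relabelL late hh:s = sound (relF late late half half settle settle) refl
relabelL late ssss = sound (relF late late settle settle settle settle) refl
relabelL late tl = sound (relF late late activate half settle settle) refl
relabelL late tr = sound (relF late late half activate settle settle) refl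
relabelL late bl = sound (relF late late half half activate half) refl
relabelL late br = sound (relF late late half half half activate) refl

-- Grids of values

true≢false : ∀ {b : Bool} → b ≡ true → b ≡ false → ⊥
true≢false refl ()

¬true⇒false : ∀ {b} → (b ≡ true → ⊥) → b ≡ false
¬true⇒false {true} h = ⊥-elim (h refl)
¬true⇒false {false} h = refl

not-intro : ∀ {b} → b ≡ false → not b ≡ true
not-intro refl = refl

not-elim : ∀ {b} → not b ≡ true → b ≡ false
not-elim {false} _ = refl

∧-i : ∀ {a b} → a ≡ true → b ≡ true → a ∧ b ≡ true
∧-i refl refl = refl

≤ᵇ⇒≤′ : ∀ {m n} → (m ≤ᵇ n) ≡ true → m ≤ n
≤ᵇ⇒≤′ {m} e = ≤ᵇ⇒≤ m _ (subst T (sym e) _)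

<ᵇ-false : ∀ {m n} → (m <ᵇ n) ≡ false → n ≤ m
<ᵇ-false {m} {n} e = ≮⇒≥ (λ m<n → subst T e (<⇒<ᵇ m<n))

<ᵇ-true : ∀ {m n} → (m <ᵇ n) ≡ true → m < n
<ᵇ-true {m} {n} e = <ᵇ⇒< m n (subst T (sym e) _)

Grid : Set
Grid = ℕ → ℕ → V

-- A record instead of the bare equation, which would compute: from a `Win` the four values can be
-- inferred.
record Win (φ : Phase) (a b c d : V) : Set where
  constructor mkWin
  field holds : win φ a b c d ≡ true
open Win public

WinAt : Phase → Grid → ℕ → ℕ → Set
WinAt φ g k l = Win φ (g k l) (g k (suc l)) (g (suc k) l) (g (suc k) (suc l))

module _ {φ : Phase} {a b c d : V} (e : Win φ a b c d) where
  private
    e₁ = ∧-r {allowed φ a} (holds e)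
    e₂ = ∧-r {hor c d} (∧-r {hor a b} e₁)
  win-allowed : allowed φ a ≡ true
  win-allowed = ∧-l (holds e)
  win-hor : hor a b ≡ true
  win-hor = ∧-l e₁
  win-ver : ver a c ≡ true
  win-ver = ∧-l e₂
  win-late : ∀ φ' → allowed φ' a ≡ true → Win φ' a b c d
  win-late φ' h = mkWin (∧-i h e₁)

record Base (φ : Phase) (g : Grid) : Set where
  field
    wins : ∀ k l → WinAt φ g k l
    tri  : ∀ k l → isVoid (g k l) ≡ (l <ᵇ k)

  inside : ∀ {k l} → isVoid (g k l) ≡ false → k ≤ l
  inside {k} {l} e = <ᵇ-false (trans (sym (tri k l)) e)

  inside′ : ∀ {k l} → k ≤ l → isVoid (g k l) ≡ false
  inside′ {k} {l} h = trans (tri k l) (¬true⇒false λ e → <-irrefl refl (≤-trans (<ᵇ-true e) h))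

  hor-rank : ∀ {v w} → isVoid v ≡ false → hor v w ≡ true → rankV v ≤ rankV w
  hor-rank {v} {w} o h rewrite o = ≤ᵇ⇒≤′ (∧-l (∧-r {not (isVoid w)} h))

  ver-rank : ∀ {v w} → isVoid w ≡ false → ver v w ≡ true → rankV v ≤ rankV w
  ver-rank {v} {w} o h rewrite o = ≤ᵇ⇒≤′ (∧-l (∧-r {not (isVoid v)} h))

  rowMono′ : ∀ {k l} m → k ≤ l → rankV (g k l) ≤ rankV (g k (m + l))
  rowMono′ zero h = ≤-refl
  rowMono′ {k} {l} (suc m) h = ≤-trans (rowMono′ m h)
    (hor-rank {g k (m + l)} (inside′ (≤-trans h (m≤n+m l m))) (win-hor (wins k (m + l))))

  rowMono : ∀ {k l l'} → k ≤ l → l ≤ l' → rankV (g k l) ≤ rankV (g k l')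
  rowMono {k} {l} {l'} h h' = subst (λ n → rankV (g k l) ≤ rankV (g k n)) (m∸n+n≡m h') (rowMono′ (l' ∸ l) h)

  colMono′ : ∀ {k l} m → m + k ≤ l → rankV (g k l) ≤ rankV (g (m + k) l)
  colMono′ zero h = ≤-refl
  colMono′ {k} {l} (suc m) h = ≤-trans (colMono′ m (≤-trans (n≤1+n _) h))
    (ver-rank {g (m + k) l} (inside′ h) (win-ver (wins (m + k) l)))

  colMono : ∀ {k k' l} → k ≤ k' → k' ≤ l → rankV (g k l) ≤ rankV (g k' l)
  colMono {k} {k'} {l} h h' = subst (λ n → rankV (g k l) ≤ rankV (g n l)) (m∸n+n≡m h)
    (colMono′ (k' ∸ k) (subst (_≤ l) (sym (m∸n+n≡m h)) h'))

data Sel : Set where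
  first second other : Sel

sel : ℕ → ℕ → Sel
sel zero zero = first
sel zero (suc zero) = second
sel zero (suc (suc _)) = other
sel (suc i) zero = other
sel (suc i) (suc k) = sel i k

pick : (a b c d v : V) → Sel → Sel → V
pick a b c d v other _ = v
pick a b c d v first first = a
pick a b c d v first second = b
pick a b c d v second first = c
pick a b c d v second second = d
pick a b c d v first other = v
pick a b c d v second other = v

-- Every move is confined to a square of two by two cells, which `put` overwrites. It is opaque, so
-- that proofs reach it through `put-elim`, `put-wins` and the equations for the single cells.
opaque
  put : ℕ → ℕ → (a b c d : V) → Grid → Grid
  put i j a b c d g k l = pick a b c d (g k l) (sel i k) (sel j l)

data SelView (i : ℕ) : ℕ → Sel → Set where
  isFirst  : SelView i i first
  isSecond : SelView i (suc i) second
  isOther  : ∀ {k} → k ≢ i → k ≢ suc i → SelView i k other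

selView : ∀ i k → SelView i k (sel i k)
selView zero zero = isFirst
selView zero (suc zero) = isSecond
selView zero (2+ k) = isOther (λ ()) (λ ())
selView (suc i) zero = isOther (λ ()) (λ ())
selView (suc i) (suc k) with sel i k | selView i k
... | _ | isFirst = isFirst
... | _ | isSecond = isSecond
... | _ | isOther p q = isOther (λ e → p (suc-injective e)) (λ e → q (suc-injective e))

Outside : (i j k l : ℕ) → Set
Outside i j k l = (k ≢ i × k ≢ suc i) ⊎ (l ≢ j × l ≢ suc j)

opaque
  unfolding put
  put-elim : ∀ {i j a b c d g} (P : ℕ → ℕ → V → Set) →
    P i j a → P i (suc j) b → P (suc i) j c → P (suc i) (suc j) d →
    (∀ k l → Outside i j k l → P k l (g k l)) → ∀ k l → P k l (put i j a b c d g k l)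
  put-elim {i} {j} P pa pb pc pd po k l with sel i k | selView i k | sel j l | selView j l
  ... | _ | isOther p q | _ | _ = po k l (inj₁ (p , q))
  ... | _ | isFirst | _ | isFirst = pa
  ... | _ | isFirst | _ | isSecond = pb
  ... | _ | isSecond | _ | isFirst = pc
  ... | _ | isSecond | _ | isSecond = pd
  ... | _ | isFirst | _ | isOther p q = po k l (inj₂ (p , q))
  ... | _ | isSecond | _ | isOther p q = po k l (inj₂ (p , q))

sel-first : ∀ i → sel i i ≡ first
sel-first zero = refl
sel-first (suc i) = sel-first i

sel-second : ∀ i → sel i (suc i) ≡ second
sel-second zero = refl
sel-second (suc i) = sel-second i

sel-before : ∀ i → sel (suc i) i ≡ other
sel-before zero = refl
sel-before (suc i) = sel-before i

sel-after : ∀ i → sel i (2+ i) ≡ other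
sel-after zero = refl
sel-after (suc i) = sel-after i

-- The upper row of a window relative to a square in rows `suc i` and `2+ i`. Windows touch the
-- square for three upper rows and, likewise, three left columns; these are the windows collected in
-- `Nine`.
data Row (i : ℕ) : ℕ → Set where
  top  : Row i i
  mid  : Row i (suc i)
  bot  : Row i (2+ i)
  away : ∀ {k} → sel (suc i) k ≡ other → sel (suc i) (suc k) ≡ other → Row i k

row : ∀ i k → Row i k
row zero zero = top
row zero (suc zero) = mid
row zero (2+ zero) = bot
row zero (3+ k) = away refl refl
row (suc i) zero = away refl refl
row (suc i) (suc k) with row i k
... | top = top
... | mid = mid
... | bot = bot
... | away p q = away p q

Nine : Phase → ℕ → ℕ → (a b c d : V) → Grid → Set
Nine φ i j a b c d g =
  Win φ (g i j) (g i (suc j)) (g (suc i) j) a ×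
  Win φ (g i (suc j)) (g i (2+ j)) a b ×
  Win φ (g i (2+ j)) (g i (3+ j)) b (g (suc i) (3+ j)) ×
  Win φ (g (suc i) j) a (g (2+ i) j) c ×
  Win φ a b c d ×
  Win φ b (g (suc i) (3+ j)) d (g (2+ i) (3+ j)) ×
  Win φ (g (2+ i) j) c (g (3+ i) j) (g (3+ i) (suc j)) ×
  Win φ c d (g (3+ i) (suc j)) (g (3+ i) (2+ j)) ×
  Win φ d (g (2+ i) (3+ j)) (g (3+ i) (2+ j)) (g (3+ i) (3+ j))

opaque
  unfolding put
  put-wins : ∀ {φ} i j {a b c d g} → Nine φ i j a b c d g →
    (∀ k l → sel (suc i) k ≡ other ⊎ sel (suc j) l ≡ other → WinAt φ g k l) →
    ∀ k l → WinAt φ (put (suc i) (suc j) a b c d g) k l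
  put-wins i j n w k l with row i k | row j l
  ... | away p q | _ rewrite p | q = w k l (inj₁ p)
  put-wins i j n w .i l | top | away p q rewrite sel-before i | sel-first i | p | q = w i l (inj₁ (sel-before i))
  put-wins i j n w .(suc i) l | mid | away p q rewrite sel-first i | sel-second i | p | q = w (suc i) l (inj₂ p)
  put-wins i j n w .(2+ i) l | bot | away p q rewrite sel-second i | sel-after i | p | q = w (2+ i) l (inj₂ p)
  put-wins i j n w .i .j | top | top rewrite sel-before i | sel-first i | sel-before j | sel-first j = proj₁ n
  put-wins i j n w .i .(suc j) | top | mid rewrite sel-before i | sel-first i | sel-second j | sel-first j = proj₁
      (proj₂ n)
  put-wins i j n w .i .(2+ j) | top | bot rewrite sel-before i | sel-first i | sel-second j | sel-after j = proj₁
      (proj₂ (proj₂ n))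
  put-wins i j n w .(suc i) .j | mid | top rewrite sel-first i | sel-second i | sel-before j | sel-first j = proj₁
      (proj₂ (proj₂ (proj₂ n)))
  put-wins i j n w .(suc i) .(suc j) | mid | mid rewrite sel-first i | sel-second i | sel-second j | sel-first j = proj₁ (proj₂ (proj₂ (proj₂ (proj₂ n))))
  put-wins i j n w .(suc i) .(2+ j) | mid | bot rewrite sel-first i | sel-second i | sel-second j | sel-after j = proj₁ (proj₂ (proj₂ (proj₂ (proj₂ (proj₂ n)))))
  put-wins i j n w .(2+ i) .j | bot | top rewrite sel-second i | sel-after i | sel-before j | sel-first j = proj₁
      (proj₂ (proj₂ (proj₂ (proj₂ (proj₂ (proj₂ n))))))
  put-wins i j n w .(2+ i) .(suc j) | bot | mid rewrite sel-second i | sel-after i | sel-second j | sel-first j = proj₁ (proj₂ (proj₂ (proj₂ (proj₂ (proj₂ (proj₂ (proj₂ n)))))))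
  put-wins i j n w .(2+ i) .(2+ j) | bot | bot rewrite sel-second i | sel-after i | sel-second j | sel-after j = proj₂
      (proj₂ (proj₂ (proj₂ (proj₂ (proj₂ (proj₂ (proj₂ n)))))))

module _ {i j : ℕ} {a b c d : V} {g : Grid} where
  opaque
    unfolding put
    put-11 : put i j a b c d g i j ≡ a
    put-11 rewrite sel-first i | sel-first j = refl
    put-12 : put i j a b c d g i (suc j) ≡ b
    put-12 rewrite sel-first i | sel-second j = refl
    put-21 : put i j a b c d g (suc i) j ≡ c
    put-21 rewrite sel-second i | sel-first j = refl
    put-22 : put i j a b c d g (suc i) (suc j) ≡ d
    put-22 rewrite sel-second i | sel-second j = refl
    put-out : ∀ {k l} → Outside i j k l → put i j a b c d g k l ≡ g k l
    put-out {k} {l} o with sel i k | selView i k | sel j l | selView j l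
    ... | _ | isOther p q | _ | _ = refl
    put-out o | _ | isFirst | _ | isOther p q = refl
    put-out o | _ | isSecond | _ | isOther p q = refl
    put-out (inj₁ (p , q)) | _ | isFirst | _ | isFirst = ⊥-elim (p refl)
    put-out (inj₂ (p , q)) | _ | isFirst | _ | isFirst = ⊥-elim (p refl)
    put-out (inj₁ (p , q)) | _ | isFirst | _ | isSecond = ⊥-elim (p refl)
    put-out (inj₂ (p , q)) | _ | isFirst | _ | isSecond = ⊥-elim (q refl)
    put-out (inj₁ (p , q)) | _ | isSecond | _ | isFirst = ⊥-elim (q refl)
    put-out (inj₂ (p , q)) | _ | isSecond | _ | isFirst = ⊥-elim (p refl)
    put-out (inj₁ (p , q)) | _ | isSecond | _ | isSecond = ⊥-elim (q refl)
    put-out (inj₂ (p , q)) | _ | isSecond | _ | isSecond = ⊥-elim (q refl)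

put-tri : ∀ {i j a b c d g} → isVoid a ≡ isVoid (g i j) → isVoid b ≡ isVoid (g i (suc j)) →
  isVoid c ≡ isVoid (g (suc i) j) → isVoid d ≡ isVoid (g (suc i) (suc j)) →
  (∀ k l → isVoid (g k l) ≡ (l <ᵇ k)) → ∀ k l → isVoid (put i j a b c d g k l) ≡ (l <ᵇ k)
put-tri {i} {j} {a} {b} {c} {d} {g} pa pb pc pd t = put-elim (λ k l v → isVoid v ≡ (l <ᵇ k))
  (trans pa (t _ _)) (trans pb (t _ _)) (trans pc (t _ _)) (trans pd (t _ _)) (λ k l _ → t k l)

-- The a-boxes are treated from east to west, then the primed ones from south to north. For the active box at
-- (suc i , suc j), o1 and o2 place it between the unmoved and the settled boxes; the other fields keep it (nx, na₂), and
-- the boxes treated after it (na, na₁), from being led to the column or row of a settled box.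
record OrderE (g : Grid) (i j : ℕ) : Set where
  field
    o1 : ∀ k l → g k l ≡ un false → l < suc j
    o2 : ∀ k l → isSe (g k l) ≡ true → suc j < l
    nx : g (suc i) (2+ j) ≡ be true → ∀ k → isSe (g k (2+ j)) ≡ true → ⊥
    na : ∀ k → g k j ≡ un false → g k (suc j) ≡ be true → k < suc i → ⊥

record OrderL (g : Grid) (i j : ℕ) : Set where
  field
    o1 : ∀ k l → isUn (g k l) ≡ true → k < suc i
    o2 : ∀ k l → g k l ≡ se true → suc i < k
    na₁ : isBe (g (suc i) j) ≡ true → g i (suc j) ≡ be false → ∀ m → m < suc j → isUn (g i m) ≡ true → ⊥
    na₂ : ∀ l → suc j < suc l → g (2+ i) (suc l) ≡ se true → isBe (g (2+ i) l) ≡ true →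
          g (suc i) (suc l) ≡ be false → ⊥

Order : Phase → Grid → ℕ → ℕ → Set
Order early = OrderE
Order late = OrderL

-- What survives of `OrderE` while no box is active. `nn` follows from `na` of the box that has
-- stopped and yields `nx` for the next one; in `IdleL` it mediates in the same way between `na₁`
-- and `na₂`.
record IdleE (g : Grid) : Set where
  field
    o2 : ∀ k l k' l' → g k l ≡ un false → isSe (g k' l') ≡ true → l < l'
    nn : ∀ k l k' → g k l ≡ un false → g k (suc l) ≡ be true → k < k' → isSe (g k' (suc l)) ≡ true → ⊥

record IdleL (g : Grid) : Set where
  field
    o2 : ∀ k l k' l' → isUn (g k l) ≡ true → g k' l' ≡ se true → k < k'
    nn : ∀ k l m → g (suc k) (suc l) ≡ se true → isBe (g (suc k) l) ≡ true → g k (suc l) ≡ be false →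
         m < suc l → isUn (g k m) ≡ true → ⊥

IdleOrder : Phase → Grid → Set
IdleOrder early = IdleE
IdleOrder late = IdleL

-- `ah` and `av` compare the b-boxes on opposite sides of the active box. These become neighbours
-- when it leaves, and no window contains both.
record Active (φ : Phase) (g : Grid) (i j : ℕ) : Set where
  field
    base : Base φ g
    at   : isAct φ (g (suc i) (suc j)) ≡ true
    uniq : ∀ k l → isAc (g k l) ≡ true → k ≡ suc i × l ≡ suc j
    ah   : aroundH (g (suc i) j) (g (suc i) (2+ j)) ≡ true
    av   : aroundV (g i (suc j)) (g (2+ i) (suc j)) ≡ true
    ord  : Order φ g i j
  open Base base public

record Idle (φ : Phase) (g : Grid) : Set where
  field
    base : Base φ g
    noAc : ∀ k l → isAc (g k l) ≡ false
    ord  : IdleOrder φ g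
  open Base base public

suc≢ : ∀ {j : ℕ} → suc j ≢ j
suc≢ {j} e = <-irrefl (sym e) (n<1+n j)

be≢un : ∀ {v p} → isBe v ≡ true → v ≡ un p → ⊥
be≢un () refl
ac≢un : ∀ {v p} → isAc v ≡ true → v ≡ un p → ⊥
ac≢un () refl
be≢ac : ∀ {v} → isBe v ≡ true → isAc v ≡ true → ⊥
be≢ac {be _} _ ()
be≢se : ∀ {v} → isBe v ≡ true → isSe v ≡ true → ⊥
be≢se {be _} _ ()
ac≢se : ∀ {v} → isAc v ≡ true → isSe v ≡ true → ⊥
ac≢se {ac _} _ ()
se-rank : ∀ {v} → isSe v ≡ true → rankV v ≡ 3
se-rank {se _} _ = refl
be-rank : ∀ {v} → isBe v ≡ true → rankV v ≡ 2
be-rank {be _} _ = refl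
ac-rank : ∀ {v} → isAc v ≡ true → rankV v ≡ 2
ac-rank {ac _} _ = refl
un-rank : ∀ {v} → isUn v ≡ true → rankV v ≡ 1
un-rank {un _} _ = refl
se-off : ∀ {v} → isSe v ≡ true → isVoid v ≡ false
se-off {se _} _ = refl
be-off : ∀ {v} → isBe v ≡ true → isVoid v ≡ false
be-off {be _} _ = refl
ac-off : ∀ {v} → isAc v ≡ true → isVoid v ≡ false
ac-off {ac _} _ = refl
un-off : ∀ {v} → isUn v ≡ true → isVoid v ≡ false
un-off {un _} _ = refl
isAct-ac : ∀ φ {v} → isAct φ v ≡ true → isAc v ≡ true
isAct-ac φ {v} h = ∧-r {allowed φ v} h
be-true : ∀ {v} → isBe v ≡ true → primedV v ≡ true → v ≡ be true
be-true {be true} _ _ = refl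
be-false : ∀ {v} → isBe v ≡ true → primedV v ≡ false → v ≡ be false
be-false {be false} _ _ = refl

un-false : ∀ {v} → isUn v ∧ not (primedV v) ≡ true → v ≡ un false
un-false {un false} _ = refl
se-true : ∀ {v} → isSe v ∧ primedV v ≡ true → v ≡ se true
se-true {se true} _ = refl

notUnprimed-I : ∀ {v} → (v ≡ un false → ⊥) → notUnprimed early v ≡ true
notUnprimed-I h = not-intro (¬true⇒false (λ e → h (un-false e)))

unprimedI : ∀ {v} → (v ≡ se true → ⊥) → unprimedSettled late v ≡ true
unprimedI h = not-intro (¬true⇒false (λ e → h (se-true e)))

module Around {φ : Phase} {g : Grid} {i j : ℕ} (A : Active φ g i j) where
  open Active A public

  hac : isAc (g (suc i) (suc j)) ≡ true
  hac = isAct-ac φ at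

  i≤j : i ≤ j
  i≤j = ≤-pred (inside (ac-off hac))

  nb : ∀ k l → (k ≡ suc i → l ≡ suc j → ⊥) → dom φ (g k l) ≡ true
  nb k l h = ∧-i (win-allowed (wins k l)) (not-intro (¬true⇒false λ a → h (proj₁ (uniq k l a)) (proj₂ (uniq k l a))))

  W : ∀ k l → win φ (g k l) (g k (suc l)) (g (suc k) l) (g (suc k) (suc l)) ≡ true
  W k l = holds (wins k l)

notUnprimedφ : ∀ φ {g i j} → Active φ g i j → ∀ k l → suc j ≤ l → notUnprimed φ (g k l) ≡ true
notUnprimedφ early A k l h = notUnprimed-I λ e → <-irrefl refl (<-≤-trans (OrderE.o1 (Active.ord A) k l e) h)
notUnprimedφ late A k l h = refl

noUnmovedφ : ∀ φ {g i j} → Active φ g i j → ∀ k l → suc i ≤ k → noUnmoved φ (g k l) ≡ true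
noUnmovedφ early A k l h = refl
noUnmovedφ late A k l h = not-intro (¬true⇒false λ e → <-irrefl refl (<-≤-trans (OrderL.o1 (Active.ord A) k l e) h))

noSettledφ : ∀ φ {g i j} → Active φ g i j → ∀ k l → l ≤ suc j → noSettled φ (g k l) ≡ true
noSettledφ early A k l h = not-intro (¬true⇒false λ e → <-irrefl refl (<-≤-trans (OrderE.o2 (Active.ord A) k l e) h))
noSettledφ late A k l h = refl

unprimedSettledφ : ∀ φ {g i j} → Active φ g i j → ∀ k l → k ≤ suc i → unprimedSettled φ (g k l) ≡ true
unprimedSettledφ early A k l h = refl
unprimedSettledφ late A k l h = unprimedI λ e → <-irrefl refl (<-≤-trans (OrderL.o2 (Active.ord A) k l e) h)

-- South of the active box the rank is at least 2 unless the cell is `void`. Being neither a b-box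
-- nor settled, the cell `s` is then `high`, which forces `d` to be `high`. If `s` is `void`, a
-- settled `d` is the first window excluded by `corner`.
cornerF : Formula
cornerF = all (isAct early) λ x → all (dom early) λ e → isBe e ⇒ all (dom early) λ s → not (isSe s) ⇒ not (isBe s) ⇒
  all (dom early) λ d → win early x e s d ⇒ end ((isVoid s ∧ not (isSe d)) ∨ (not (isVoid s) ∧ isHigh d))
  where
  isHigh : V → Bool
  isHigh high = true
  isHigh _ = false

cornerL : ⟦ cornerF ⟧
cornerL = sound cornerF refl

-- No settled box shares the column which the active box enters.
module _ {g i j} (A : Active early g i j) where
  open Around A
  open OrderE ord

  noSettledNext : isBe (g (suc i) (2+ j)) ≡ true →
    not (isBe (g (2+ i) (suc j)) ∧ not (primedV (g (suc i) (2+ j)))) ≡ true →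
    ∀ k → isSe (g k (2+ j)) ≡ true → ⊥
  -- A primed east neighbour is the case of `nx`. Otherwise `hc` says that the south neighbour is no
  -- b-box: settled boxes in the rows up to `suc i` contradict monotonicity of ranks, those further
  -- south the corner check.
  noSettledNext he hc k hz with primedV (g (suc i) (2+ j)) in pe
  ... | true = nx (be-true he pe) k hz
  ... | false with k ≤? suc i
  ... | yes k≤ = <-irrefl refl (≤-trans (≤-reflexive (sym (se-rank hz)))
          (≤-trans (colMono k≤ (s≤s (m≤n⇒m≤1+n i≤j))) (≤-reflexive (be-rank he))))
  ... | no k≰ with cornerL (g (suc i) (suc j)) at (g (suc i) (2+ j)) (nb (suc i) (2+ j) λ _ ()) he
                     (g (2+ i) (suc j)) (nb (2+ i) (suc j) λ ()) (noSettledφ early A _ _ ≤-refl) s≢b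
                     (g (2+ i) (2+ j)) (nb (2+ i) (2+ j) λ ()) (W (suc i) (suc j))
    where
    s≢b : not (isBe (g (2+ i) (suc j))) ≡ true
    s≢b with isBe (g (2+ i) (suc j))
    ... | true = hc
    ... | false = refl
  ... | r with isVoid (g (2+ i) (suc j)) in so
  ... | true = case-off
    where
    k≡ : k ≡ 2+ i
    k≡ = ≤-antisym (≤-trans (inside (se-off hz)) (<ᵇ-true (trans (sym (tri _ _)) so))) (≰⇒> k≰)
    case-off : ⊥
    case-off with subst (λ m → isSe (g m (2+ j)) ≡ true) k≡ hz
    ... | hz' rewrite hz' = contra r
      where
      contra : false ∨ false ≡ true → ⊥
      contra ()
  ... | false with g (2+ i) (2+ j) in dh
  ... | high = <-irrefl refl (≤-trans (≤-trans (≤-reflexive (sym (cong rankV dh)))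
          (colMono (≰⇒> k≰) (inside (se-off hz)))) (≤-reflexive (se-rank hz)))

-- A primed settled box `d` has no a-box of its family to its west, so `c` is a b-box. An a-box
-- above `d` would be primed, so `b` is a b-box too. West of `b` is a b-box, which makes `b`
-- unprimed, or the active box.
sideF : Formula
sideF = all (allowed late) λ a → all (dom late) λ b → all (dom late) λ c → all (dom late) λ d → win late a b c d ⇒
  (isSe d ∧ primedV d) ⇒ (2 ≤ᵇ rankV c) ⇒ not (isVoid c) ⇒ (2 ≤ᵇ rankV b) ⇒ not (isSe b ∧ primedV b) ⇒ (2 ≤ᵇ rankV a) ⇒
  end (isBe c ∧ (isBe b ∧ (not (primedV b) ∨ isAc a)))

sideL : ⟦ sideF ⟧
sideL = sound sideF refl

≤⇒≤ᵇ′ : ∀ {m n} → m ≤ n → (m ≤ᵇ n) ≡ true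
≤⇒≤ᵇ′ {m} {n} h with m ≤ᵇ n | ≤⇒≤ᵇ h
... | true | _ = refl

-- No primed settled box shares the row which the active box enters.
module _ {g i j} (A : Active late g i j) where
  open Around A
  open OrderL ord

  noPrimedNext : isBe (g (2+ i) (suc j)) ≡ true →
    not (isBe (g (suc i) (2+ j)) ∧ primedV (g (suc i) (2+ j))) ≡ true →
    ∀ l → g (2+ i) l ≡ se true → ⊥
  noPrimedNext hs hc l hz with l ≤? suc j
  ... | yes l≤ = <-irrefl refl (≤-trans (≤-reflexive (sym (cong rankV hz)))
          (≤-trans (rowMono (inside (cong isVoid hz)) l≤) (≤-reflexive (be-rank hs))))
  noPrimedNext hs hc zero hz | no l≰ = l≰ z≤n
  noPrimedNext hs hc (suc l) hz | no l≰ = go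
    where
    j≤l : suc j ≤ l
    j≤l = ≤-pred (≰⇒> l≰)
    i≤l : 2+ i ≤ l
    i≤l = ≤-trans (inside (be-off hs)) j≤l
    in1 : suc i ≤ suc j
    in1 = s≤s i≤j
    conclusion : _
    conclusion = sideL (g (suc i) l) (win-allowed (wins (suc i) l)) (g (suc i) (suc l)) (nb (suc i) (suc l) λ _ e →
        <-irrefl (sym (suc-injective e)) j≤l)
      (g (2+ i) l) (nb (2+ i) l λ ()) (g (2+ i) (suc l)) (nb (2+ i) (suc l) λ ()) (W (suc i) l)
      (cong (λ v → isSe v ∧ primedV v) hz)
      (≤⇒≤ᵇ′ (≤-trans (≤-reflexive (sym (be-rank hs))) (rowMono (inside (be-off hs)) j≤l)))
      (not-intro (inside′ i≤l))
      (≤⇒≤ᵇ′ (≤-trans (≤-reflexive (sym (ac-rank hac))) (rowMono in1 (m≤n⇒m≤1+n j≤l))))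
      (not-intro (¬true⇒false λ e → <-irrefl refl (o2 (suc i) (suc l) (se-true e))))
      (≤⇒≤ᵇ′ (≤-trans (≤-reflexive (sym (ac-rank hac))) (rowMono in1 j≤l)))
    isBe-b : isBe (g (suc i) (suc l)) ≡ true
    isBe-b = ∧-l (∧-r {isBe (g (2+ i) l)} conclusion)
    go : ⊥
    -- An unprimed b-box above the settled one is the pattern forbidden by `na₂`. A primed one has
    -- the active box to its west, and then the switch would go east, against `hc`.
    go with primedV (g (suc i) (suc l)) in pb | ∧-r {isBe (g (suc i) (suc l))} (∧-r {isBe (g (2+ i) l)} conclusion)
    ... | false | _ = na₂ l (s≤s j≤l) hz (∧-l conclusion) (be-false isBe-b pb)
    ... | true | a with proj₂ (uniq _ _ a)
    ... | refl = true≢false hc (cong not (∧-i isBe-b pb))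

-- Moves of the active box

shiftE shiftS : Grid → ℕ → ℕ → Grid
shiftE g i j = put (suc i) (suc j) (g (suc i) (2+ j)) (g (suc i) (suc j))
  (g (2+ i) (suc j)) (g (2+ i) (2+ j)) g
shiftS g i j = put (suc i) (suc j) (g (2+ i) (suc j)) (g (suc i) (2+ j))
  (g (suc i) (suc j)) (g (2+ i) (2+ j)) g

l≢ : ∀ {m l} → m < l → l ≢ m
l≢ h refl = <-irrefl refl h

outcol : ∀ {i j k l} → suc j < l → Outside i j k l
outcol h = inj₂ (l≢ (≤-trans (n≤1+n _) h) , l≢ h)

outrow : ∀ {i j k l} → suc i < k → Outside i j k l
outrow h = inj₁ (l≢ (≤-trans (n≤1+n _) h) , l≢ h)

outrow′ : ∀ {i j k l} → k < i → Outside i j k l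
outrow′ h = inj₁ ((λ e → l≢ h (sym e)) , (λ { refl → <-irrefl refl (≤-trans (n≤1+n _) h) }))

outside-at : ∀ {i j k l} → Outside i j k l → k ≡ i → l ≡ j → ⊥
outside-at (inj₁ (p , _)) q _ = p q
outside-at (inj₂ (p , _)) _ q = p q

not-be : ∀ {v w p} → not (isBe v ∧ not (primedV v)) ≡ true → w ≡ v → w ≡ be p → p ≡ true
not-be {p = true} h e b = refl
not-be {p = false} h refl refl with h
... | ()

module _ {g : Grid} {i j : ℕ} (A : Active early g i j) (he : isBe (g (suc i) (2+ j)) ≡ true)
  (h₂ : not (isBe (g (2+ i) (suc j)) ∧ not (primedV (g (suc i) (2+ j)))) ≡ true) where
  open Around A
  open OrderE ord

  -- The new `nx` cannot be violated, because the box just passed was a b-box and makes its east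
  -- neighbour unprimed if that is a b-box. The premise of `na` fails, because the unprimed unmoved
  -- boxes lie west of the column that has been left.
  shiftE-early : aroundH (g (suc i) (2+ j)) (g (suc i) (3+ j)) ≡ true → OrderE (shiftE g i j) i (suc j)
  shiftE-early h₃ = record
    { o1 = λ k l u → m≤n⇒m≤1+n (back k l u)
    ; o2 = back′
    ; nx = λ b _ _ → true≢false h₃ (cong not (∧-i he (∧-i (cong isBe (trans (sym east) b)) (cong primedV (trans
        (sym east) b)))))
    ; na = λ k u _ _ → ⊥-elim (<-irrefl refl (back k (suc j) u)) }
    where
    east : shiftE g i j (suc i) (3+ j) ≡ g (suc i) (3+ j)
    east = put-out (outcol ≤-refl)
    back : ∀ k l → shiftE g i j k l ≡ un false → l < suc j
    back = put-elim (λ k l v → v ≡ un false → l < suc j) (λ u → ⊥-elim (be≢un he u)) (λ u → ⊥-elim (ac≢un hac u))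
      (o1 _ _) (o1 _ _) (λ k l _ → o1 k l)
    back′ : ∀ k l → isSe (shiftE g i j k l) ≡ true → 2+ j < l
    back′ = put-elim (λ k l v → isSe v ≡ true → 2+ j < l)
      (λ u → ⊥-elim (be≢se he u)) (λ u → ⊥-elim (ac≢se hac u)) (λ u → ⊥-elim (<-irrefl refl (o2 _ _ u)))
      (λ u → ⊥-elim (noSettledNext A he h₂ _ u))
      (λ k l _ u → ≤∧≢⇒< (o2 k l u) (λ { refl → noSettledNext A he h₂ k u }))

module _ {g : Grid} {i j : ℕ} (A : Active late g i j) (he : isBe (g (suc i) (2+ j)) ≡ true) where
  open Around A
  open OrderL ord

  -- The cell north of the new position stood above a b-box, so a b-box there is primed and `na₁`
  -- holds. `na₂` only concerns columns further east and is inherited.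
  shiftE-late : not (isBe (g i (2+ j)) ∧ not (primedV (g i (2+ j)))) ≡ true → OrderL (shiftE g i j) i (suc j)
  shiftE-late h₄ = record
    { o1 = put-elim (λ k l v → isUn v ≡ true → k < suc i) (o1 _ _) (o1 _ _) (o1 _ _) (o1 _ _) (λ k l _ → o1 k l)
    ; o2 = put-elim (λ k l v → v ≡ se true → suc i < k)
        (o2 _ _) (λ u → ⊥-elim (ac≢se hac (cong isSe u))) (o2 _ _) (o2 _ _) (λ k l _ → o2 k l)
    ; na₁ = λ _ b _ _ _ → false≢true (not-be h₄ (put-out (outrow′ ≤-refl)) b)
    ; na₂ = south }
    where
    false≢true : false ≡ true → ⊥
    false≢true ()
    south : ∀ l → 2+ j < suc l → shiftE g i j (2+ i) (suc l) ≡ se true →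
      isBe (shiftE g i j (2+ i) l) ≡ true → shiftE g i j (suc i) (suc l) ≡ be false → ⊥
    south l h z w n = na₂ l (≤-trans (n≤1+n _) h) (trans (sym (put-out (outcol h))) z) (w′ (m≤n⇒m<n∨m≡n (≤-pred h)))
        (trans (sym (put-out (outcol h))) n)
      where
      w′ : (2+ j < l) ⊎ (2+ j ≡ l) → isBe (g (2+ i) l) ≡ true
      w′ (inj₁ lt) = trans (cong isBe (sym (put-out (outcol lt)))) w
      w′ (inj₂ refl) = trans (cong isBe (sym put-22)) w

-- The hypothesis with `isVoid` sets (S3) and (S1′) aside, the last one the switches that lead south
-- past an unprimed east neighbour.
moveE : ∀ φ {g i j} → Active φ g i j → isBe (g (suc i) (2+ j)) ≡ true →
  not (isVoid (g (2+ i) (suc j)) ∧ primedV (g (suc i) (2+ j))) ≡ true →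
  not (isBe (g (2+ i) (suc j)) ∧ not (primedV (g (suc i) (2+ j)))) ≡ true →
  Active φ (shiftE g i j) i (suc j)
moveE φ {g} {i} {j} A he h₁ h₂ = result (eastL φ
    (g i+1 j+1) at e (nb i+1 j+2 λ _ ()) he (win-hor (wins i+1 j+1))
    s (nb i+2 j+1 λ ()) (win-ver (wins i+1 j+1)) h₁ h₂ (noSettledφ φ A i+2 j+1 ≤-refl)
    (g i+2 j+2) (nb i+2 j+2 λ ()) (W i+1 j+1) (nsd φ A he h₂)
    (g i j+1) (nb i j+1 λ ()) (win-ver (wins i j+1)) av (notUnprimedφ φ A i j+1 ≤-refl)
    (g i j+2) (nb i j+2 λ ()) (W i j+1) (notUnprimedφ φ A i j+2 (n≤1+n _))
    (g i+1 j) (nb i+1 j λ _ ()) (win-hor (wins i+1 j)) ah (noUnmovedφ φ A i+1 j ≤-refl)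
    (g i j) (nb i j λ ()) (W i j)
    (g i+2 j) (nb i+2 j λ ()) (W i+1 j)
    (g i+1 j+3) (nb i+1 j+3 λ _ ()) (win-hor (wins i+1 j+2)) (unprimedSettledφ φ A i+1 j+3 ≤-refl)
    (g i j+3) (nb i j+3 λ ()) (W i j+2) (notUnprimedφ φ A i j+3 (≤-trans (n≤1+n _) (n≤1+n _)))
    (g i+2 j+3) (nb i+2 j+3 λ ()) (W i+1 j+2))
  where
  open Around A
  i+1 = suc i
  i+2 = suc i+1
  j+1 = suc j
  j+2 = suc j+1
  j+3 = suc j+2
  e = g i+1 j+2
  s = g i+2 j+1
  nsd : ∀ φ {g} → Active φ g i j → isBe (g i+1 j+2) ≡ true → not (isBe (g i+2 j+1) ∧ not (primedV (g i+1 j+2))) ≡ true →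
    noSettled φ (g i+2 j+2) ≡ true
  nsd early A he h = not-intro (¬true⇒false (noSettledNext A he h i+2))
  nsd late A he h = refl
  order : ∀ φ {g : Grid} → Active φ g i j → isBe (g i+1 j+2) ≡ true → not (isBe (g i+2 j+1) ∧ not (primedV
      (g i+1 j+2))) ≡ true →
    aroundH (g i+1 j+2) (g i+1 j+3) ≡ true → not (isBe (g i j+2) ∧ not (primedV (g i j+2))) ≡ true →
    Order φ (shiftE g i j) i j+1
  order early A he h₂ h₃ h₄ = shiftE-early A he h₂ h₃
  order late A he h₂ h₃ h₄ = shiftE-late A he h₄
  result : _ → Active φ (shiftE g i j) i j+1
  result (r₁ , r₂ , r₃ , r₄ , r₅ , r₆ , r₇ , r₈ , r₉) = record
    { base = record
      { wins = put-wins i j (mkWin r₁ , mkWin r₂ , mkWin r₃ , mkWin r₄ , mkWin r₅ , mkWin r₆ , wins _ _ , wins _ _ ,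
          wins _ _) (λ k l _ → wins k l)
      ; tri = put-tri {g = g} (trans (be-off he) (sym (ac-off hac))) (trans (ac-off hac) (sym
          (be-off he))) refl refl tri }
    ; at = trans (cong (isAct φ) put-12) at
    ; uniq = put-elim (λ k l v → isAc v ≡ true → k ≡ i+1 × l ≡ j+2)
        (λ a → ⊥-elim (be≢ac he a)) (λ _ → refl , refl) (λ a → ⊥-elim (suc≢ (suc-injective (proj₁ (uniq _ _ a)))))
        (λ a → ⊥-elim (suc≢ (suc-injective (proj₁ (uniq _ _ a)))))
        (λ k l o a → ⊥-elim (outside-at o (proj₁ (uniq k l a)) (proj₂ (uniq k l a))))
    ; ah = trans (cong₂ aroundH put-11 (put-out (outcol ≤-refl))) r₇
    ; av = trans (cong₂ aroundV (put-out (outrow′ ≤-refl)) put-22) r₈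
    ; ord = order φ A he h₂ r₇ r₉ }

module _ {g : Grid} {i j : ℕ} (A : Active early g i j) (hs : isBe (g (2+ i) (suc j)) ≡ true) where
  open Around A
  open OrderE ord

  -- The east neighbour of the new position is no b-box: it would need a primed b-box above it, and
  -- then the switch would have been (S5). So `nx` cannot be violated. For `na`, the row just left
  -- is the only new one.
  shiftS-early : not (isBe (g (2+ i) (2+ j))) ≡ true →
    not ((isUn (g (suc i) j) ∧ not (primedV (g (suc i) j))) ∧ primedV (g (2+ i) (suc j))) ≡ true →
    OrderE (shiftS g i j) (suc i) j
  shiftS-early h₁ h₂ = record
    { o1 = put-elim (λ k l v → v ≡ un false → l < suc j) (o1 _ _) (o1 _ _) (o1 _ _) (o1 _ _) (λ k l _ → o1 k l)
    ; o2 = put-elim (λ k l v → isSe v ≡ true → suc j < l)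
        (o2 _ _) (o2 _ _) (λ u → ⊥-elim (ac≢se hac u)) (o2 _ _) (λ k l _ → o2 k l)
    ; nx = λ b _ _ → true≢false h₁ (cong (λ v → not (isBe v)) (trans (sym put-22) b))
    ; na = west }
    where
    absurd : ∀ {w s} → not ((isUn w ∧ not (primedV w)) ∧ primedV s) ≡ true → w ≡ un false → s ≡ be true → ⊥
    absurd () refl refl
    west : ∀ k → shiftS g i j k j ≡ un false → shiftS g i j k (suc j) ≡ be true → k < 2+ i → ⊥
    west k u b h with m≤n⇒m<n∨m≡n (≤-pred h)
    ... | inj₂ refl = absurd h₂ (trans (sym (put-out (inj₂ ((λ e → suc≢ (sym e)) , λ e → <-irrefl e (≤-trans (n<1+n _)
        (n≤1+n _)))))) u) (trans (sym put-11) b)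
    ... | inj₁ k< = na k (trans (sym (put-out (outrow′ k<))) u) (trans (sym (put-out (outrow′ k<))) b) k<

rank3 : ∀ {v w} → isBe v ≡ true → rankV v ≤ rankV w → not (isBe w) ≡ true → isAc w ≡ false → 3 ≤ rankV w
rank3 {v} {w} b h n a = ≤ᵇ⇒≤′ (sound (all any λ v → all any λ w → isBe v ⇒ (rankV v ≤ᵇ rankV w) ⇒ not (isBe w) ⇒ not
    (isAc w) ⇒
  end (3 ≤ᵇ rankV w)) refl v refl w refl b (≤⇒≤ᵇ′ h) n (not-intro a))

module _ {g : Grid} {i j : ℕ} (A : Active late g i j) (hs : isBe (g (2+ i) (suc j)) ≡ true)
  (hc : not (isBe (g (suc i) (2+ j)) ∧ primedV (g (suc i) (2+ j))) ≡ true) where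
  open Around A
  open OrderL ord

  shiftS-late : not (isBe (g (2+ i) (2+ j))) ≡ true → OrderL (shiftS g i j) (suc i) j
  shiftS-late h₁ = record
    { o1 = λ k l u → m≤n⇒m≤1+n (back k l u)
    ; o2 = put-elim (λ k l v → v ≡ se true → 2+ i < k)
        (λ u → ⊥-elim (noPrimedNext A hs hc _ u)) (λ u → ⊥-elim (<-irrefl refl (o2 _ _ u)))
        (λ u → ⊥-elim (ac≢se hac (cong isSe u))) (λ u → ⊥-elim (noPrimedNext A hs hc _ u))
        (λ k l _ u → ≤∧≢⇒< (o2 k l u) (λ { refl → noPrimedNext A hs hc l u }))
    ; na₁ = λ _ b m h u → <-irrefl refl (back (suc i) m u)
    ; na₂ = λ l h _ _ b → east l h b }
    where
    back : ∀ k l → isUn (shiftS g i j k l) ≡ true → k < suc i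
    back = put-elim (λ k l v → isUn v ≡ true → k < suc i) (λ u → ⊥-elim (nou hs u)) (o1 _ _) (λ u → ⊥-elim
        (noac hac u)) (o1 _ _) (λ k l _ → o1 k l)
      where
      nou : ∀ {v} → isBe v ≡ true → isUn v ≡ true → ⊥
      nou {be _} _ ()
      noac : ∀ {v} → isAc v ≡ true → isUn v ≡ true → ⊥
      noac {ac _} _ ()
    d≥3 : 3 ≤ rankV (g (2+ i) (2+ j))
    d≥3 = rank3 hs (rowMono (inside (be-off hs)) (n≤1+n _)) h₁ (¬true⇒false λ a → suc≢ (suc-injective (proj₁
        (uniq _ _ a))))
    east : ∀ l → suc j < suc l → shiftS g i j (2+ i) (suc l) ≡ be false → ⊥
    east l h b = <-irrefl refl (≤-trans (≤-trans d≥3 (rowMono (≤-trans (inside (be-off hs)) (n≤1+n _)) h))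
        (≤-reflexive (cong rankV (same (m≤n⇒m<n∨m≡n h)))))
      where
      same : 2+ j < suc l ⊎ 2+ j ≡ suc l → g (2+ i) (suc l) ≡ be false
      same (inj₁ lt) = trans (sym (put-out (outcol lt))) b
      same (inj₂ refl) = trans (sym put-22) b

-- The second hypothesis excludes (S5); the third excludes the switches that involve the diagonal.
moveS : ∀ φ {g i j} → Active φ g i j → isBe (g (2+ i) (suc j)) ≡ true →
  not (isBe (g (suc i) (2+ j)) ∧ primedV (g (suc i) (2+ j))) ≡ true →
  special φ (g (suc i) j) (g (2+ i) j) ≡ true →
  Active φ (shiftS g i j) (suc i) j
moveS φ {g} {i} {j} A hs h₁ h₂ = result (southL φ
    (g i+1 j+1) at s (nb i+2 j+1 λ ()) hs (win-ver (wins i+1 j+1))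
    (g i+1 j+2) (nb i+1 j+2 λ _ ()) (win-hor (wins i+1 j+1)) h₁
    d (nb i+2 j+2 λ ()) (W i+1 j+1) (usd φ A hs h₁)
    w (nb i+1 j λ _ ()) (win-hor (wins i+1 j)) ah (noUnmovedφ φ A i+1 j ≤-refl)
    (g i+2 j) (nb i+2 j λ ()) (W i+1 j) h₂ (noUnmovedφ φ A i+2 j (n≤1+n _))
    (g i j+1) (nb i j+1 λ ()) (win-ver (wins i j+1)) av (notUnprimedφ φ A i j+1 ≤-refl)
    (g i j) (nb i j λ ()) (W i j)
    (g i j+2) (nb i j+2 λ ()) (W i j+1) (notUnprimedφ φ A i j+2 (n≤1+n _))
    (g i+3 j+1) (nb i+3 j+1 λ ()) (win-ver (wins i+2 j+1)) (noSettledφ φ A i+3 j+1 ≤-refl)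
    (g i+3 j) (nb i+3 j λ ()) (W i+2 j)
    (g i+3 j+2) (nb i+3 j+2 λ ()) (W i+2 j+1))
  where
  open Around A
  i+1 = suc i
  i+2 = suc i+1
  i+3 = suc i+2
  j+1 = suc j
  j+2 = suc j+1
  s = g i+2 j+1
  d = g i+2 j+2
  w = g i+1 j
  usd : ∀ φ {g} → Active φ g i j → isBe (g i+2 j+1) ≡ true → not (isBe (g i+1 j+2) ∧ primedV (g i+1 j+2)) ≡ true →
    unprimedSettled φ (g i+2 j+2) ≡ true
  usd early A hs h = refl
  usd late A hs h = unprimedI (noPrimedNext A hs h j+2)
  order : ∀ φ {g} → Active φ g i j → isBe (g i+2 j+1) ≡ true → not (isBe (g i+1 j+2) ∧ primedV (g i+1 j+2)) ≡ true →
    not (isBe (g i+2 j+2)) ≡ true → not ((isUn (g i+1 j) ∧ not (primedV (g i+1 j))) ∧ primedV (g i+2 j+1)) ≡ true →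
    Order φ (shiftS g i j) i+1 j
  order early A hs h₁ h₃ h₄ = shiftS-early A hs h₃ h₄
  order late A hs h₁ h₃ h₄ = shiftS-late A hs h₁ h₃
  result : _ → Active φ (shiftS g i j) i+1 j
  result (r₁ , r₂ , r₃ , r₄ , r₅ , r₆ , r₇ , r₈ , r₉ , r₁₀) = record
    { base = record
      { wins = put-wins i j (mkWin r₁ , mkWin r₂ , wins _ _ , mkWin r₃ , mkWin r₄ , wins _ _ , mkWin r₅ , mkWin r₆ ,
          wins _ _) (λ k l _ → wins k l)
      ; tri = put-tri {g = g} (trans (be-off hs) (sym (ac-off hac))) refl (trans (ac-off hac) (sym
          (be-off hs))) refl tri }
    ; at = trans (cong (isAct φ) put-21) at
    ; uniq = put-elim (λ k l v → isAc v ≡ true → k ≡ i+2 × l ≡ j+1)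
        (λ a → ⊥-elim (be≢ac hs a)) (λ a → ⊥-elim (suc≢ (suc-injective (proj₂ (uniq _ _ a))))) (λ _ → refl , refl)
        (λ a → ⊥-elim (suc≢ (suc-injective (proj₁ (uniq _ _ a)))))
        (λ k l o a → ⊥-elim (outside-at o (proj₁ (uniq k l a)) (proj₂ (uniq k l a))))
    ; ah = trans (cong₂ aroundH (put-out (inj₂ ((λ e → suc≢ (sym e)) , λ e → <-irrefl e (≤-trans (n<1+n _)
        (n≤1+n _))))) put-22) r₇
    ; av = trans (cong₂ aroundV put-11 (put-out (outrow ≤-refl))) r₈
    ; ord = order φ A hs h₁ r₉ r₁₀ }

-- Switches at the diagonal

frame-at : ∀ {φ φ' g i j a' b' c' d' pre post} → Base φ g →
  (∀ k l → Outside (suc i) (suc j) k l → dom φ (g k l) ≡ true) →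
  let p = g i j ; q = g i (suc j) ; r = g i (2+ j) ; s = g i (3+ j)
      t = g (suc i) j ; u = g (suc i) (3+ j)
      v = g (2+ i) j ; w = g (2+ i) (3+ j) in
  ⟦ frame φ (g (suc i) (suc j)) (g (suc i) (2+ j)) (g (2+ i) (suc j)) (g (2+ i) (2+ j))
          pre φ' a' b' c' d' post ⟧ →
  pre p q r s t u v w ≡ true → Nine φ' i j a' b' c' d' g × ⟦ post p q r u ⟧
frame-at {φ} {φ'} {g} {i} {j} {a'} {b'} {c'} {d'} {pre} {post} B o f h = result (f
   (g i j+1) (o _ _ up) (win-ver (wins i j+1))
   (g i j+2) (o _ _ up) (holds (wins i j+1))
   (g i+1 j) (o _ _ lf) (win-hor (wins i+1 j))
   (g i j) (o _ _ up) (holds (wins i j))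
   (g i+2 j) (o _ _ lf) (holds (wins i+1 j))
   (g i+1 j+3) (o _ _ rt) (win-hor (wins i+1 j+2))
   (g i j+3) (o _ _ up) (holds (wins i j+2))
   (g i+2 j+3) (o _ _ rt) (holds (wins i+1 j+2)) h
   (g i+3 j+1) (o _ _ dn) (win-ver (wins i+2 j+1))
   (g i+3 j) (o _ _ dn) (holds (wins i+2 j))
   (g i+3 j+2) (o _ _ dn) (holds (wins i+2 j+1))
   (g i+3 j+3) (o _ _ dn) (holds (wins i+2 j+2)))
  where
  open Base B
  i+1 = suc i
  i+2 = suc i+1
  i+3 = suc i+2
  j+1 = suc j
  j+2 = suc j+1
  j+3 = suc j+2
  up : ∀ {l} → Outside i+1 j+1 i l
  up = outrow′ ≤-refl
  dn : ∀ {l} → Outside i+1 j+1 i+3 l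
  dn = outrow ≤-refl
  rt : ∀ {k} → Outside i+1 j+1 k j+3
  rt = outcol ≤-refl
  lf : ∀ {k} → Outside i+1 j+1 k j
  lf = inj₂ ((λ e → suc≢ (sym e)) , λ e → <-irrefl e (≤-trans (n<1+n _) (n≤1+n _)))
  result : _ → Nine φ' i j a' b' c' d' g × ⟦ post (g i j) (g i j+1) (g i j+2) (g i+1 j+3) ⟧
  result (r₁ , r₂ , r₃ , r₄ , r₅ , r₆ , r₇ , r₈ , r₉ , r) =
    (mkWin r₁ , mkWin r₂ , mkWin r₃ , mkWin r₄ , mkWin r₅ , mkWin r₆ , mkWin r₇ , mkWin r₈ , mkWin r₉) , r

idleE : ∀ {g} m → (∀ k l → g k l ≡ un false → l < m) → (∀ k l → isSe (g k l) ≡ true → m < l) → IdleE g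
idleE m f h = record
  { o2 = λ k l k' l' u v → <-trans (f k l u) (h k' l' v)
  ; nn = λ k l k' u _ _ v → <-irrefl refl (≤-trans (h k' (suc l) v) (f k l u)) }

idleL : ∀ {g} m → (∀ k l → isUn (g k l) ≡ true → k < m) → (∀ k l → g k l ≡ se true → m < k) → IdleL g
idleL m f h = record
  { o2 = λ k l k' l' u v → <-trans (f k l u) (h k' l' v)
  ; nn = λ k l m' v _ _ _ u → <-irrefl refl (≤-trans (h (suc k) (suc l) v) (f k m' u)) }

allowed-late : ∀ {v} → (v ≡ un false → ⊥) → isAc v ≡ false → allowed late v ≡ true
allowed-late {v} h a = sound (all any λ v → not (isUn v ∧ not (primedV v)) ⇒ not (isAc v) ⇒ end (allowed late v)) refl
  v refl (notUnprimed-I h) (not-intro a)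

not-se-true : ∀ {v} → allowed early v ≡ true → v ≡ se true → ⊥
not-se-true () refl

off-not-un : ∀ {v} → isVoid v ≡ true → isUn v ≡ true → ⊥
off-not-un {void} _ ()
off-not-se : ∀ {v} → isVoid v ≡ true → isSe v ≡ true → ⊥
off-not-se {void} _ ()
off-not-ac : ∀ {v} → isVoid v ≡ true → isAc v ≡ true → ⊥
off-not-ac {void} _ ()
be-not-un : ∀ {v} → isBe v ≡ true → isUn v ≡ true → ⊥
be-not-un {be _} _ ()

sel-other : ∀ {i k} → sel i k ≡ other → k ≢ i × k ≢ suc i
sel-other {i} {k} e = (λ { refl → first≢ (trans (sym (sel-first i)) e) }) , (λ { refl → second≢ (trans (sym
    (sel-second i)) e) })
  where
  first≢ : first ≢ other
  first≢ ()
  second≢ : second ≢ other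
  second≢ ()

outside-sel : ∀ {i j k l} → sel i k ≡ other ⊎ sel j l ≡ other → Outside i j k l
outside-sel (inj₁ e) = inj₁ (sel-other e)
outside-sel (inj₂ e) = inj₂ (sel-other e)

only-un : ∀ {v} → 1 ≤ rankV v → rankV v ≤ 1 → isUn v ≡ true
only-un {un _} _ _ = refl
only-un {ac _} _ (s≤s ())
only-un {be _} _ (s≤s ())
only-un {se _} _ (s≤s ())
only-un {high} _ (s≤s ())

low-rank : ∀ {v} → isLow v ≡ true → rankV v ≡ 0
low-rank {low} _ = refl

module _ {φ g} (B : Base φ g) where
  open Base B

  mono : ∀ {k k' l l'} → k ≤ k' → l ≤ l' → k ≤ l → k' ≤ l' → rankV (g k l) ≤ rankV (g k' l')
  mono h h' t t' = ≤-trans (rowMono t h') (colMono h t')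

  -- By monotonicity the cell just below the first box has rank 1 as well, hence is unmoved; but a
  -- box with a south neighbour of its own letter is primed. `row-un` is the dual statement for
  -- rows.
  column-un : ∀ {k k' l} → g k l ≡ un false → isUn (g k' l) ≡ true → k < k' → ⊥
  column-un {k} {k'} {l} u u' h = clash u below-un (win-ver (wins k l))
    where
    k'≤l : k' ≤ l
    k'≤l = inside (un-off u')
    r≤1 : rankV (g (suc k) l) ≤ 1
    r≤1 = ≤-trans (colMono h k'≤l) (≤-reflexive (un-rank u'))
    r≥1 : 1 ≤ rankV (g (suc k) l)
    r≥1 = ≤-trans (≤-reflexive (sym (cong rankV u))) (colMono (n≤1+n k) (≤-trans h k'≤l))
    below-un : isUn (g (suc k) l) ≡ true
    below-un = only-un r≥1 r≤1
    clash : ∀ {v w} → v ≡ un false → isUn w ≡ true → ver v w ≡ true → ⊥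
    clash {w = un _} refl _ ()

  row-un : ∀ {k l l'} → isUn (g k l) ≡ true → g k l' ≡ un true → l < l' → ⊥
  row-un {k} {l} {suc l'} u u' h = clash left-un u' (win-hor (wins k l'))
    where
    k≤l : k ≤ l
    k≤l = inside (un-off u)
    r≤1 : rankV (g k l') ≤ 1
    r≤1 = ≤-trans (rowMono (≤-trans k≤l (≤-pred h)) (n≤1+n l')) (≤-reflexive (cong rankV u'))
    r≥1 : 1 ≤ rankV (g k l')
    r≥1 = ≤-trans (≤-reflexive (sym (un-rank u))) (rowMono k≤l (≤-pred h))
    left-un : isUn (g k l') ≡ true
    left-un = only-un r≥1 r≤1
    clash : ∀ {v w} → isUn v ≡ true → w ≡ un true → hor v w ≡ true → ⊥
    clash {un _} _ refl ()

c-off : ∀ {φ g} → Base φ g → ∀ n → isVoid (g (suc n) n) ≡ true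
c-off B n = trans (Base.tri B _ _) (lt n)
  where
  lt : ∀ n → (n <ᵇ suc n) ≡ true
  lt zero = refl
  lt (suc n) = lt n

module _ {g i} (A : Active early g i i) where
  open Around A
  open OrderE ord
  private
    a = g (suc i) (suc i)
    b = g (suc i) (2+ i)
    c = g (2+ i) (suc i)
    d = g (2+ i) (2+ i)

  dom-outside-diag : ∀ k l → Outside (suc i) (suc i) k l → dom early (g k l) ≡ true
  dom-outside-diag k l o = nb k l (outside-at o)

  pre-diag : (notUnprimed early (g i (suc i)) ∧ (notUnprimed early (g i (2+ i)) ∧
    (notUnprimed early (g i (3+ i)) ∧ aroundH (g (suc i) i) b))) ≡ true
  pre-diag = ∧-i (notUnprimedφ early A i (suc i) ≤-refl) (∧-i (notUnprimedφ early A i (2+ i) (n≤1+n _))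
    (∧-i (notUnprimedφ early A i (3+ i) (≤-trans (n≤1+n _) (n≤1+n _))) ah))

  moveS3 : isBe b ≡ true → primedV b ≡ true → isBe d ≡ true → Idle early (put (suc i) (suc i) d (be false) c (se false) g)
  moveS3 hb pb hd = record
    { base = record
      { wins = put-wins i i (proj₁ r) (λ k l _ → wins k l)
      ; tri = put-tri {g = g} (trans (be-off hd) (sym (ac-off hac))) (sym (be-off hb)) refl (sym (be-off hd)) tri }
    ; noAc = put-elim (λ k l v → isAc v ≡ false) (¬true⇒false (be≢ac hd)) refl (¬true⇒false (off-not-ac (c-off base
        (suc i)))) refl
        (λ k l o → ¬true⇒false λ x → outside-at o (proj₁ (uniq k l x)) (proj₂ (uniq k l x)))
    ; ord = idleE (suc i)
        (put-elim (λ k l v → v ≡ un false → l < suc i) (λ u → ⊥-elim (be≢un hd u)) (λ ()) (o1 _ _) (λ ()) (λ k l _ →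
            o1 k l))
        (put-elim (λ k l v → isSe v ≡ true → suc i < l) (λ u → ⊥-elim (be≢se hd u)) (λ ())
          (λ u → ⊥-elim (off-not-se (c-off base (suc i)) u)) (λ _ → ≤-refl) (λ k l _ → o2 k l)) }
    where
    r = frame-at base dom-outside-diag (s3L a at b (nb _ _ λ _ ()) hb pb c (nb _ _ λ ()) (c-off base (suc i)) d
        (nb _ _ λ ()) hd (W (suc i) (suc i))) pre-diag

  -- The early phase ends here. By `o1` an unprimed unmoved box lies in a column up to `i`, hence
  -- weakly north-west of the diagonal cell `(i , i)`; the check shows that this cell is `low`, so
  -- there is no such box. Primed boxes have not been settled yet, which disposes of the conditions
  -- on them.
  moveS1′ : isBe b ≡ true → primedV b ≡ true → not (isBe d) ≡ true →
    Active late (put (suc i) (suc i) (be false) (ac true) c d g) i (suc i)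
  moveS1′ hb pb hd = record
    { base = record
      { wins = put-wins i i (proj₁ r) (λ k l o → win-late (wins k l) late
          (allowed-late (noUn k l) (¬true⇒false λ x → outside-at (outside-sel o) (proj₁ (uniq k l x)) (proj₂
              (uniq k l x)))))
      ; tri = put-tri {g = g} (sym (ac-off hac)) (sym (be-off hb)) refl refl tri }
    ; at = cong (isAct late) put-12
    ; uniq = put-elim (λ k l v → isAc v ≡ true → k ≡ suc i × l ≡ 2+ i) (λ ()) (λ _ → refl , refl)
        (λ x → ⊥-elim (off-not-ac (c-off base (suc i)) x)) (λ x → ⊥-elim (suc≢ (suc-injective (proj₁ (uniq _ _ x)))))
        (λ k l o x → ⊥-elim (outside-at o (proj₁ (uniq k l x)) (proj₂ (uniq k l x))))
    ; ah = trans (cong₂ aroundH put-11 (put-out (outcol ≤-refl))) (proj₁ (proj₂ r))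
    ; av = trans (cong₂ aroundV (put-out (outrow′ ≤-refl)) put-22) (around (g i (2+ i)) (not-elim hd))
    ; ord = record
      { o1 = put-elim (λ k l v → isUn v ≡ true → k < suc i) (λ ()) (λ ())
          (λ u → ⊥-elim (off-not-un (c-off base (suc i)) u)) (above _ _) (λ k l _ → above k l)
      ; o2 = λ k l u → ⊥-elim (noSe k l u)
      ; na₁ = λ _ n _ _ _ → case (not-be (proj₂ (proj₂ (proj₂ r))) (put-out (outrow′ ≤-refl)) n)
      ; na₂ = λ l _ u _ _ → noSe _ _ u } }
    where
    r = frame-at base dom-outside-diag (s1′L a at b (nb _ _ λ _ ()) hb pb c (nb _ _ λ ()) (c-off base (suc i)) d
        (nb _ _ λ ()) hd (W (suc i) (suc i))) pre-diag
    case : false ≡ true → ⊥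
    case ()
    around : ∀ n {s} → isBe s ≡ false → aroundV n s ≡ true
    around n {s} e rewrite e with isBe n
    ... | true = refl
    ... | false = refl
    noUn : ∀ k l → g k l ≡ un false → ⊥
    noUn k l u = <-irrefl refl (≤-trans (≤-reflexive (sym (cong rankV u)))
      (≤-trans (mono base (≤-trans (inside (cong isVoid u)) l≤i) l≤i (inside (cong isVoid u)) ≤-refl)
               (≤-reflexive (low-rank (proj₁ (proj₂ (proj₂ r)))))))
      where
      l≤i : l ≤ i
      l≤i = ≤-pred (o1 k l u)
    above : ∀ k l → isUn (g k l) ≡ true → k < suc i
    above k l u = ≰⇒> λ h → <-irrefl refl (≤-trans (≤-reflexive (sym (ac-rank hac)))
      (≤-trans (mono base h (≤-trans h (inside (un-off u))) ≤-refl (inside (un-off u))) (≤-reflexive (un-rank u))))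
    noSe : ∀ k l → put (suc i) (suc i) (be false) (ac true) c d g k l ≡ se true → ⊥
    noSe = put-elim (λ k l v → v ≡ se true → ⊥) (λ ()) (λ ()) (not-se-true (win-allowed (wins _ _)))
      (not-se-true (win-allowed (wins _ _))) (λ k l _ → not-se-true (win-allowed (wins k l)))

module _ {φ g i} (A : Active φ g i (suc i)) where
  open Around A
  private
    a = g (suc i) (suc i)
    b = g (suc i) (2+ i)
    c = g (2+ i) (suc i)
    d = g (2+ i) (2+ i)

  outside-at′ : ∀ {k l} → Outside (suc i) (suc i) k l → k ≡ suc i → l ≡ 2+ i → ⊥
  outside-at′ (inj₁ (p , _)) q _ = p q
  outside-at′ (inj₂ (_ , p)) _ q = p q

  dom-outside : ∀ k l → Outside (suc i) (suc i) k l → dom φ (g k l) ≡ true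
  dom-outside k l o = nb k l (outside-at′ o)

-- The box loses its prime on entering the diagonal and comes to rest there at once, since no b-box
-- is left to its east. One lemma serves (S2′) and (S6′): the latter also writes an unprimed b into
-- a box that holds one.
moveS26′ : ∀ {g i} → Active late g i (suc i) → isBe (g (2+ i) (2+ i)) ≡ true →
  not (isBe (g (suc i) (3+ i)) ∧ primedV (g (suc i) (3+ i))) ≡ true →
  Idle late (put (suc i) (suc i) (g (suc i) (suc i)) (be true) (g (2+ i) (suc i)) (se false) g)
moveS26′ {g} {i} A hd hu = record
    { base = record
      { wins = put-wins i i (proj₁ r) (λ k l _ → wins k l)
      ; tri = put-tri {g = g} refl (sym (ac-off hac)) refl (sym (be-off hd)) tri }
    ; noAc = put-elim (λ k l v → isAc v ≡ false) (¬true⇒false λ x → suc≢ (suc-injective (sym (proj₂ (uniq _ _ x))))) refl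
        (¬true⇒false (off-not-ac (c-off base (suc i)))) refl
        (λ k l o → ¬true⇒false λ x → outside-at′ A o (proj₁ (uniq k l x)) (proj₂ (uniq k l x)))
    ; ord = idleL (suc i)
        (put-elim (λ k l v → isUn v ≡ true → k < suc i) (o1 _ _) (λ ()) (o1 _ _) (λ ()) (λ k l _ → o1 k l))
        (put-elim (λ k l v → v ≡ se true → suc i < k) (o2 _ _) (λ ()) (o2 _ _) (λ ()) (λ k l _ → o2 k l)) }
  where
  open Around A
  open OrderL ord
  a = g (suc i) (suc i)
  b = g (suc i) (2+ i)
  c = g (2+ i) (suc i)
  d = g (2+ i) (2+ i)
  r = frame-at base (dom-outside A) (s26′L b at c (nb _ _ λ ()) (c-off base (suc i)) d (nb _ _ λ ()) hd
        a (nb _ _ λ _ ()) (W (suc i) (suc i)) (noUnmovedφ late A _ _ ≤-refl))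
        (∧-i hu (∧-i av (∧-i ah (unprimedI (noPrimedNext A hd hu _)))))

-- The diagonal a-box jumps to the next diagonal cell and settles, while the active box stays in
-- place, becomes primed and opens the late phase. An unprimed unmoved box elsewhere in the column
-- of the diagonal a-box is excluded by `column-un`; further west, everything in question is weakly
-- north-west of a `low` cell.
moveS47 : ∀ {g i} → Active early g i (suc i) → isUn (g (suc i) (suc i)) ≡ true → isBe (g (2+ i) (2+ i)) ≡ true →
  not (isBe (g (suc i) (3+ i)) ∧ primedV (g (suc i) (3+ i))) ≡ true →
  Active late (put (suc i) (suc i) (g (2+ i) (2+ i)) (ac true) (g (2+ i) (suc i)) (se false) g) i (suc i)
moveS47 {g} {i} A ha hd hu = record
    { base = record
      { wins = put-wins i i (proj₁ r) (λ k l o → win-late (wins k l) late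
          (allowed-late (noUn k l (outside-sel o)) (¬true⇒false λ x → outside-at′ A (outside-sel o) (proj₁
              (uniq k l x)) (proj₂ (uniq k l x)))))
      ; tri = put-tri {g = g} (trans (be-off hd) (sym (un-off ha))) (sym (ac-off hac)) refl (sym (be-off hd)) tri }
    ; at = cong (isAct late) put-12
    ; uniq = put-elim (λ k l v → isAc v ≡ true → k ≡ suc i × l ≡ 2+ i) (λ x → ⊥-elim (be≢ac hd x)) (λ _ → refl , refl)
        (λ x → ⊥-elim (off-not-ac (c-off base (suc i)) x)) (λ ())
        (λ k l o x → ⊥-elim (outside-at′ A o (proj₁ (uniq k l x)) (proj₂ (uniq k l x))))
    ; ah = trans (cong₂ aroundH put-11 (put-out (outcol ≤-refl))) (proj₁ (proj₂ r))
    ; av = trans (cong₂ aroundV (put-out (outrow′ ≤-refl)) put-22) (around (g i (2+ i)))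
    ; ord = record
      { o1 = put-elim (λ k l v → isUn v ≡ true → k < suc i) (λ u → ⊥-elim (be-not-un hd u)) (λ ())
          (λ u → ⊥-elim (off-not-un (c-off base (suc i)) u)) (λ ()) above
      ; o2 = λ k l u → ⊥-elim (noSe k l u)
      ; na₁ = λ _ n _ _ _ → case (not-be (proj₂ (proj₂ (proj₂ (proj₂ r)))) (put-out (outrow′ ≤-refl)) n)
      ; na₂ = λ l _ u _ _ → noSe _ _ u } }
  where
  open Around A
  open OrderE ord
  a = g (suc i) (suc i)
  b = g (suc i) (2+ i)
  c = g (2+ i) (suc i)
  d = g (2+ i) (2+ i)
  r = frame-at base (dom-outside A) (s47L b at c (nb _ _ λ ()) (c-off base (suc i)) d (nb _ _ λ ()) hd
        a (nb _ _ λ _ ()) (W (suc i) (suc i)) ha)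
        (∧-i hu (∧-i av (∧-i (notUnprimedφ early A i (2+ i) ≤-refl) (notUnprimedφ early A i (3+ i) (n≤1+n _)))))
  case : false ≡ true → ⊥
  case ()
  around : ∀ n → aroundV n (se false) ≡ true
  around n with isBe n
  ... | true = refl
  ... | false = refl
  noUn : ∀ k l → Outside (suc i) (suc i) k l → g k l ≡ un false → ⊥
  noUn k l o u with m≤n⇒m<n∨m≡n (≤-pred (o1 k l u))
  ... | inj₁ l<i = <-irrefl refl (≤-trans (≤-reflexive (sym (cong rankV u)))
      (≤-trans (mono base (≤-trans (inside (cong isVoid u)) (≤-pred l<i)) (≤-pred l<i) (inside (cong isVoid u)) ≤-refl)
               (≤-reflexive (low-rank (proj₁ (proj₂ (proj₂ r)))))))
  ... | inj₂ refl with m≤n⇒m<n∨m≡n (inside {k} {suc i} (cong isVoid u))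
  ... | inj₂ refl = outside-at o refl refl
  ... | inj₁ k<i = column-un base u ha k<i
  above : ∀ k l → Outside (suc i) (suc i) k l → isUn (g k l) ≡ true → k < suc i
  above k l o u = ≰⇒> λ h → absurd h (m≤n⇒m<n∨m≡n (≤-trans h (inside (un-off u))))
    where
    absurd : suc i ≤ k → suc i < l ⊎ suc i ≡ l → ⊥
    absurd h (inj₂ refl) = outside-at o (≤-antisym (inside (un-off u)) h) refl
    absurd h (inj₁ lt) = <-irrefl refl (≤-trans (≤-reflexive (sym (ac-rank hac)))
      (≤-trans (mono base h lt (n≤1+n _) (inside (un-off u))) (≤-reflexive (un-rank u))))
  noSe : ∀ k l → put (suc i) (suc i) d (ac true) c (se false) g k l ≡ se true → ⊥
  noSe = put-elim (λ k l v → v ≡ se true → ⊥) (λ u → be≢se hd (cong isSe u)) (λ ()) (not-se-true (win-allowed (wins _ _)))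
      (λ ()) (λ k l _ → not-se-true (win-allowed (wins k l)))

-- Settling and activating boxes

⟶-intro : ∀ {a b} → (a ≡ true → b ≡ true) → (a ⟶ b) ≡ true
⟶-intro {true} h = h refl
⟶-intro {false} h = refl

retired : Grid → Grid
retired g k l = retire (g k l)

eqB-sound : ∀ a {b} → eqB a b ≡ true → a ≡ b
eqB-sound true e = sym e
eqB-sound false e = sym (not-elim e)

retire-off : ∀ v → isVoid (retire v) ≡ isVoid v
retire-off v = eqB-sound _ (sound (all any λ v → end (eqB (isVoid (retire v)) (isVoid v))) refl v refl)

retire-noAc : ∀ v → isAc (retire v) ≡ false
retire-noAc v = not-elim (sound (all any λ v → end (not (isAc (retire v)))) refl v refl)

retire-un : ∀ {v p} → retire v ≡ un p → v ≡ un p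
retire-un {un _} refl = refl

retire-isUn : ∀ {v} → isUn (retire v) ≡ true → isUn v ≡ true
retire-isUn {un _} _ = refl

retire-be : ∀ {v p} → retire v ≡ be p → v ≡ be p
retire-be {be _} refl = refl

retire-isBe : ∀ {v} → isBe (retire v) ≡ true → isBe v ≡ true
retire-isBe {be _} _ = refl

retire-isSe : ∀ {v} → isSe (retire v) ≡ true → isSe v ≡ true ⊎ isAc v ≡ true
retire-isSe {se _} _ = inj₁ refl
retire-isSe {ac _} _ = inj₂ refl

retire-se : ∀ {v p} → retire v ≡ se p → v ≡ se p ⊎ isAc v ≡ true
retire-se {se _} refl = inj₁ refl
retire-se {ac _} refl = inj₂ refl

-- The only new instances of `nn` have the retiring box as the settled one, and `na` or `na₁` has
-- been carried along for exactly these. For boxes settled earlier, the columns or rows already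
-- contradict the premises.
retiring : ∀ φ {g i j} → Active φ g i j → isBe (g (suc i) (2+ j)) ≡ false → isBe (g (2+ i) (suc j)) ≡ false →
  Idle φ (retired g)
retiring φ {g} {i} {j} A he hs = record
  { base = record
    { wins = λ k l → mkWin (retireL φ
        (g k l) (win-allowed (wins k l))
        (g k (suc l)) (win-allowed (wins k (suc l))) (⟶-intro (east k l))
        (g (suc k) l) (win-allowed (wins (suc k) l)) (⟶-intro (south k l))
        (g (suc k) (suc l)) (win-allowed (wins (suc k) (suc l))) (⟶-intro (south k (suc l))) (⟶-intro (east (suc k) l))
        (W k l))
    ; tri = λ k l → trans (retire-off (g k l)) (tri k l) }
  ; noAc = λ k l → retire-noAc (g k l)
  ; ord = order φ A }
  where
  open Around A
  east : ∀ k l → isAc (g k l) ≡ true → not (isBe (g k (suc l))) ≡ true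
  east k l a with uniq k l a
  ... | refl , refl = not-intro he
  south : ∀ k l → isAc (g k l) ≡ true → not (isBe (g (suc k) l)) ≡ true
  south k l a with uniq k l a
  ... | refl , refl = not-intro hs
  order : ∀ φ {g} → Active φ g i j → IdleOrder φ (retired g)
  order early {g} A = record
    { o2 = λ k l k' l' u v → <-≤-trans (o1 k l (retire-un u)) (later k' l' (retire-isSe v))
    ; nn = λ k l k' u b h v → clash k l k' (retire-un u) (retire-be b) h (retire-isSe v) }
    where
    open OrderE (Active.ord A)
    later : ∀ k l → isSe (g k l) ≡ true ⊎ isAc (g k l) ≡ true → suc j ≤ l
    later k l (inj₁ s) = <⇒≤ (o2 k l s)
    later k l (inj₂ a) = ≤-reflexive (sym (proj₂ (Active.uniq A k l a)))
    clash : ∀ k l k' → g k l ≡ un false → g k (suc l) ≡ be true → k < k' →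
      isSe (g k' (suc l)) ≡ true ⊎ isAc (g k' (suc l)) ≡ true → ⊥
    clash k l k' u b h (inj₁ s) = <-irrefl refl (≤-trans (o2 k' (suc l) s) (o1 k l u))
    clash k l k' u b h (inj₂ a) with Active.uniq A k' (suc l) a
    ... | refl , refl = na k u b h
  order late {g} A = record
    { o2 = λ k l k' l' u v → <-≤-trans (o1 k l (retire-isUn u)) (later k' l' (retire-se v))
    ; nn = λ k l m v w n h u → clash k l m (retire-se v) (retire-isBe w) (retire-be n) h (retire-isUn u) }
    where
    open OrderL (Active.ord A)
    later : ∀ k l → g k l ≡ se true ⊎ isAc (g k l) ≡ true → suc i ≤ k
    later k l (inj₁ s) = <⇒≤ (o2 k l s)
    later k l (inj₂ a) = ≤-reflexive (sym (proj₁ (Active.uniq A k l a)))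
    clash : ∀ k l m → g (suc k) (suc l) ≡ se true ⊎ isAc (g (suc k) (suc l)) ≡ true → isBe (g (suc k) l) ≡ true →
      g k (suc l) ≡ be false → m < suc l → isUn (g k m) ≡ true → ⊥
    clash k l m (inj₁ s) w n h u = <-irrefl refl (≤-trans (o2 (suc k) (suc l) s) (o1 k m u))
    clash k l m (inj₂ a) w n h u with Active.uniq A (suc k) (suc l) a
    ... | refl , refl = na₁ w n m h u

relab : (ℕ → ℕ → Mode) → Grid → Grid
relab μ g k l = relabel (μ k l) (g k l)

relabel-off : ∀ m v → isVoid (relabel m v) ≡ isVoid v
relabel-off m void = refl
relabel-off m low = refl
relabel-off m high = refl
relabel-off m (ac _) = refl
relabel-off m (se _) = refl
relabel-off m (be _) = refl
relabel-off keep (un _) = refl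
relabel-off half (un false) = refl
relabel-off half (un true) = refl
relabel-off settle (un _) = refl
relabel-off activate (un _) = refl

relabel-be≡ : ∀ m v → isBe (relabel m v) ≡ isBe v
relabel-be≡ m void = refl
relabel-be≡ m low = refl
relabel-be≡ m high = refl
relabel-be≡ keep (un _) = refl
relabel-be≡ half (un false) = refl
relabel-be≡ half (un true) = refl
relabel-be≡ settle (un _) = refl
relabel-be≡ activate (un _) = refl
relabel-be≡ m (ac _) = refl
relabel-be≡ m (se _) = refl
relabel-be≡ m (be _) = refl

relabel-isBe : ∀ {m v} → isBe (relabel m v) ≡ true → isBe v ≡ true
relabel-isBe {m} {v} h = trans (sym (relabel-be≡ m v)) h

relabel-be : ∀ {m v p} → relabel m v ≡ be p → v ≡ be p
relabel-be {m} {be _} refl = refl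
relabel-be {half} {un false} ()
relabel-be {half} {un true} ()
relabel-be {keep} {un _} ()
relabel-be {settle} {un _} ()
relabel-be {activate} {un _} ()

relabel-un : ∀ {m v p} → relabel m v ≡ un p → v ≡ un p × (m ≡ keep ⊎ (m ≡ half × p ≡ true))
relabel-un {half} {un true} refl = refl , inj₂ (refl , refl)
relabel-un {keep} {un _} refl = refl , inj₁ refl

relabel-ac : ∀ {m v} → isAc (relabel m v) ≡ true → isAc v ≡ false → m ≡ activate
relabel-ac {half} {un false} () _
relabel-ac {half} {un true} () _
relabel-ac {keep} {un _} () _
relabel-ac {settle} {un _} () _
relabel-ac {activate} {un _} _ _ = refl
relabel-ac {m} {ac _} _ ()

relabel-se : ∀ {m v p} → relabel m v ≡ se p → v ≡ se p ⊎ (v ≡ un p × (m ≡ settle ⊎ (m ≡ half × p ≡ false)))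
relabel-se {m} {se _} refl = inj₁ refl
relabel-se {half} {un false} refl = inj₂ (refl , inj₂ (refl , refl))
relabel-se {settle} {un _} refl = inj₂ (refl , inj₁ refl)

isSe-se : ∀ {v} → isSe v ≡ true → v ≡ se (primedV v)
isSe-se {se _} _ = refl
isUn-un : ∀ {v} → isUn v ≡ true → v ≡ un (primedV v)
isUn-un {un _} _ = refl

module _ {φ φ' g} {μ : ℕ → ℕ → Mode} (I : Idle φ g)
  (ok : ∀ k l → modeOK φ' (μ k l) (g k l) ≡ true)
  (free : ∀ k l → settles (μ k l) (g k l) ≡ true → isBe (g k (suc l)) ≡ false × isBe (g (suc k) l) ≡ false)
  (rel : ∀ k l → ⟦ relF φ φ' (μ k l) (μ k (suc l)) (μ (suc k) l) (μ (suc k) (suc l)) ⟧) where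
  open Idle I

  private
    domI : ∀ k l → dom φ (g k l) ≡ true
    domI k l = ∧-i (win-allowed (wins k l)) (not-intro (noAc k l))

  relab-base : Base φ' (relab μ g)
  relab-base = record
    { wins = λ k l → mkWin (rel k l
        (g k l) (domI k l) (ok k l)
        (g k (suc l)) (domI k (suc l)) (ok k (suc l)) (⟶-intro λ s → not-intro (proj₁ (free k l s)))
        (g (suc k) l) (domI (suc k) l) (ok (suc k) l) (⟶-intro λ s → not-intro (proj₂ (free k l s)))
        (g (suc k) (suc l)) (domI (suc k) (suc l)) (ok (suc k) (suc l))
          (⟶-intro λ s → not-intro (proj₂ (free k (suc l) s))) (⟶-intro λ s → not-intro (proj₁ (free (suc k) l s)))
        (holds (wins k l)))
    ; tri = λ k l → trans (relabel-off (μ k l) (g k l)) (tri k l) }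

final-base : ∀ {φ g} → Idle φ g →
  (∀ k l → isUn (g k l) ≡ true → isBe (g k (suc l)) ≡ false × isBe (g (suc k) l) ≡ false) →
  Base late (relab (λ _ _ → settle) g)
final-base {φ} {g} I free = relab-base I (λ _ _ → refl) (λ k l s → free k l (∧-l s)) (λ _ _ → relabelL φ ssss)

data Position : Set where
  before hit after : Position

position : ℕ → ℕ → Position
position zero zero = hit
position zero (suc _) = after
position (suc j) zero = before
position (suc j) (suc l) = position j l

pos-refl : ∀ j → position j j ≡ hit
pos-refl zero = refl
pos-refl (suc j) = pos-refl j

pos-here : ∀ {j l} → position j l ≡ hit → l ≡ j
pos-here {zero} {zero} _ = refl
pos-here {suc j} {suc l} e = cong suc (pos-here e)

pos-before : ∀ {j l} → position j l ≡ before → l < j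
pos-before {suc j} {zero} _ = s≤s z≤n
pos-before {suc j} {suc l} e = s≤s (pos-before e)

pos-after : ∀ {j l} → position j l ≡ after → j < l
pos-after {zero} {suc l} _ = s≤s z≤n
pos-after {suc j} {suc l} e = s≤s (pos-after e)

data Adj : Position → Position → Set where
  bb : Adj before before
  bh : Adj before hit
  ha : Adj hit after
  aa : Adj after after

adj : ∀ j l → Adj (position j l) (position j (suc l))
adj zero zero = ha
adj zero (suc l) = aa
adj (suc zero) zero = bh
adj (2+ j) zero = bb
adj (suc j) (suc l) = adj j l

-- In the column of the activated box the other cells can be kept, since by `column-un` none of them
-- is unprimed and unmoved. In its row the late modes are `half`, which leaves primed boxes waiting;
-- by `row-un` there are none.
modeE modeL : Position → Position → Mode
modeE r before = keep
modeE r after = half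
modeE hit hit = activate
modeE before hit = keep
modeE after hit = keep
modeL before c = half
modeL after c = settle
modeL hit hit = activate
modeL hit before = half
modeL hit after = half

patE : ∀ {r r' c c'} → Adj r r' → Adj c c' → EPat (modeE r c) (modeE r c') (modeE r' c) (modeE r' c')
patE x bb = kkkk
patE x aa = hhhh
patE bb bh = kkkk
patE bh bh = br
patE ha bh = tr
patE aa bh = kkkk
patE bb ha = kk:h
patE bh ha = bl
patE ha ha = tl
patE aa ha = kk:h

patL : ∀ {r r' c c'} → Adj r r' → Adj c c' → LPat (modeL r c) (modeL r c') (modeL r' c) (modeL r' c')
patL bb x = hhhh
patL aa x = ssss
patL bh bb = hhhh
patL bh bh = br
patL bh ha = bl
patL bh aa = hhhh
patL ha bb = hh:s
patL ha bh = tr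
patL ha ha = tl
patL ha aa = hh:s

modeE-half : ∀ {r c} → modeE r c ≡ half → c ≡ after
modeE-half {c = after} _ = refl
modeE-half {hit} {hit} ()
modeE-half {before} {hit} ()
modeE-half {after} {hit} ()

modeE-settle : ∀ {r c} → modeE r c ≡ settle → ⊥
modeE-settle {hit} {hit} ()
modeE-settle {before} {hit} ()
modeE-settle {after} {hit} ()

modeE-keep : ∀ {r c} → modeE r c ≡ keep → c ≡ before ⊎ (c ≡ hit × r ≢ hit)
modeE-keep {c = before} _ = inj₁ refl
modeE-keep {before} {hit} _ = inj₂ (refl , λ ())
modeE-keep {after} {hit} _ = inj₂ (refl , λ ())

modeE-activate : ∀ {r c} → modeE r c ≡ activate → r ≡ hit × c ≡ hit
modeE-activate {hit} {hit} _ = refl , refl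
modeE-activate {before} {hit} ()
modeE-activate {after} {hit} ()

modeL-half : ∀ {r c} → modeL r c ≡ half → r ≡ before ⊎ (r ≡ hit × c ≢ hit)
modeL-half {before} _ = inj₁ refl
modeL-half {hit} {before} _ = inj₂ (refl , λ ())
modeL-half {hit} {after} _ = inj₂ (refl , λ ())

modeL-settle : ∀ {r c} → modeL r c ≡ settle → r ≡ after
modeL-settle {after} _ = refl
modeL-settle {hit} {before} ()
modeL-settle {hit} {hit} ()
modeL-settle {hit} {after} ()

modeL-keep : ∀ {r c} → modeL r c ≡ keep → ⊥
modeL-keep {hit} {before} ()
modeL-keep {hit} {hit} ()
modeL-keep {hit} {after} ()

modeL-activate : ∀ {r c} → modeL r c ≡ activate → r ≡ hit × c ≡ hit
modeL-activate {hit} {hit} _ = refl , refl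
modeL-activate {hit} {before} ()
modeL-activate {hit} {after} ()

activated : (Position → Position → Mode) → ℕ → ℕ → Grid → Grid
activated μ i j = relab (λ k l → μ (position (suc i) k) (position (suc j) l))

modeOK-I : ∀ {φ' m v} → (m ≡ activate → isUn v ∧ allowed φ' (relabel activate v) ≡ true) → modeOK φ' m v ≡ true
modeOK-I {m = keep} h = refl
modeOK-I {m = half} h = refl
modeOK-I {m = settle} h = refl
modeOK-I {m = activate} h = h refl

hor-be-un : ∀ {v w} → hor v w ≡ true → isUn w ≡ true → isBe v ≡ false
hor-be-un {v} {w} h u = not-elim (sound (all any λ v → all any λ w → hor v w ⇒ isUn w ⇒ end (not
    (isBe v))) refl v refl w refl h u)

ver-be-un : ∀ {v w} → ver v w ≡ true → isUn w ≡ true → isBe v ≡ false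
ver-be-un {v} {w} h u = not-elim (sound (all any λ v → all any λ w → ver v w ⇒ isUn w ⇒ end (not
    (isBe v))) refl v refl w refl h u)

aroundH-I : ∀ {w} e → isBe w ≡ false → aroundH w e ≡ true
aroundH-I e h rewrite h = refl
aroundV-I : ∀ {n s} → isBe n ≡ false → aroundV n s ≡ true
aroundV-I h rewrite h = refl

-- `nx` is inherited from `nn`. `na` holds outright, because a b-box above the activated box would
-- have a larger rank than that box had before.
activateE : ∀ {g i j} → Idle early g → g (suc i) (suc j) ≡ un false →
  (∀ k l → g k l ≡ un false → suc j < l → isBe (g k (suc l)) ≡ false × isBe (g (suc k) l) ≡ false) →
  Active early (activated modeE i j g) i j
activateE {g} {i} {j} I c free = record
  { base = B
  ; at = at-c
  ; uniq = λ k l a → let r , s = modeE-activate (relabel-ac {v = g k l} a (noAc k l)) in pos-here r , pos-here s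
  ; ah = aroundH-I (activated modeE i j g (suc i) (2+ j)) (¬true⇒false λ b → true≢false (relabel-isBe {v = g
      (suc i) j} b) (hor-be-un (win-hor (wins (suc i) j)) (cong isUn c)))
  ; av = aroundV-I (¬true⇒false λ b → true≢false (relabel-isBe {v = g i (suc j)} b) (ver-be-un (win-ver (wins i
      (suc j))) (cong isUn c)))
  ; ord = record { o1 = o1 ; o2 = o2′ ; nx = nx ; na = na } }
  where
  open Idle I
  module O = IdleE ord
  g' = activated modeE i j g
  settled-half : ∀ {m v} → settles m v ≡ true → m ≢ settle → m ≡ half × v ≡ un false
  settled-half {half} {un false} _ _ = refl , refl
  settled-half {settle} {un _} _ h = ⊥-elim (h refl)
  settled-half {keep} {un _} () _
  settled-half {activate} {un _} () _
  settled-half {half} {un true} () _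
  B : Base early g'
  B = relab-base I
    (λ k l → modeOK-I {early} {modeE (position (suc i) k) (position (suc j) l)} {g k l} λ m → let r , s = modeE-activate m in
       trans (cong (λ v → isUn v ∧ allowed early (relabel activate v)) (trans (cong₂ g (pos-here r)
           (pos-here s)) c)) refl)
    (λ k l s → let m , v = settled-half s modeE-settle in free k l v (pos-after (modeE-half m)))
    (λ k l → relabelE (patE (adj (suc i) k) (adj (suc j) l)))
  at-c : isAct early (g' (suc i) (suc j)) ≡ true
  at-c rewrite c | pos-refl i | pos-refl j = refl
  o1 : ∀ k l → g' k l ≡ un false → l < suc j
  o1 k l u with relabel-un {v = g k l} u
  ... | v , inj₁ m with modeE-keep m
  ... | inj₁ b = pos-before b
  ... | inj₂ (h , r) with pos-here {suc j} {l} h | <-cmp k (suc i)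
  ... | refl | tri< lt _ _ = ⊥-elim (column-un base v (cong isUn c) lt)
  ... | refl | tri≈ _ refl _ = ⊥-elim (r (pos-refl i))
  ... | refl | tri> _ _ gt = ⊥-elim (column-un base c (cong isUn v) gt)
  o2′ : ∀ k l → isSe (g' k l) ≡ true → suc j < l
  o2′ k l s with relabel-se {v = g k l} (isSe-se s)
  ... | inj₁ v = O.o2 _ _ k l c (cong isSe v)
  ... | inj₂ (v , inj₁ m) = ⊥-elim (modeE-settle m)
  ... | inj₂ (v , inj₂ (m , _)) = pos-after (modeE-half m)
  nx : g' (suc i) (2+ j) ≡ be true → ∀ k → isSe (g' k (2+ j)) ≡ true → ⊥
  nx b k s with k ≤? suc i
  ... | yes k≤ = <-irrefl refl (≤-trans (≤-reflexive (sym (se-rank s)))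
      (≤-trans (Base.colMono B k≤ (Base.inside B (cong isVoid b))) (≤-reflexive (cong rankV b))))
  ... | no k≰ with relabel-se {v = g k (2+ j)} (isSe-se s)
  ... | inj₁ v = O.nn (suc i) (suc j) k c (relabel-be {v = g (suc i) (2+ j)} b) (≰⇒> k≰) (cong isSe v)
  ... | inj₂ (v , _) = <-irrefl refl (≤-trans (≤-reflexive (sym (cong rankV (relabel-be {v = g (suc i) (2+ j)} b))))
      (≤-trans (colMono (<⇒≤ (≰⇒> k≰)) (inside (cong isVoid v))) (≤-reflexive (cong rankV v))))
  na : ∀ k → g' k j ≡ un false → g' k (suc j) ≡ be true → k < suc i → ⊥
  na k _ b h = <-irrefl refl (≤-trans (≤-reflexive (sym (cong rankV (relabel-be {v = g k (suc j)} b))))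
      (≤-trans (colMono (<⇒≤ h) (inside (cong isVoid c))) (≤-reflexive (cong rankV c))))

-- Starting from an early idle grid, this opens the late phase. Then no primed box is settled yet,
-- so only boxes settled by this very relabelling have to be examined for `na₂`; having been
-- unmoved, they have no b-box to their west.
activateL : ∀ φ {g i j} → Idle φ g → g (suc i) (suc j) ≡ un true →
  (∀ k l → g k l ≡ un false ⊎ (g k l ≡ un true × suc i < k) → isBe (g k (suc l)) ≡ false × isBe (g (suc k) l) ≡ false) →
  Active late (activated modeL i j g) i j
activateL φ {g} {i} {j} I c free = record
  { base = B
  ; at = at-c
  ; uniq = λ k l a → let r , s = modeL-activate (relabel-ac {v = g k l} a (noAc k l)) in pos-here r , pos-here s
  ; ah = aroundH-I (g' (suc i) (2+ j)) west
  ; av = aroundV-I (¬true⇒false λ b → true≢false (relabel-isBe {v = g i (suc j)} b) (ver-be-un (win-ver (wins i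
      (suc j))) (cong isUn c)))
  ; ord = record { o1 = o1 ; o2 = o2′ φ I ; na₁ = λ w _ _ _ _ → true≢false w west ; na₂ = na₂ φ I } }
  where
  open Idle I
  g' = activated modeL i j g
  west : isBe (g' (suc i) j) ≡ false
  west = ¬true⇒false λ b → true≢false (relabel-isBe {v = g (suc i) j} b) (hor-be-un (win-hor (wins (suc i) j))
      (cong isUn c))
  settled : ∀ {m v} → settles m v ≡ true → v ≡ un false ⊎ (v ≡ un true × m ≡ settle)
  settled {half} {un false} _ = inj₁ refl
  settled {settle} {un false} _ = inj₁ refl
  settled {settle} {un true} _ = inj₂ (refl , refl)
  settled {keep} {un _} ()
  settled {activate} {un _} ()
  settled {half} {un true} ()
  free′ : ∀ k l {m} → m ≡ modeL (position (suc i) k) (position (suc j) l) → g k l ≡ un false ⊎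
      (g k l ≡ un true × m ≡ settle) →
    g k l ≡ un false ⊎ (g k l ≡ un true × suc i < k)
  free′ k l e (inj₁ v) = inj₁ v
  free′ k l e (inj₂ (v , m)) = inj₂ (v , pos-after (modeL-settle (trans (sym e) m)))
  B : Base late g'
  B = relab-base I
    (λ k l → modeOK-I {late} {modeL (position (suc i) k) (position (suc j) l)} {g k l} λ m → let r , s = modeL-activate m in
       trans (cong (λ v → isUn v ∧ allowed late (relabel activate v)) (trans (cong₂ g (pos-here r) (pos-here s)) c)) refl)
    (λ k l s → free k l (free′ k l refl (settled s)))
    (λ k l → relabelL φ (patL (adj (suc i) k) (adj (suc j) l)))
  at-c : isAct late (g' (suc i) (suc j)) ≡ true
  at-c rewrite c | pos-refl i | pos-refl j = refl
  o1 : ∀ k l → isUn (g' k l) ≡ true → k < suc i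
  o1 k l u with relabel-un {v = g k l} (isUn-un u)
  ... | v , inj₁ m = ⊥-elim (modeL-keep m)
  ... | v , inj₂ (m , p) with modeL-half m
  ... | inj₁ b = pos-before b
  ... | inj₂ (h , r) with pos-here {suc i} {k} h | <-cmp l (suc j)
  ... | refl | tri< lt _ _ = ⊥-elim (row-un base (cong isUn v) c lt)
  ... | refl | tri≈ _ refl _ = ⊥-elim (r (pos-refl j))
  ... | refl | tri> _ _ gt = ⊥-elim (row-un base (cong isUn c) (trans v (cong un p)) gt)
  o2′ : ∀ φ → Idle φ g → ∀ k l → g' k l ≡ se true → suc i < k
  o2′ φ I k l s with relabel-se {v = g k l} s
  o2′ early I k l s | inj₁ v = ⊥-elim (not-se-true (win-allowed (Idle.wins I k l)) v)
  o2′ late I k l s | inj₁ v = IdleL.o2 (Idle.ord I) _ _ k l (cong isUn c) v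
  ... | inj₂ (v , inj₁ m) = pos-after (modeL-settle m)
  na₂ : ∀ φ → Idle φ g → ∀ l → suc j < suc l → g' (2+ i) (suc l) ≡ se true → isBe (g' (2+ i) l) ≡ true →
          g' (suc i) (suc l) ≡ be false → ⊥
  na₂ φ I l h s w n with relabel-se {v = g (2+ i) (suc l)} s
  na₂ early I l h s w n | inj₁ v = ⊥-elim (not-se-true (win-allowed (Idle.wins I (2+ i) (suc l))) v)
  na₂ late I l h s w n | inj₁ v = IdleL.nn (Idle.ord I) (suc i) l (suc j) v (relabel-isBe {v = g (2+ i) l} w)
      (relabel-be {v = g (suc i) (suc l)} n) h (cong isUn c)
  ... | inj₂ (v , _) = true≢false (relabel-isBe {v = g (2+ i) l} w) (hor-be-un (win-hor (Idle.wins I (2+ i) l))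
      (cong isUn v))

-- States represented by grids

count : (Cell → Bool) → List Cell → ℕ
count f xs = length (filterᵇ f xs)

bit : Bool → ℕ
bit true = 1
bit false = 0

count-∷ : ∀ f x xs → count f (x ∷ xs) ≡ bit (f x) + count f xs
count-∷ f x xs with f x
... | true = refl
... | false = refl

count-cong : ∀ {f h} xs → (∀ x → x ∈ xs → f x ≡ h x) → count f xs ≡ count h xs
count-cong [] e = refl
count-cong {f} {h} (x ∷ xs) e = trans (count-∷ f x xs) (trans
  (cong₂ _+_ (cong bit (e x (here refl))) (count-cong xs (λ y m → e y (there m)))) (sym (count-∷ h x xs)))

count-point : ∀ {f h c xs} → Unique xs → c ∈ xs → (∀ x → x ≢ c → h x ≡ f x) → count h xs + bit
    (f c) ≡ count f xs + bit (h c)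
count-point {f} {h} {c} {x ∷ xs} (x∉ ∷ u) (here refl) e = begin
  count h (c ∷ xs) + bit (f c)        ≡⟨ cong (_+ bit (f c)) (count-∷ h c xs) ⟩
  bit (h c) + count h xs + bit (f c)  ≡⟨ +-assoc (bit (h c)) _ _ ⟩
  bit (h c) + (count h xs + bit (f c)) ≡⟨ +-comm (bit (h c)) _ ⟩
  count h xs + bit (f c) + bit (h c)  ≡⟨ cong (_+ bit (h c)) (+-comm (count h xs) _) ⟩
  bit (f c) + count h xs + bit (h c)  ≡⟨ cong (λ n → bit (f c) + n + bit (h c)) (count-cong xs (λ y m → e y (λ { refl
      → All.lookup x∉ m refl }))) ⟩
  bit (f c) + count f xs + bit (h c)  ≡⟨ cong (_+ bit (h c)) (sym (count-∷ f c xs)) ⟩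
  count f (c ∷ xs) + bit (h c) ∎
  where open ≡-Reasoning
count-point {f} {h} {c} {x ∷ xs} (x∉ ∷ u) (there m) e = begin
  count h (x ∷ xs) + bit (f c)         ≡⟨ cong (_+ bit (f c)) (count-∷ h x xs) ⟩
  bit (h x) + count h xs + bit (f c)   ≡⟨ +-assoc (bit (h x)) _ _ ⟩
  bit (h x) + (count h xs + bit (f c)) ≡⟨ cong₂ _+_ (cong bit (e x (All.lookup x∉ m))) (count-point u m e) ⟩
  bit (f x) + (count f xs + bit (h c)) ≡⟨ sym (+-assoc (bit (f x)) _ _) ⟩
  bit (f x) + count f xs + bit (h c)   ≡⟨ cong (_+ bit (h c)) (sym (count-∷ f x xs)) ⟩
  count f (x ∷ xs) + bit (h c) ∎
  where open ≡-Reasoning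

_≟ᶜ_ : (c d : Cell) → Dec (c ≡ d)
_≟ᶜ_ = ≡-dec _≟_ _≟_

-- The exchange is split at the predicate `k`, which differs from `f` only at `c` and from `h` only
-- at `d`. `count-point` treats one cell and is additive, because a single change may raise or lower
-- the count.
count-swap : ∀ {f h c d xs} → Unique xs → c ∈ xs → d ∈ xs → c ≢ d → h c ≡ f d → h d ≡ f c →
  (∀ x → x ≢ c → x ≢ d → h x ≡ f x) → count h xs ≡ count f xs
count-swap {f} {h} {c} {d} {xs} u mc md c≢d hc hd e = +-cancelʳ-≡ (bit (f d)) _ _ (begin
  count h xs + bit (f d) ≡⟨ cong (λ b → count h xs + bit b) (sym kd) ⟩
  count h xs + bit (k d) ≡⟨ count-point u md h≈k ⟩
  count k xs + bit (h d) ≡⟨ cong (λ b → count k xs + bit b) hd ⟩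
  count k xs + bit (f c) ≡⟨ count-point u mc k≈f ⟩
  count f xs + bit (k c) ≡⟨ cong (λ b → count f xs + bit b) (trans kc hc) ⟩
  count f xs + bit (f d) ∎)
  where
  open ≡-Reasoning
  k : Cell → Bool
  k x = if does (x ≟ᶜ c) then h c else f x
  kc : k c ≡ h c
  kc with c ≟ᶜ c
  ... | yes _ = refl
  ... | no n = ⊥-elim (n refl)
  kd : k d ≡ f d
  kd with d ≟ᶜ c
  ... | yes e = ⊥-elim (c≢d (sym e))
  ... | no _ = refl
  k≈f : ∀ x → x ≢ c → k x ≡ f x
  k≈f x n with x ≟ᶜ c
  ... | yes e = ⊥-elim (n e)
  ... | no _ = refl
  h≈k : ∀ x → x ≢ d → h x ≡ k x
  h≈k x n with x ≟ᶜ c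
  ... | yes refl = refl
  ... | no m = e x m n

≡ᵇ-refl : ∀ n → (n ≡ᵇ n) ≡ true
≡ᵇ-refl zero = refl
≡ᵇ-refl (suc n) = ≡ᵇ-refl n

≡ᵇ-suc : ∀ n → (n ≡ᵇ suc n) ≡ false
≡ᵇ-suc zero = refl
≡ᵇ-suc (suc n) = ≡ᵇ-suc n

suc-≡ᵇ : ∀ n → (suc n ≡ᵇ n) ≡ false
suc-≡ᵇ zero = refl
suc-≡ᵇ (suc n) = suc-≡ᵇ n

≡ᵇ-≢ : ∀ {m n} → m ≢ n → (m ≡ᵇ n) ≡ false
≡ᵇ-≢ {m} {n} h = ¬true⇒false λ e → h (≡ᵇ⇒≡ m n (subst T (sym e) _))

upd-≢ : ∀ {i j v st k l} → k ≢ i ⊎ l ≢ j → upd (i , j) v st (k , l) ≡ st (k , l)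
upd-≢ {i} {j} {v} {st} {k} {l} (inj₁ h) rewrite ≡ᵇ-≢ {i} {k} (λ e → h (sym e)) = refl
upd-≢ {i} {j} {v} {st} {k} {l} (inj₂ h) rewrite ≡ᵇ-≢ {j} {l} (λ e → h (sym e)) with i ≡ᵇ k
... | true = refl
... | false = refl

out-11 : ∀ {i j k l} → Outside i j k l → k ≢ i ⊎ l ≢ j
out-11 (inj₁ (p , _)) = inj₁ p
out-11 (inj₂ (p , _)) = inj₂ p
out-12 : ∀ {i j k l} → Outside i j k l → k ≢ i ⊎ l ≢ suc j
out-12 (inj₁ (p , _)) = inj₁ p
out-12 (inj₂ (_ , p)) = inj₂ p
out-21 : ∀ {i j k l} → Outside i j k l → k ≢ suc i ⊎ l ≢ j
out-21 (inj₁ (_ , p)) = inj₁ p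
out-21 (inj₂ (p , _)) = inj₂ p
out-22 : ∀ {i j k l} → Outside i j k l → k ≢ suc i ⊎ l ≢ suc j
out-22 (inj₁ (_ , p)) = inj₁ p
out-22 (inj₂ (_ , p)) = inj₂ p

module _ {i j : ℕ} {v : Maybe (Lab × Letter)} {st : State} where
  upd-at : upd (i , j) v st (i , j) ≡ v
  upd-at rewrite ≡ᵇ-refl i | ≡ᵇ-refl j = refl

live : V → Bool
live v = inA v ∨ isBe v

-- Cells of the two current letters may exchange them; all others keep their value. This is how the
-- shape and the remaining letters are preserved.
Same : V → V → Set
Same v w = v ≡ w ⊎ (live v ≡ true × live w ≡ true)

Same-trans : ∀ {u v w} → Same u v → Same v w → Same u w
Same-trans (inj₁ refl) s = s
Same-trans (inj₂ h) (inj₁ refl) = inj₂ h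
Same-trans (inj₂ (h , _)) (inj₂ (_ , h')) = inj₂ (h , h')

-- `o` is the content of the cell when the stage began, which cells outside the two letters retain.
-- The distinction between unmoved, active and settled leaves no trace in the state.
emb : ℕ → ℕ → Maybe (Lab × Letter) → V → Maybe (Lab × Letter)
emb p q o (un r) = just (SL , mkL p r)
emb p q o (ac r) = just (SL , mkL p r)
emb p q o (se r) = just (SL , mkL p r)
emb p q o (be r) = just (TL , mkL q r)
emb p q o _ = o

is′ : Lab → ℕ → Maybe (Lab × Letter) → Bool
is′ L n = maybe (λ x → labEq L (proj₁ x) ∧ (num (proj₂ x) ≡ᵇ n)) false

record Start (p q : ℕ) (st₀ : State) (g₀ : Grid) (cs : List Cell) : Set where
  field
    cs-unique : Unique cs
    dead : ∀ k l → live (g₀ k l) ≡ false → isLN SL p st₀ (k , l) ≡ false × isLN TL q st₀ (k , l) ≡ false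
    live-∈ : ∀ k l → live (g₀ k l) ≡ true → (k , l) ∈ cs
    live-row : ∀ k l → live (g₀ k l) ≡ true → 1 ≤ k

record Link (p q : ℕ) (st₀ : State) (g₀ : Grid) (cs : List Cell) (g : Grid) (st : State) : Set where
  field
    rep  : ∀ k l → st (k , l) ≡ emb p q (st₀ (k , l)) (g k l)
    same : ∀ k l → Same (g₀ k l) (g k l)
    cnt  : ∀ L n → count (isLN L n st) cs ≡ count (isLN L n st₀) cs

module _ {p q : ℕ} where
  emb-live : ∀ {o o'} v → live v ≡ true → emb p q o v ≡ emb p q o' v
  emb-live (un _) _ = refl
  emb-live (ac _) _ = refl
  emb-live (se _) _ = refl
  emb-live (be _) _ = refl

  emb-A : ∀ o v L n → inA v ≡ true → is′ L n (emb p q o v) ≡ labEq L SL ∧ (p ≡ᵇ n)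
  emb-A o (un _) L n _ = refl
  emb-A o (ac _) L n _ = refl
  emb-A o (se _) L n _ = refl

  emb-B : ∀ o v L n → isBe v ≡ true → is′ L n (emb p q o v) ≡ labEq L TL ∧ (q ≡ᵇ n)
  emb-B o (be _) L n _ = refl

  emb-prim : ∀ o v → live v ≡ true → primed (maybe proj₂ (mkL 0 false) (emb p q o v)) ≡ primedV v
  emb-prim o (un _) _ = refl
  emb-prim o (ac _) _ = refl
  emb-prim o (se _) _ = refl
  emb-prim o (be _) _ = refl

be-live : ∀ {v} → isBe v ≡ true → live v ≡ true
be-live {be _} _ = refl
ac-live : ∀ {v} → isAc v ≡ true → live v ≡ true
ac-live {ac _} _ = refl
ac-A : ∀ {v} → isAc v ≡ true → inA v ≡ true
ac-A {ac _} _ = refl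
un-live : ∀ {v} → isUn v ≡ true → live v ≡ true
un-live {un _} _ = refl
un-A : ∀ {v} → isUn v ≡ true → inA v ≡ true
un-A {un _} _ = refl

Same-live : ∀ {v w} → Same v w → live w ≡ true → live v ≡ true
Same-live (inj₁ refl) h = h
Same-live (inj₂ (h , _)) _ = h

module Linked {p q st₀ g₀ cs} (S : Start p q st₀ g₀ cs) where
  open Start S

  module _ {g st} (K : Link p q st₀ g₀ cs g st) where
    open Link K

    lk-∈ : ∀ k l → live (g k l) ≡ true → (k , l) ∈ cs
    lk-∈ k l h = live-∈ k l (Same-live (same k l) h)

    lk-row : ∀ k l → live (g k l) ≡ true → 1 ≤ k
    lk-row k l h = live-row k l (Same-live (same k l) h)

    lk-dead : ∀ k l → live (g k l) ≡ false → isLN SL p st₀ (k , l) ≡ false × isLN TL q st₀ (k , l) ≡ false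
    lk-dead k l h with same k l
    ... | inj₁ e = dead k l (trans (cong live e) h)
    ... | inj₂ (_ , h') = ⊥-elim (true≢false h' h)

    lkA : ∀ k l → isA p q st (k , l) ≡ inA (g k l)
    lkA k l rewrite rep k l with g k l | lk-dead k l
    ... | un _ | _ = ≡ᵇ-refl p
    ... | ac _ | _ = ≡ᵇ-refl p
    ... | se _ | _ = ≡ᵇ-refl p
    ... | be _ | _ = refl
    ... | void | d = proj₁ (d refl)
    ... | low | d = proj₁ (d refl)
    ... | high | d = proj₁ (d refl)

    lkB : ∀ k l → isB p q st (k , l) ≡ isBe (g k l)
    lkB k l rewrite rep k l with g k l | lk-dead k l
    ... | un _ | _ = refl
    ... | ac _ | _ = refl
    ... | se _ | _ = refl
    ... | be _ | _ = ≡ᵇ-refl q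
    ... | void | d = proj₂ (d refl)
    ... | low | d = proj₂ (d refl)
    ... | high | d = proj₂ (d refl)

    lk-prim : ∀ k l → live (g k l) ≡ true → prim st (k , l) ≡ primedV (g k l)
    lk-prim k l h rewrite rep k l = emb-prim {p} {q} _ (g k l) h

    lk-nbr : ∀ k l → hasBnbr p q st (k , l) ≡ isBe (g k (suc l)) ∨ isBe (g (suc k) l)
    lk-nbr k l = cong₂ _∨_ (lkB k (suc l)) (lkB (suc k) l)

    -- Every move exchanges an a-box with a b-box, up to primes.
    link-put : ∀ {i j a b c d} (st' : State) c₁ c₂ →
      let P = λ k l v → st' (k , l) ≡ emb p q (st₀ (k , l)) v ; g' = put i j a b c d g in
      P i j a → P i (suc j) b → P (suc i) j c → P (suc i) (suc j) d →
      (∀ k l → Outside i j k l → st' (k , l) ≡ st (k , l)) →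
      Same (g i j) a → Same (g i (suc j)) b → Same (g (suc i) j) c → Same (g (suc i) (suc j)) d →
      inA (g (proj₁ c₁) (proj₂ c₁)) ≡ true → isBe (g (proj₁ c₂) (proj₂ c₂)) ≡ true →
      isBe (g' (proj₁ c₁) (proj₂ c₁)) ≡ true → inA (g' (proj₁ c₂) (proj₂ c₂)) ≡ true →
      (let Q = λ k l v → (k , l) ≢ c₁ → (k , l) ≢ c₂ → ∀ L n → is′ L n (emb p q (st₀ (k , l)) v) ≡ is′ L n (emb p q (st₀ (k , l)) (g k l)) in
       Q i j a × Q i (suc j) b × Q (suc i) j c × Q (suc i) (suc j) d) →
      Link p q st₀ g₀ cs g' st'
    link-put {i} {j} {a} {b} {c} {d} st' c₁ c₂ pa pb pc pd po sa sb sc sd A₁ B₂ B₁' A₂' (qa , qb , qc , qd) = record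
      { rep = rep'
      ; same = λ k l → Same-trans (same k l) (put-elim (λ k l v → Same (g k l) v) sa sb sc sd (λ k l _ → inj₁ refl) k l)
      ; cnt = λ L n → trans (count-swap {isLN L n st} {isLN L n st'} {c₁} {c₂} cs-unique
           (lk-∈ _ _ (A-live {g (proj₁ c₁) (proj₂ c₁)} A₁)) (lk-∈ _ _ (be-live B₂)) c₁≢c₂
           (trans (cong (is′ L n) (rep' _ _)) (trans (emb-B {p} {q} (st₀ c₁) (g' (proj₁ c₁) (proj₂ c₁)) L n B₁') (sym
               (trans (cong (is′ L n) (rep _ _)) (emb-B {p} {q} (st₀ c₂) (g (proj₁ c₂) (proj₂ c₂)) L n B₂)))))
           (trans (cong (is′ L n) (rep' _ _)) (trans (emb-A {p} {q} (st₀ c₂) (g' (proj₁ c₂) (proj₂ c₂)) L n A₂') (sym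
               (trans (cong (is′ L n) (rep _ _)) (emb-A {p} {q} (st₀ c₁) (g (proj₁ c₁) (proj₂ c₁)) L n A₁)))))
           (λ x n₁ n₂ → trans (cong (is′ L n) (rep' _ _)) (trans (others (proj₁ x) (proj₂ x) n₁ n₂ L n) (sym (cong
               (is′ L n) (rep _ _))))))
           (cnt L n) }
      where
      g' = put i j a b c d g
      A-live : ∀ {v} → inA v ≡ true → live v ≡ true
      A-live {un _} _ = refl
      A-live {ac _} _ = refl
      A-live {se _} _ = refl
      A≢B : ∀ {v} → inA v ≡ true → isBe v ≡ true → ⊥
      A≢B {be _} () _
      c₁≢c₂ : c₁ ≢ c₂
      c₁≢c₂ refl = A≢B A₁ B₂
      rep' : ∀ k l → st' (k , l) ≡ emb p q (st₀ (k , l)) (g' k l)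
      rep' = put-elim (λ k l v → st' (k , l) ≡ emb p q (st₀ (k , l)) v) pa pb pc pd (λ k l o → trans (po k l o) (rep k l))
      others : ∀ k l → (k , l) ≢ c₁ → (k , l) ≢ c₂ → ∀ L n →
        is′ L n (emb p q (st₀ (k , l)) (g' k l)) ≡ is′ L n (emb p q (st₀ (k , l)) (g k l))
      others = put-elim (λ k l v → (k , l) ≢ c₁ → (k , l) ≢ c₂ → ∀ L n →
        is′ L n (emb p q (st₀ (k , l)) v) ≡ is′ L n (emb p q (st₀ (k , l)) (g k l))) qa qb qc qd (λ k l _ _ _ _ _ → refl)

-- Carrying out one switch

data Good (g : Grid) : Set where
  active : ∀ φ i j → Active φ g i j → Good g
  idle   : ∀ φ → Idle φ g → Good g

-- The case distinction of `switch`, abstracted from its nine tests and its possible outcomes so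
-- that each branch is reduced once, on small terms. In the lemmas below, `gen` means an a-box off
-- the diagonal and not next to it, `diag` one on it, `near` one just east of it.
opaque
  swOf : (diag nd αp eB eBp sB sBp dB aB : Bool) (r₁ r₂ r₃ r₄ r₅ rE rS r : State) → State
  swOf diag nd αp eB eBp sB sBp dB aB r₁ r₂ r₃ r₄ r₅ rE rS r =
    if diag ∧ eB ∧ eBp ∧ dB then r₁
    else if diag ∧ not αp ∧ eB ∧ eBp ∧ not sB then r₂
    else if nd ∧ αp ∧ eB ∧ not eBp ∧ sB ∧ not sBp then r₃
    else if nd ∧ αp ∧ sB ∧ not sBp ∧ not eB then r₄
    else if nd ∧ not αp ∧ aB ∧ sB ∧ (not eB ∨ not eBp) then r₅
    else if eB ∧ sB ∧ eBp then rE
    else if eB ∧ sB then rS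
    else if eB then rE
    else if sB then rS
    else r

module _ {r₁ r₂ r₃ r₄ r₅ rE rS r : State} where
  opaque
    unfolding swOf
    gen-E₁ : ∀ {αp sBp dB aB} → swOf false false αp true true true sBp dB aB r₁ r₂ r₃ r₄ r₅ rE rS r ≡ rE
    gen-E₁ = refl
    gen-E₂ : ∀ {αp eBp sBp dB aB} → swOf false false αp true eBp false sBp dB aB r₁ r₂ r₃ r₄ r₅ rE rS r ≡ rE
    gen-E₂ = refl
    gen-S₁ : ∀ {αp sBp dB aB} → swOf false false αp true false true sBp dB aB r₁ r₂ r₃ r₄ r₅ rE rS r ≡ rS
    gen-S₁ = refl
    gen-S₂ : ∀ {αp eBp sBp dB aB} → swOf false false αp false eBp true sBp dB aB r₁ r₂ r₃ r₄ r₅ rE rS r ≡ rS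
    gen-S₂ = refl
    diag-1 : ∀ {sBp aB} → swOf true false false true true false sBp true aB r₁ r₂ r₃ r₄ r₅ rE rS r ≡ r₁
    diag-1 = refl
    diag-2 : ∀ {sBp aB} → swOf true false false true true false sBp false aB r₁ r₂ r₃ r₄ r₅ rE rS r ≡ r₂
    diag-2 = refl
    diag-E : ∀ {sBp dB aB} → swOf true false false true false false sBp dB aB r₁ r₂ r₃ r₄ r₅ rE rS r ≡ rE
    diag-E = refl
    near-E₁ : ∀ {eBp sBp dB} → swOf false true false true eBp false sBp dB true r₁ r₂ r₃ r₄ r₅ rE rS r ≡ rE
    near-E₁ = refl
    near-E₂ : ∀ {eBp sBp dB} → swOf false true false true eBp false sBp dB false r₁ r₂ r₃ r₄ r₅ rE rS r ≡ rE
    near-E₂ = refl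
    near-E₃ : ∀ {dB} → swOf false true false true true true false dB true r₁ r₂ r₃ r₄ r₅ rE rS r ≡ rE
    near-E₃ = refl
    near-E₄ : ∀ {dB} → swOf false true false true true true false dB false r₁ r₂ r₃ r₄ r₅ rE rS r ≡ rE
    near-E₄ = refl
    near-E₅ : ∀ {sBp dB aB} → swOf false true true true true false sBp dB aB r₁ r₂ r₃ r₄ r₅ rE rS r ≡ rE
    near-E₅ = refl
    near-E₆ : ∀ {sBp dB aB} → swOf false true true true false false sBp dB aB r₁ r₂ r₃ r₄ r₅ rE rS r ≡ rE
    near-E₆ = refl
    near-E₇ : ∀ {dB aB} → swOf false true true true true true false dB aB r₁ r₂ r₃ r₄ r₅ rE rS r ≡ rE
    near-E₇ = refl
    near-S₁ : ∀ {dB} → swOf false true false true false true false dB false r₁ r₂ r₃ r₄ r₅ rE rS r ≡ rS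
    near-S₁ = refl
    near-S₂ : ∀ {eBp dB} → swOf false true false false eBp true false dB false r₁ r₂ r₃ r₄ r₅ rE rS r ≡ rS
    near-S₂ = refl
    near-3 : ∀ {dB aB} → swOf false true true true false true false dB aB r₁ r₂ r₃ r₄ r₅ rE rS r ≡ r₃
    near-3 = refl
    near-4 : ∀ {eBp dB aB} → swOf false true true false eBp true false dB aB r₁ r₂ r₃ r₄ r₅ rE rS r ≡ r₄
    near-4 = refl
    near-5₁ : ∀ {dB} → swOf false true false true false true false dB true r₁ r₂ r₃ r₄ r₅ rE rS r ≡ r₅
    near-5₁ = refl
    near-5₂ : ∀ {eBp dB} → swOf false true false false eBp true false dB true r₁ r₂ r₃ r₄ r₅ rE rS r ≡ r₅
    near-5₂ = refl

act-prim-early : ∀ {v} → isAct early v ≡ true → primedV v ≡ false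
act-prim-early {ac false} _ = refl
act-prim-early {se false} ()
act-prim-early {se true} ()
act-prim-late : ∀ {v} → isAct late v ≡ true → primedV v ≡ true
act-prim-late {ac true} _ = refl
act-prim-late {un false} ()
act-prim-late {un true} ()
hor-off : ∀ {v w} → isVoid v ≡ true → hor v w ≡ true → primedV w ≡ false
hor-off {void} _ h = not-elim h

Apart : Cell → Cell → Set
Apart x c = proj₁ x ≢ proj₁ c ⊎ proj₂ x ≢ proj₂ c

module Upd2 (c₁ : Cell) (v₁ : Maybe (Lab × Letter)) (c₂ : Cell) (v₂ : Maybe (Lab × Letter)) (st : State) where
  s : State
  s = upd c₁ v₁ (upd c₂ v₂ st)
  at₁ : s c₁ ≡ v₁
  at₁ = upd-at {proj₁ c₁} {proj₂ c₁} {v₁} {upd c₂ v₂ st}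
  at₂ : Apart c₂ c₁ → s c₂ ≡ v₂
  at₂ a = trans (upd-≢ {proj₁ c₁} {proj₂ c₁} {v₁} {upd c₂ v₂ st} a) (upd-at {proj₁ c₂} {proj₂ c₂} {v₂} {st})
  els : ∀ x → Apart x c₁ → Apart x c₂ → s x ≡ st x
  els x a b = trans (upd-≢ {proj₁ c₁} {proj₂ c₁} {v₁} {upd c₂ v₂ st} a) (upd-≢ {proj₁ c₂} {proj₂ c₂} {v₂} {st} b)

module Upd3 (c₁ : Cell) (v₁ : Maybe (Lab × Letter)) (c₂ : Cell) (v₂ : Maybe (Lab × Letter))
  (c₃ : Cell) (v₃ : Maybe (Lab × Letter)) (st : State) where
  private module U = Upd2 c₂ v₂ c₃ v₃ st
  s : State
  s = upd c₁ v₁ U.s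
  at₁ : s c₁ ≡ v₁
  at₁ = upd-at {proj₁ c₁} {proj₂ c₁} {v₁} {U.s}
  at₂ : Apart c₂ c₁ → s c₂ ≡ v₂
  at₂ a = trans (upd-≢ {proj₁ c₁} {proj₂ c₁} {v₁} {U.s} a) U.at₁
  at₃ : Apart c₃ c₁ → Apart c₃ c₂ → s c₃ ≡ v₃
  at₃ a b = trans (upd-≢ {proj₁ c₁} {proj₂ c₁} {v₁} {U.s} a) (U.at₂ b)
  els : ∀ x → Apart x c₁ → Apart x c₂ → Apart x c₃ → s x ≡ st x
  els x a b d = trans (upd-≢ {proj₁ c₁} {proj₂ c₁} {v₁} {U.s} a) (U.els x b d)

module Step {p q st₀ g₀ cs} (S : Start p q st₀ g₀ cs) where
  open Start S
  open Linked S

  record Result (st' : State) : Set where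
    constructor result
    field
      {new} : Grid
      link : Link p q st₀ g₀ cs new st'
      good : Good new

  module _ {φ g st i j} (Ac : Active φ g i j) (K : Link p q st₀ g₀ cs g st) where
    open Around Ac
    open Link K

    private
      c E Sd D : Cell
      c = (suc i , suc j)
      E = (suc i , 2+ j)
      Sd = (2+ i , suc j)
      D = (2+ i , 2+ j)

      hx : live (g (suc i) (suc j)) ≡ true
      hx = ac-live hac

      hxA : inA (g (suc i) (suc j)) ≡ true
      hxA = ac-A hac

    resE : isBe (g (suc i) (2+ j)) ≡ true →
      not (isVoid (g (2+ i) (suc j)) ∧ primedV (g (suc i) (2+ j))) ≡ true →
      not (isBe (g (2+ i) (suc j)) ∧ not (primedV (g (suc i) (2+ j)))) ≡ true →
      Result (swapC c E st)
    resE he h₁ h₂ = result (link-put K (swapC c E st) c E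
        (trans U.at₁ (trans (rep _ _) (emb-live (g (suc i) (2+ j)) (be-live he))))
        (trans (U.at₂ (inj₂ λ ())) (trans (rep _ _) (emb-live (g (suc i) (suc j)) hx)))
        (trans (U.els Sd (inj₁ λ ()) (inj₁ λ ())) (rep _ _))
        (trans (U.els D (inj₁ λ ()) (inj₁ λ ())) (rep _ _))
        (λ k l o → U.els (k , l) (out-11 o) (out-12 o))
        (inj₂ (hx , be-live he)) (inj₂ (be-live he , hx)) (inj₁ refl) (inj₁ refl)
        hxA he (trans (cong isBe put-11) he) (trans (cong inA put-12) hxA)
        ((λ n → ⊥-elim (n refl)) , (λ _ n → ⊥-elim (n refl)) , (λ _ _ _ _ → refl) , (λ _ _ _ _ → refl)))
      (active φ i (suc j) (moveE φ Ac he h₁ h₂))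
      where module U = Upd2 c (st E) E (st c) st

    resS : isBe (g (2+ i) (suc j)) ≡ true →
      not (isBe (g (suc i) (2+ j)) ∧ primedV (g (suc i) (2+ j))) ≡ true →
      special φ (g (suc i) j) (g (2+ i) j) ≡ true →
      Result (swapC c Sd st)
    resS hs h₁ h₂ = result (link-put K (swapC c Sd st) c Sd
        (trans U.at₁ (trans (rep _ _) (emb-live (g (2+ i) (suc j)) (be-live hs))))
        (trans (U.els E (inj₂ λ ()) (inj₂ λ ())) (rep _ _))
        (trans (U.at₂ (inj₁ λ ())) (trans (rep _ _) (emb-live (g (suc i) (suc j)) hx)))
        (trans (U.els D (inj₁ λ ()) (inj₂ λ ())) (rep _ _))
        (λ k l o → U.els (k , l) (out-11 o) (out-21 o))
        (inj₂ (hx , be-live hs)) (inj₁ refl) (inj₂ (be-live hs , hx)) (inj₁ refl)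
        hxA hs (trans (cong isBe put-11) hs) (trans (cong inA put-21) hxA)
        ((λ n → ⊥-elim (n refl)) , (λ _ _ _ _ → refl) , (λ _ n → ⊥-elim (n refl)) , (λ _ _ _ _ → refl)))
      (active φ (suc i) j (moveS φ Ac hs h₁ h₂))
      where module U = Upd2 c (st Sd) Sd (st c) st

  entry-be : ∀ {g st} → Link p q st₀ g₀ cs g st → ∀ k l → isBe (g k l) ≡ true → ∀ o → just (TL , entry st (k ,
      l)) ≡ emb p q o (g k l)
  entry-be {g} K k l h o rewrite Link.rep K k l with g k l
  ... | be _ = refl

  entry-A : ∀ {g st} → Link p q st₀ g₀ cs g st → ∀ k l → inA (g k l) ≡ true → entry st (k , l) ≡ mkL p (primedV (g k l))
  entry-A {g} K k l h rewrite Link.rep K k l with g k l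
  ... | un _ = refl
  ... | ac _ = refl
  ... | se _ = refl

  module _ {g st i} (Ac : Active early g i i) (K : Link p q st₀ g₀ cs g st)
    (he : isBe (g (suc i) (2+ i)) ≡ true) (pe : primedV (g (suc i) (2+ i)) ≡ true) where
    open Around Ac
    open Link K

    resS3 : isBe (g (2+ i) (2+ i)) ≡ true →
      Result (upd (suc i , suc i) (just (TL , entry st (2+ i , 2+ i)))
        (upd (suc i , 2+ i) (just (TL , mkL q false))
          (upd (2+ i , 2+ i) (just (SL , entry st (suc i , suc i))) st)))
    resS3 hd = result (link-put K U.s (suc i , suc i) (2+ i , 2+ i)
        (trans U.at₁ (entry-be K _ _ hd _))
        (U.at₂ (inj₂ λ ()))
        (trans (U.els (2+ i , suc i) (inj₁ λ ()) (inj₁ λ ()) (inj₂ λ ())) (rep _ _))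
        (trans (U.at₃ (inj₁ λ ()) (inj₁ λ ())) (cong (λ x → just (SL , x)) (trans (entry-A K _ _ (ac-A hac)) (cong
            (mkL p) (act-prim-early {g (suc i) (suc i)} at)))))
        (λ k l o → U.els (k , l) (out-11 o) (out-12 o) (out-22 o))
        (inj₂ (ac-live hac , be-live hd)) (inj₂ (be-live he , refl)) (inj₁ refl) (inj₂ (be-live hd , refl))
        (ac-A hac) hd (trans (cong isBe put-11) hd) (cong inA put-22)
        ((λ n → ⊥-elim (n refl)) , (λ _ _ L n → sym (emb-B {p} {q} (st₀ (suc i , 2+ i)) (g (suc i) (2+ i)) L n he))
          , (λ _ _ _ _ → refl) , (λ _ n → ⊥-elim (n refl))))
      (idle early (moveS3 Ac he pe hd))
      where
      module U = Upd3 (suc i , suc i) (just (TL , entry st (2+ i , 2+ i)))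
        (suc i , 2+ i) (just (TL , mkL q false)) (2+ i , 2+ i) (just (SL , entry st (suc i , suc i))) st

    resS1′ : isBe (g (2+ i) (2+ i)) ≡ false →
      Result (upd (suc i , suc i) (just (TL , mkL q false)) (upd (suc i , 2+ i) (just (SL , mkL p true)) st))
    resS1′ hd = result (link-put K U.s (suc i , suc i) (suc i , 2+ i)
        U.at₁
        (U.at₂ (inj₂ λ ()))
        (trans (U.els (2+ i , suc i) (inj₁ λ ()) (inj₁ λ ())) (rep _ _))
        (trans (U.els (2+ i , 2+ i) (inj₁ λ ()) (inj₁ λ ())) (rep _ _))
        (λ k l o → U.els (k , l) (out-11 o) (out-12 o))
        (inj₂ (ac-live hac , refl)) (inj₂ (be-live he , refl)) (inj₁ refl) (inj₁ refl)
        (ac-A hac) he (cong isBe put-11) (cong inA put-12)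
        ((λ n → ⊥-elim (n refl)) , (λ _ n → ⊥-elim (n refl)) , (λ _ _ _ _ → refl) , (λ _ _ _ _ → refl)))
      (active late i (suc i) (moveS1′ Ac he pe (not-intro hd)))
      where module U = Upd2 (suc i , suc i) (just (TL , mkL q false)) (suc i , 2+ i) (just (SL , mkL p true)) st

  module _ {φ g st i} (Ac : Active φ g i (suc i)) (K : Link p q st₀ g₀ cs g st)
    (hd : isBe (g (2+ i) (2+ i)) ≡ true) where
    open Around Ac
    open Link K

    link-S26′ : ∀ st' → (∀ k l → Outside (suc i) (suc i) k l → st' (k , l) ≡ st (k , l)) →
      st' (suc i , suc i) ≡ st (suc i , suc i) → st' (suc i , 2+ i) ≡ just (TL , mkL q true) →
      st' (2+ i , suc i) ≡ st (2+ i , suc i) → st' (2+ i , 2+ i) ≡ just (SL , mkL p false) →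
      Link p q st₀ g₀ cs (put (suc i) (suc i) (g (suc i) (suc i)) (be true) (g (2+ i) (suc i)) (se false) g) st'
    link-S26′ st' po pa pb pc pd = link-put K st' (suc i , 2+ i) (2+ i , 2+ i)
        (trans pa (rep _ _)) pb (trans pc (rep _ _)) pd po
        (inj₁ refl) (inj₂ (ac-live hac , refl)) (inj₁ refl) (inj₂ (be-live hd , refl))
        (ac-A hac) hd (cong isBe put-12) (cong inA put-22)
        ((λ _ _ _ _ → refl) , (λ n → ⊥-elim (n refl)) , (λ _ _ _ _ → refl) , (λ _ n → ⊥-elim (n refl)))

  module _ {g st i} (Ac : Active late g i (suc i)) (K : Link p q st₀ g₀ cs g st)
    (hd : isBe (g (2+ i) (2+ i)) ≡ true) where
    open Around Ac
    open Link K

    resS2′ : isBe (g (suc i) (3+ i)) ≡ false →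
      Result (upd (suc i , 2+ i) (just (TL , mkL q true)) (upd (2+ i , 2+ i) (just (SL , mkL p false)) st))
    resS2′ hu = result (link-S26′ Ac K hd U.s
        (λ k l o → U.els (k , l) (out-12 o) (out-22 o))
        (U.els (suc i , suc i) (inj₂ λ ()) (inj₂ λ ()))
        U.at₁
        (U.els (2+ i , suc i) (inj₁ λ ()) (inj₂ λ ()))
        (U.at₂ (inj₁ λ ())))
      (idle late (moveS26′ Ac hd (cong (λ b → not (b ∧ primedV (g (suc i) (3+ i)))) hu)))
      where module U = Upd2 (suc i , 2+ i) (just (TL , mkL q true)) (2+ i , 2+ i) (just (SL , mkL p false)) st

    resS6′ : g (suc i) (3+ i) ≡ be false →
      Result (upd (suc i , 2+ i) (just (TL , mkL q true)) (upd (suc i , 3+ i) (just (TL , mkL q false))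
        (upd (2+ i , 2+ i) (just (SL , mkL p false)) st)))
    resS6′ hu = result (link-S26′ Ac K hd U.s out
        (U.els (suc i , suc i) (inj₂ λ ()) (inj₂ λ ()) (inj₂ λ ()))
        U.at₁
        (U.els (2+ i , suc i) (inj₁ λ ()) (inj₁ λ ()) (inj₂ λ ()))
        (U.at₃ (inj₁ λ ()) (inj₁ λ ())))
      (idle late (moveS26′ Ac hd (cong (λ v → not (isBe v ∧ primedV v)) hu)))
      where
      module U = Upd3 (suc i , 2+ i) (just (TL , mkL q true)) (suc i , 3+ i) (just (TL , mkL q false))
        (2+ i , 2+ i) (just (SL , mkL p false)) st
      out : ∀ k l → Outside (suc i) (suc i) k l → U.s (k , l) ≡ st (k , l)
      -- The third cell written by (S6′) lies outside the square, but already holds the unprimed b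
      -- that is written.
      out k l o with (k , l) ≟ᶜ (suc i , 3+ i)
      ... | yes refl = trans (U.at₂ (inj₂ λ ())) (sym (trans (rep _ _) (cong (emb p q (st₀ (suc i , 3+ i))) hu)))
      ... | no n = U.els (k , l) (out-12 o) (apart (k ≟ suc i)) (out-22 o)
        where
        apart : Dec (k ≡ suc i) → k ≢ suc i ⊎ l ≢ 3+ i
        apart (yes refl) = inj₂ λ { refl → n refl }
        apart (no m) = inj₁ m

  module _ {g st i} (Ac : Active early g i (suc i)) (K : Link p q st₀ g₀ cs g st)
    (hd : isBe (g (2+ i) (2+ i)) ≡ true) where
    open Around Ac
    open Link K

    resS47 : isUn (g (suc i) (suc i)) ≡ true →
      not (isBe (g (suc i) (3+ i)) ∧ primedV (g (suc i) (3+ i))) ≡ true →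
      Result (upd (suc i , suc i) (just (TL , entry st (2+ i , 2+ i)))
        (upd (suc i , 2+ i) (just (SL , mkL p true))
          (upd (2+ i , 2+ i) (just (SL , entry st (suc i , suc i))) st)))
    resS47 hn hu = result (link-put K U.s (suc i , suc i) (2+ i , 2+ i)
        (trans U.at₁ (entry-be K _ _ hd _))
        (U.at₂ (inj₂ λ ()))
        (trans (U.els (2+ i , suc i) (inj₁ λ ()) (inj₁ λ ()) (inj₂ λ ())) (rep _ _))
        (trans (U.at₃ (inj₁ λ ()) (inj₁ λ ())) (cong (λ x → just (SL , x)) (trans (entry-A K _ _ (un-A hn))
          (cong (mkL p) (hor-off {g (suc i) i} {g (suc i) (suc i)} (c-off base i) (win-hor (wins (suc i) i)))))))
        (λ k l o → U.els (k , l) (out-11 o) (out-12 o) (out-22 o))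
        (inj₂ (un-live hn , be-live hd)) (inj₂ (ac-live hac , refl)) (inj₁ refl) (inj₂ (be-live hd , refl))
        (un-A hn) hd (trans (cong isBe put-11) hd) (cong inA put-22)
        ((λ n → ⊥-elim (n refl)) , (λ _ _ L n → sym (emb-A {p} {q} (st₀ (suc i , 2+ i)) (g (suc i) (2+ i)) L n
            (ac-A hac)))
          , (λ _ _ _ _ → refl) , (λ _ n → ⊥-elim (n refl))))
      (active late i (suc i) (moveS47 Ac hn hd hu))
      where
      module U = Upd3 (suc i , suc i) (just (TL , entry st (2+ i , 2+ i)))
        (suc i , 2+ i) (just (SL , mkL p true)) (2+ i , 2+ i) (just (SL , entry st (suc i , suc i))) st

sw : ℕ → ℕ → State → ℕ → ℕ → (diag nd αp eB eBp sB sBp dB aB : Bool) → State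
sw p q st i j diag nd αp eB eBp sB sBp dB aB = swOf diag nd αp eB eBp sB sBp dB aB
  (upd (i , i) (just (TL , entry st (suc i , suc i))) (upd (i , suc i) (just (TL , mkL q false)) (upd (suc i , suc i)
      (just (SL , entry st (i , j))) st)))
  (upd (i , i) (just (TL , mkL q false)) (upd (i , suc i) (just (SL , mkL p true)) st))
  (upd (i , j) (just (TL , mkL q true)) (upd (i , suc j) (just (TL , mkL q false)) (upd (suc i , j) (just (SL ,
      mkL p false)) st)))
  (upd (i , j) (just (TL , mkL q true)) (upd (suc i , j) (just (SL , mkL p false)) st))
  (upd (i , i) (just (TL , entry st (suc i , j))) (upd (i , j) (just (SL , mkL p true)) (upd (suc i , j) (just (SL ,
      entry st (i , i))) st)))
  (swapC (i , j) (i , suc j) st) (swapC (i , j) (suc i , j) st) st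

opaque
  switched : ℕ → ℕ → State → Cell → State
  switched = switch

opaque
  unfolding swOf switched
  switch-sw : ∀ p q st i j {diag nd αp eB eBp sB sBp dB aB} → (i ≡ᵇ j) ≡ diag → (j ≡ᵇ suc i) ≡ nd →
    prim st (i , j) ≡ αp → isB p q st (i , suc j) ≡ eB → prim st (i , suc j) ≡ eBp →
    isB p q st (suc i , j) ≡ sB → prim st (suc i , j) ≡ sBp → isB p q st (suc i , suc i) ≡ dB →
    isA p q st (i , i) ≡ aB → switched p q st (i , j) ≡ sw p q st i j diag nd αp eB eBp sB sBp dB aB
  switch-sw p q st i j refl refl refl refl refl refl refl refl refl = refl

off-not-be : ∀ {v} → isVoid v ≡ true → isBe v ≡ false
off-not-be {void} _ = refl

-- A settled box has too large a rank to stand west of the active one. So the diagonal neighbour is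
-- an a-box exactly when it is unmoved, which translates the test of (S4) and (S7) into values.
A-un : ∀ {v w} → hor v w ≡ true → isAc w ≡ true → isAc v ≡ false → isUn v ≡ false → inA v ≡ false
A-un {v} {w} h a b c = not-elim (sound (all any λ v → all any λ w → hor v w ⇒ isAc w ⇒ not (isAc v) ⇒ not
    (isUn v) ⇒ end (not (inA v)))
  refl v refl w refl h a (not-intro b) (not-intro c))

first-or : ∀ a {b} → (a ∨ b) ≡ true → b ≡ false → a ≡ true
first-or true _ _ = refl
first-or false h e = ⊥-elim (true≢false h e)

module Dispatch {p q st₀ g₀ cs} (S : Start p q st₀ g₀ cs) where
  open Start S
  open Linked S
  open Step S

  via : ∀ {s t} → s ≡ t → Result t → Result s
  via refl r = r

  module _ {g : Grid} {st : State} {i j : ℕ} where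
    private
      e s : V
      c : Cell
      e = g (suc i) (2+ j)
      s = g (2+ i) (suc j)
      c = (suc i , suc j)

    stepGeneral : ∀ φ → Active φ g i j → Link p q st₀ g₀ cs g st → i ≢ j → j ≢ suc i →
      (isBe e ∨ isBe s) ≡ true → Result (switched p q st c)
    stepGeneral φ A K n₁ n₂ h = go _ _ _ refl refl refl
      where
      open Around A
      far : suc i ≤ j
      far = ≤∧≢⇒< i≤j n₁
      far′ : 2+ i ≤ j
      far′ = ≤∧≢⇒< far (λ x → n₂ (sym x))
      eq : ∀ {eB eBp sB} → isBe e ≡ eB → prim st (suc i , 2+ j) ≡ eBp → isBe s ≡ sB →
        switched p q st c ≡ sw p q st (suc i) (suc j) false false (prim st c) eB eBp sB
          (prim st (2+ i , suc j)) (isB p q st (2+ i , 2+ i)) (isA p q st (suc i , suc i))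
      eq a b d = switch-sw p q st (suc i) (suc j) (≡ᵇ-≢ n₁) (≡ᵇ-≢ n₂) refl (trans (lkB K _ _) a) b (trans
          (lkB K _ _) d) refl refl refl
      h₁ : not (isVoid s ∧ primedV e) ≡ true
      h₁ = cong (λ b → not (b ∧ primedV e)) (inside′ (s≤s far))
      spec : ∀ φ → special φ (g (suc i) j) (g (2+ i) j) ≡ true
      spec early = cong (λ b → not (b ∧ isUn (g (suc i) j))) (inside′ far′)
      spec late = cong not (inside′ far′)
      go : ∀ eB sB pB → isBe e ≡ eB → isBe s ≡ sB → primedV e ≡ pB → Result (switched p q st c)
      go true true true he hs pe = via (trans (eq he (trans (lk-prim K _ _ (be-live he)) pe) hs) gen-E₁)
        (resE A K he h₁ (cong₂ (λ a b → not (a ∧ not b)) hs pe))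
      go true true false he hs pe = via (trans (eq he (trans (lk-prim K _ _ (be-live he)) pe) hs) gen-S₁)
        (resS A K hs (cong₂ (λ a b → not (a ∧ b)) he pe) (spec φ))
      go true false _ he hs _ = via (trans (eq he refl hs) gen-E₂)
        (resE A K he h₁ (cong (λ a → not (a ∧ not (primedV e))) hs))
      go false true _ he hs _ = via (trans (eq he refl hs) gen-S₂)
        (resS A K hs (cong (λ a → not (a ∧ primedV e)) he) (spec φ))
      go false false _ he hs _ = ⊥-elim (true≢false h (trans (cong₂ _∨_ he hs) refl))

  module _ {g : Grid} {st : State} {i : ℕ} where
    private
      e s d : V
      c : Cell
      e = g (suc i) (2+ i)
      s = g (2+ i) (suc i)
      d = g (2+ i) (2+ i)
      c = (suc i , suc i)

    -- A late active box is primed and therefore never on the diagonal. An early one has `void`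
    -- below it, so its b-neighbour is to the east.
    stepDiag : ∀ φ → Active φ g i i → Link p q st₀ g₀ cs g st → (isBe e ∨ isBe s) ≡ true → Result (switched p q st c)
    stepDiag late A K h = ⊥-elim (true≢false (act-prim-late {g (suc i) (suc i)} at)
        (hor-off {g (suc i) i} {g (suc i) (suc i)} (c-off base i) (win-hor (wins (suc i) i))))
      where open Around A
    stepDiag early A K h = go _ _ refl refl
      where
      open Around A
      hs : isBe s ≡ false
      hs = off-not-be (c-off base (suc i))
      he : isBe e ≡ true
      he = first-or (isBe e) h hs
      eq : ∀ {eBp dB} → primedV e ≡ eBp → isBe d ≡ dB →
        switched p q st c ≡ sw p q st (suc i) (suc i) true false false true eBp false
          (prim st (2+ i , suc i)) dB (isA p q st (suc i , suc i))
      eq a b = switch-sw p q st (suc i) (suc i) (≡ᵇ-refl i) (≡ᵇ-suc i)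
        (trans (lk-prim K _ _ (ac-live hac)) (act-prim-early {g (suc i) (suc i)} at)) (trans (lkB K _ _) he) (trans
            (lk-prim K _ _ (be-live he)) a)
        (trans (lkB K _ _) hs) refl (trans (lkB K _ _) b) refl
      go : ∀ eBp dB → primedV e ≡ eBp → isBe d ≡ dB → Result (switched p q st c)
      go true true pe hd = via (trans (eq pe hd) diag-1) (resS3 A K he pe hd)
      go true false pe hd = via (trans (eq pe hd) diag-2) (resS1′ A K he pe hd)
      go false _ pe hd = via (trans (eq pe hd) diag-E) (resE A K he
        (subst (λ b → not (isVoid s ∧ b) ≡ true) (sym pe) (cong (λ b → not (b ∧ false)) (c-off base (suc i))))
        (cong (λ a → not (a ∧ not (primedV e))) hs))

  module _ {g : Grid} {st : State} {i : ℕ} where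
    private
      w e s : V
      c : Cell
      w = g (suc i) (suc i)
      e = g (suc i) (3+ i)
      s = g (2+ i) (2+ i)
      c = (suc i , 2+ i)

    stepNear : ∀ φ → Active φ g i (suc i) → Link p q st₀ g₀ cs g st → (isBe e ∨ isBe s) ≡ true → Result
        (switched p q st c)
    stepNear φ A K h = go φ A at _ _ _ _ refl refl refl refl
      where
      open Around A
      eq : ∀ {αp eB eBp sB sBp aB} → primedV (g (suc i) (2+ i)) ≡ αp → isBe e ≡ eB → prim st (suc i , 3+ i) ≡ eBp →
        isBe s ≡ sB → prim st (2+ i , 2+ i) ≡ sBp → inA w ≡ aB →
        switched p q st c ≡ sw p q st (suc i) (2+ i) false true αp eB eBp sB sBp (isB p q st (2+ i , 2+ i)) aB
      eq a b x y z t = switch-sw p q st (suc i) (2+ i) (≡ᵇ-suc i) (≡ᵇ-refl i)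
        (trans (lk-prim K _ _ (ac-live hac)) a) (trans (lkB K _ _) b) x (trans (lkB K _ _) y) z refl (trans (lkA K _ _) t)
      s-in : isVoid s ≡ false
      s-in = inside′ ≤-refl
      h₁ : not (isVoid s ∧ primedV e) ≡ true
      h₁ = cong (λ b → not (b ∧ primedV e)) s-in
      -- The south cell is on the diagonal, so a b-box there is unprimed, as (S2′) and (S6′) demand.
      sp : isBe s ≡ true → prim st (2+ i , 2+ i) ≡ false
      sp hs = trans (lk-prim K _ _ (be-live hs)) (hor-off {g (2+ i) (suc i)} {s} (c-off base (suc i)) (win-hor (wins
          (2+ i) (suc i))))
      w-A : ∀ φ → Active φ g i (suc i) → isUn w ≡ false → inA w ≡ false
      w-A φ A uw = A-un (win-hor (wins (suc i) (suc i))) hac (not-elim (∧-r {allowed φ w} (Around.nb A (suc i)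
          (suc i) λ _ ()))) uw
      spec : isUn w ≡ false → special early w (g (2+ i) (suc i)) ≡ true
      spec uw = cong not (trans (cong (isVoid (g (2+ i) (suc i)) ∧_) uw) (∧-zeroʳ _))
      early-p : isAct early (g (suc i) (2+ i)) ≡ true → primedV (g (suc i) (2+ i)) ≡ false
      early-p = act-prim-early {g (suc i) (2+ i)}
      late-p : isAct late (g (suc i) (2+ i)) ≡ true → primedV (g (suc i) (2+ i)) ≡ true
      late-p = act-prim-late {g (suc i) (2+ i)}
      ep : isBe e ≡ true → ∀ {b} → primedV e ≡ b → prim st (suc i , 3+ i) ≡ b
      ep he pe = trans (lk-prim K _ _ (be-live he)) pe
      go : ∀ φ → Active φ g i (suc i) → isAct φ (g (suc i) (2+ i)) ≡ true → ∀ eB sB pB uB →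
        isBe e ≡ eB → isBe s ≡ sB → primedV e ≡ pB → isUn w ≡ uB → Result (switched p q st c)
      go φ A at false false _ _ he hs _ _ = ⊥-elim (true≢false h (trans (cong₂ _∨_ he hs) refl))
      go early A at true false _ true he hs _ uw = via (trans (eq (early-p at) he refl hs refl (un-A uw)) near-E₁)
          (resE A K he h₁ (cong (λ a → not (a ∧ not (primedV e))) hs))
      go early A at true false _ false he hs _ uw = via (trans (eq (early-p at) he refl hs refl (w-A early A uw)) near-E₂)
          (resE A K he h₁ (cong (λ a → not (a ∧ not (primedV e))) hs))
      go early A at true true true true he hs pe uw = via (trans (eq (early-p at) he (ep he pe) hs (sp hs)
          (un-A uw)) near-E₃)
          (resE A K he h₁ (cong₂ (λ a b → not (a ∧ not b)) hs pe))
      go early A at true true true false he hs pe uw = via (trans (eq (early-p at) he (ep he pe) hs (sp hs)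
          (w-A early A uw)) near-E₄)
          (resE A K he h₁ (cong₂ (λ a b → not (a ∧ not b)) hs pe))
      go early A at true true false true he hs pe uw = via (trans (eq (early-p at) he (ep he pe) hs (sp hs)
          (un-A uw)) near-5₁)
          (resS47 A K hs uw (cong₂ (λ a b → not (a ∧ b)) he pe))
      go early A at true true false false he hs pe uw = via (trans (eq (early-p at) he (ep he pe) hs (sp hs)
          (w-A early A uw)) near-S₁)
          (resS A K hs (cong₂ (λ a b → not (a ∧ b)) he pe) (spec uw))
      go early A at false true _ true he hs _ uw = via (trans (eq (early-p at) he refl hs (sp hs) (un-A uw)) near-5₂)
          (resS47 A K hs uw (cong (λ a → not (a ∧ primedV e)) he))
      go early A at false true _ false he hs _ uw = via (trans (eq (early-p at) he refl hs (sp hs)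
          (w-A early A uw)) near-S₂)
          (resS A K hs (cong (λ a → not (a ∧ primedV e)) he) (spec uw))
      go late A at true false true _ he hs pe _ = via (trans (eq (late-p at) he (ep he pe) hs refl refl) near-E₅)
          (resE A K he h₁ (cong (λ a → not (a ∧ not (primedV e))) hs))
      go late A at true false false _ he hs pe _ = via (trans (eq (late-p at) he (ep he pe) hs refl refl) near-E₆)
          (resE A K he h₁ (cong (λ a → not (a ∧ not (primedV e))) hs))
      go late A at false true _ _ he hs _ _ = via (trans (eq (late-p at) he refl hs (sp hs) refl) near-4)
          (resS2′ A K hs he)
      go late A at true true true _ he hs pe _ = via (trans (eq (late-p at) he (ep he pe) hs (sp hs) refl) near-E₇)
          (resE A K he h₁ (cong₂ (λ a b → not (a ∧ not b)) hs pe))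
      go late A at true true false _ he hs pe _ = via (trans (eq (late-p at) he (ep he pe) hs (sp hs) refl) near-3)
          (resS6′ A K hs (be-false he pe))

  stepActive : ∀ φ {g st i j} → Active φ g i j → Link p q st₀ g₀ cs g st →
    (isBe (g (suc i) (2+ j)) ∨ isBe (g (2+ i) (suc j))) ≡ true → Result (switched p q st (suc i , suc j))
  stepActive φ {i = i} {j} A K h with i ≟ j | j ≟ suc i
  ... | yes refl | _ = stepDiag φ A K h
  ... | no _ | yes refl = stepNear φ A K h
  ... | no n | no m = stepGeneral φ A K n m h

∨-false : ∀ a {b} → (a ∨ b) ≡ false → a ≡ false × b ≡ false
∨-false false h = refl , h

∨-falseI : ∀ {a b} → a ≡ false → b ≡ false → (a ∨ b) ≡ false
∨-falseI refl h = h

hor-se-be : ∀ {v w} → hor v w ≡ true → isSe v ≡ true → isBe w ≡ false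
hor-se-be {v} {w} h u = not-elim (sound (all any λ v → all any λ w → hor v w ⇒ isSe v ⇒ end (not
    (isBe w))) refl v refl w refl h u)

ver-se-be : ∀ {v w} → ver v w ≡ true → isSe v ≡ true → isBe w ≡ false
ver-se-be {v} {w} h u = not-elim (sound (all any λ v → all any λ w → ver v w ⇒ isSe v ⇒ end (not
    (isBe w))) refl v refl w refl h u)

data AView : V → Set where
  vun : ∀ r → AView (un r)
  vac : ∀ r → AView (ac r)
  vse : ∀ r → AView (se r)

aview : ∀ {v} → inA v ≡ true → AView v
aview {un r} _ = vun r
aview {ac r} _ = vac r
aview {se r} _ = vse r

A⇒live : ∀ v → inA v ≡ true → live v ≡ true
A⇒live (un _) _ = refl
A⇒live (ac _) _ = refl
A⇒live (se _) _ = refl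

retire-Same : ∀ v → Same v (retire v)
retire-Same void = inj₁ refl
retire-Same low = inj₁ refl
retire-Same high = inj₁ refl
retire-Same (un _) = inj₁ refl
retire-Same (ac _) = inj₂ (refl , refl)
retire-Same (se _) = inj₁ refl
retire-Same (be _) = inj₁ refl

relabel-Same : ∀ m v → Same v (relabel m v)
relabel-Same m void = inj₁ refl
relabel-Same m low = inj₁ refl
relabel-Same m high = inj₁ refl
relabel-Same keep (un _) = inj₁ refl
relabel-Same half (un false) = inj₂ (refl , refl)
relabel-Same half (un true) = inj₁ refl
relabel-Same settle (un _) = inj₂ (refl , refl)
relabel-Same activate (un _) = inj₂ (refl , refl)
relabel-Same m (ac _) = inj₁ refl
relabel-Same m (se _) = inj₁ refl
relabel-Same m (be _) = inj₁ refl

module _ {p q : ℕ} where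
  retire-emb : ∀ o v → emb p q o v ≡ emb p q o (retire v)
  retire-emb o void = refl
  retire-emb o low = refl
  retire-emb o high = refl
  retire-emb o (un _) = refl
  retire-emb o (ac _) = refl
  retire-emb o (se _) = refl
  retire-emb o (be _) = refl

  relabel-emb : ∀ o m v → emb p q o v ≡ emb p q o (relabel m v)
  relabel-emb o m void = refl
  relabel-emb o m low = refl
  relabel-emb o m high = refl
  relabel-emb o keep (un _) = refl
  relabel-emb o half (un false) = refl
  relabel-emb o half (un true) = refl
  relabel-emb o settle (un _) = refl
  relabel-emb o activate (un _) = refl
  relabel-emb o m (ac _) = refl
  relabel-emb o m (se _) = refl
  relabel-emb o m (be _) = refl

-- The switching process for one pair of letters

module Process {p q st₀ g₀ cs} (S : Start p q st₀ g₀ cs) where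
  open Start S
  open Linked S
  open Step S
  open Dispatch S

  link-retire : ∀ {g st} → Link p q st₀ g₀ cs g st → Link p q st₀ g₀ cs (retired g) st
  link-retire {g} K = record
    { rep = λ k l → trans (Link.rep K k l) (retire-emb _ (g k l))
    ; same = λ k l → Same-trans (Link.same K k l) (retire-Same (g k l))
    ; cnt = Link.cnt K }

  link-relab : ∀ {g st} μ → Link p q st₀ g₀ cs g st → Link p q st₀ g₀ cs (relab μ g) st
  link-relab {g} μ K = record
    { rep = λ k l → trans (Link.rep K k l) (relabel-emb _ (μ k l) (g k l))
    ; same = λ k l → Same-trans (Link.same K k l) (relabel-Same (μ k l) (g k l))
    ; cnt = Link.cnt K }

  module _ {g st} (K : Link p q st₀ g₀ cs g st) where
    nbr : ℕ → ℕ → Bool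
    nbr k l = isBe (g k (suc l)) ∨ isBe (g (suc k) l)

    cand-in : ∀ {k l} → inA (g k l) ≡ true → nbr k l ≡ true →
      (primedV (g k l) ≡ false → candU p q st (k , l) ≡ true) × (primedV (g k l) ≡ true → candP p q st (k , l) ≡ true)
    cand-in {k} {l} a n =
      (λ r → ∧-i (trans (lkA K k l) a) (∧-i (cong not (trans (lk-prim K k l (A⇒live (g k l) a)) r)) (trans
          (lk-nbr K k l) n))) ,
      (λ r → ∧-i (trans (lkA K k l) a) (∧-i (trans (lk-prim K k l (A⇒live (g k l) a)) r) (trans (lk-nbr K k l) n)))

    candU-out : ∀ {k l} → candU p q st (k , l) ≡ true → inA (g k l) ≡ true × primedV (g k l) ≡ false × nbr k l ≡ true
    candU-out {k} {l} c = a , trans (sym (lk-prim K k l (A⇒live (g k l) a))) (not-elim (∧-l (∧-r {isA p q st (k , l)} c)))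
        , trans (sym (lk-nbr K k l)) (∧-r {not (prim st (k , l))} (∧-r {isA p q st (k , l)} c))
      where
      a : inA (g k l) ≡ true
      a = trans (sym (lkA K k l)) (∧-l c)

    candP-out : ∀ {k l} → candP p q st (k , l) ≡ true → inA (g k l) ≡ true × primedV (g k l) ≡ true × nbr k l ≡ true
    candP-out {k} {l} c = a , trans (sym (lk-prim K k l (A⇒live (g k l) a))) (∧-l (∧-r {isA p q st (k , l)} c))
        , trans (sym (lk-nbr K k l)) (∧-r {prim st (k , l)} (∧-r {isA p q st (k , l)} c))
      where
      a : inA (g k l) ≡ true
      a = trans (sym (lkA K k l)) (∧-l c)

    no-se : ∀ {φ k l} → Base φ g → isSe (g k l) ≡ true → nbr k l ≡ true → ⊥
    no-se {φ} {k} {l} B s n = true≢false n (∨-falseI (hor-se-be (win-hor (Base.wins B k l)) s) (ver-se-be (win-ver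
        (Base.wins B k l)) s))

    free-of : ∀ {k l} → nbr k l ≢ true → isBe (g k (suc l)) ≡ false × isBe (g (suc k) l) ≡ false
    free-of {k} {l} h = ∨-false (isBe (g k (suc l))) (¬true⇒false h)

    -- While the active box has a b-neighbour, it is itself a candidate. Settled boxes have no
    -- b-neighbour, and an unmoved candidate is ruled out by `o1` and the maximality of □, or by its
    -- prime, or by the phase. So □ stays with the active box.
    box-active : ∀ φ {i j c} → Active φ g i j → nbr (suc i) (suc j) ≡ true → IsBox p q st c → c ≡ (suc i , suc j)
    box-active early {i} {j} A n (boxU {k} {l} cu mx) with candU-out cu
    ... | a , r , n' = go (g k l) refl (aview a)
      where
      open Around A
      mx′ : suc j ≤ l
      mx′ with mx (suc i) (suc j) (proj₁ (cand-in hxa n) (act-prim-early {g (suc i) (suc j)} at))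
        where
        hxa = ac-A hac
      ... | inj₁ lt = <⇒≤ lt
      ... | inj₂ (e , _) = ≤-reflexive e
      go : ∀ v → g k l ≡ v → AView v → (k , l) ≡ (suc i , suc j)
      go _ e (vun true) = ⊥-elim (true≢false (cong primedV e) r)
      go _ e (vun false) = ⊥-elim (<-irrefl refl (<-≤-trans (OrderE.o1 ord k l e) mx′))
      go _ e (vac _) with uniq k l (cong isAc e)
      ... | refl , refl = refl
      go _ e (vse _) = ⊥-elim (no-se base (cong isSe e) n')
    box-active early {i} {j} A n (boxP none _ _) = ⊥-elim (true≢false (proj₁ (cand-in (ac-A (Around.hac A)) n)
        (act-prim-early {g (suc i) (suc j)} (Active.at A))) (none _))
    box-active late {i} {j} A n (boxU {k} {l} cu mx) with candU-out cu
    ... | a , r , n' = go (g k l) refl (aview a)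
      where
      open Around A
      go : ∀ v → g k l ≡ v → AView v → (k , l) ≡ (suc i , suc j)
      go _ e (vun true) = ⊥-elim (true≢false (cong primedV e) r)
      go _ e (vun false) = ⊥-elim (true≢false (win-allowed (wins k l)) (cong (allowed late) e))
      go _ e (vac _) with uniq k l (cong isAc e)
      ... | refl , refl = refl
      go _ e (vse _) = ⊥-elim (no-se base (cong isSe e) n')
    box-active late {i} {j} A n (boxP {k} {l} _ cp mx) with candP-out cp
    ... | a , r , n' = go (g k l) refl (aview a)
      where
      open Around A
      mx′ : suc i ≤ k
      mx′ with mx (suc i) (suc j) (proj₂ (cand-in (ac-A hac) n) (act-prim-late {g (suc i) (suc j)} at))
      ... | inj₁ lt = <⇒≤ lt
      ... | inj₂ (e , _) = ≤-reflexive e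
      go : ∀ v → g k l ≡ v → AView v → (k , l) ≡ (suc i , suc j)
      go _ e (vun _) = ⊥-elim (<-irrefl refl (<-≤-trans (OrderL.o1 ord k l (cong isUn e)) mx′))
      go _ e (vac _) with uniq k l (cong isAc e)
      ... | refl , refl = refl
      go _ e (vse _) = ⊥-elim (no-se base (cong isSe e) n')

    -- The maximality of □ says that the boxes later in the order have no b-neighbour. This is
    -- precisely what activation asks for in order to settle them.
    step-idle : ∀ φ {c} → Idle φ g → IsBox p q st c → Result (switched p q st c)
    step-idle φ I (boxU {k} {l} cu mx) with candU-out cu
    ... | a , r , n = go φ I k l (g k l) refl (aview a) r n (lk-row K k l (A⇒live (g k l) a)) (λ k' l' c → mx k' l' c)
      where
      go : ∀ φ → Idle φ g → ∀ k l v → g k l ≡ v → AView v → primedV (g k l) ≡ false → nbr k l ≡ true → 1 ≤ k →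
        (∀ k' l' → candU p q st (k' , l') ≡ true → l' < l ⊎ (l' ≡ l × k' ≤ k)) → Result (switched p q st (k , l))
      go φ I k l _ e (vac _) _ _ _ _ = ⊥-elim (true≢false (cong isAc e) (Idle.noAc I k l))
      go φ I k l _ e (vse _) _ n _ _ = ⊥-elim (no-se (Idle.base I) (cong isSe e) n)
      go φ I k l _ e (vun true) r _ _ _ = ⊥-elim (true≢false (cong primedV e) r)
      go late I k l _ e (vun false) _ _ _ _ = ⊥-elim (true≢false (win-allowed (Idle.wins I k l)) (cong (allowed late) e))
      go early I (suc k) zero _ e (vun false) _ _ _ _ with Idle.inside I {suc k} {zero} (cong isVoid e)
      ... | ()
      go early I (suc k) (suc l) _ e (vun false) r n _ mx =
        stepActive early (activateE I e free) (link-relab _ K)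
          (trans (cong₂ _∨_ (relabel-be≡ _ (g (suc k) (2+ l))) (relabel-be≡ _ (g (2+ k) (suc l)))) n)
        where
        free : ∀ k' l' → g k' l' ≡ un false → suc l < l' → isBe (g k' (suc l')) ≡ false × isBe (g (suc k') l') ≡ false
        free k' l' u h = free-of λ n' → far h (mx k' l' (proj₁ (cand-in (cong inA u) n') (cong primedV u)))
          where
          far : ∀ {m} → suc l < l' → l' < suc l ⊎ (l' ≡ suc l × m) → ⊥
          far h (inj₁ x) = <-asym h x
          far h (inj₂ (x , _)) = <-irrefl (sym x) h
    step-idle φ I (boxP {k} {l} none cp mx) with candP-out cp
    ... | a , r , n = go k l (g k l) refl (aview a) r n (lk-row K k l (A⇒live (g k l) a)) (λ k' l' c → mx k' l' c)
      where
      go : ∀ k l v → g k l ≡ v → AView v → primedV (g k l) ≡ true → nbr k l ≡ true → 1 ≤ k →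
        (∀ k' l' → candP p q st (k' , l') ≡ true → k' < k ⊎ (k' ≡ k × l' ≤ l)) → Result (switched p q st (k , l))
      go k l _ e (vac _) _ _ _ _ = ⊥-elim (true≢false (cong isAc e) (Idle.noAc I k l))
      go k l _ e (vse _) _ n _ _ = ⊥-elim (no-se (Idle.base I) (cong isSe e) n)
      go k l _ e (vun false) r _ _ _ = ⊥-elim (true≢false r (cong primedV e))
      go (suc k) zero _ e (vun true) _ _ _ _ with Idle.inside I {suc k} {zero} (cong isVoid e)
      ... | ()
      go (suc k) (suc l) _ e (vun true) r n _ mx =
        stepActive late (activateL φ I e free) (link-relab _ K)
          (trans (cong₂ _∨_ (relabel-be≡ _ (g (suc k) (2+ l))) (relabel-be≡ _ (g (2+ k) (suc l)))) n)
        where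
        free : ∀ k' l' → g k' l' ≡ un false ⊎ (g k' l' ≡ un true × suc k < k') → isBe (g k' (suc l')) ≡ false × isBe
            (g (suc k') l') ≡ false
        free k' l' (inj₁ u) = free-of λ n' → true≢false (proj₁ (cand-in (cong inA u) n') (cong primedV u)) (none _)
        free k' l' (inj₂ (u , h)) = free-of λ n' → far h (mx k' l' (proj₂ (cand-in (cong inA u) n') (cong primedV u)))
          where
          far : ∀ {m} → suc k < k' → k' < suc k ⊎ (k' ≡ suc k × m) → ⊥
          far h (inj₁ x) = <-asym h x
          far h (inj₂ (x , _)) = <-irrefl (sym x) h

  -- An active box that has lost its b-neighbours is retired only now, when the process demands
  -- another box.
  step-good : ∀ {g st c} → Good g → Link p q st₀ g₀ cs g st → IsBox p q st c → Result (switched p q st c)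
  step-good (idle φ I) K b = step-idle K φ I b
  step-good {g} (active φ i j A) K b = go (nbr K (suc i) (suc j)) refl
    where
    go : ∀ n → nbr K (suc i) (suc j) ≡ n → Result (switched p q _ _)
    go true n with box-active K φ A n b
    ... | refl = stepActive φ A K n
    go false n = let he , hs = ∨-false (isBe (g (suc i) (2+ j))) n in
      step-idle (link-retire K) φ (retiring φ A he hs) b

  record Finished (st : State) : Set where
    field
      {final} : Grid
      base : Base late final
      link : Link p q st₀ g₀ cs final st
      noUn : ∀ k l → isUn (final k l) ≡ false
      noAc : ∀ k l → isAc (final k l) ≡ false

  settle-noUn : ∀ v → isUn (relabel settle v) ≡ false
  settle-noUn v = not-elim (sound (all any λ v → end (not (isUn (relabel settle v)))) refl v refl)

  settle-noAc : ∀ v → isAc v ≡ false → isAc (relabel settle v) ≡ false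
  settle-noAc v h = not-elim (sound (all any λ v → not (isAc v) ⇒ end (not (isAc (relabel settle v)))) refl v refl
      (not-intro h))

  switched-free : ∀ {g st} (K : Link p q st₀ g₀ cs g st) → FullySwitched p q st →
    ∀ k l → inA (g k l) ≡ true → isBe (g k (suc l)) ≡ false × isBe (g (suc k) l) ≡ false
  switched-free K fs k l a = free-of K λ n → true≢false (∧-i (trans (lkA K k l) a) (trans (lk-nbr K k l) n)) (fs (k , l))

  finish-idle : ∀ φ {g st} → Idle φ g → Link p q st₀ g₀ cs g st → FullySwitched p q st → Finished st
  finish-idle φ {g} I K fs = record
    { base = final-base I (λ k l u → switched-free K fs k l (un-A u))
    ; link = link-relab _ K
    ; noUn = λ k l → settle-noUn (g k l)
    ; noAc = λ k l → settle-noAc (g k l) (Idle.noAc I k l) }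

  finish : ∀ {g st} → Good g → Link p q st₀ g₀ cs g st → FullySwitched p q st → Finished st
  finish (idle φ I) K fs = finish-idle φ I K fs
  finish (active φ i j A) K fs = let he , hs = switched-free K fs (suc i) (suc j) (ac-A (Around.hac A)) in
    finish-idle φ (retiring φ A he hs) (link-retire K) fs

  opaque
    unfolding switched
    unswitch : ∀ {st c} → Result (switched p q st c) → Result (switch p q st c)
    unswitch r = r

  process : ∀ {g st st'} → Good g → Link p q st₀ g₀ cs g st → Proc p q st st' → Finished st'
  process G K (done fs) = finish G K fs
  process G K (step b rest) with unswitch (step-good G K b)
  ... | result K' G' = process G' K' rest

-- One stage

<ᵇ-I : ∀ {m n} → m < n → (m <ᵇ n) ≡ true
<ᵇ-I {m} {n} h with m <ᵇ n | <⇒<ᵇ h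
... | true | _ = refl

inS-out : ∀ la i j → inS la (i , j) ≡ true → 1 ≤ i × i ≤ j × j < i + part la i
inS-out la i j h = ≤ᵇ⇒≤′ (∧-l h) , ≤ᵇ⇒≤′ (∧-l (∧-r {1 ≤ᵇ i} h)) , <ᵇ-true (∧-r {i ≤ᵇ j} (∧-r {1 ≤ᵇ i} h))

inS-in : ∀ {la i j} → 1 ≤ i → i ≤ j → j < i + part la i → inS la (i , j) ≡ true
inS-in a b c = ∧-i (≤⇒≤ᵇ′ a) (∧-i (≤⇒≤ᵇ′ b) (<ᵇ-I c))

inS-left : ∀ {la i j} → i ≤ j → inS la (i , suc j) ≡ true → inS la (i , j) ≡ true
inS-left {la} {i} {j} h e = let a , _ , c = inS-out la i (suc j) e in inS-in {la} a h (<-trans (n<1+n _) c)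

strict-tail : ∀ {x la} → Strict (x ∷ la) → Strict la
strict-tail (one _) = nil
strict-tail (cons _ s) = s

part-strict : ∀ {la} → Strict la → ∀ i → 1 ≤ part la (2+ i) → part la (2+ i) < part la (suc i)
part-strict {x ∷ y ∷ la} (cons h s) zero p = h
part-strict {x ∷ y ∷ la} (cons h s) (suc i) p = part-strict s i p

part-sum : ∀ {la} → Strict la → ∀ i → 1 ≤ part la (suc i) → i + part la (suc i) ≤ sum la
part-sum {x ∷ la} s zero p = m≤m+n x _
part-sum {x ∷ la} s (suc i) p = +-mono-≤ (strict-pos s) (part-sum (strict-tail s) i p)
  where
  strict-pos : ∀ {x la} → Strict (x ∷ la) → 1 ≤ x
  strict-pos (one h) = h
  strict-pos (cons h _) = ≤-trans (s≤s z≤n) h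

part-pos : ∀ i {m j} → i ≤ j → j < i + m → 1 ≤ m
part-pos i {zero} {j} b c = ⊥-elim (<-irrefl refl (<-≤-trans (subst (j <_) (+-identityʳ i) c) b))
part-pos i {suc m} _ _ = s≤s z≤n

inS-up : ∀ {la i j} → Strict la → 1 ≤ i → inS la (suc i , j) ≡ true → inS la (i , j) ≡ true
inS-up {la} {suc i} {j} s _ e = let a , b , c = inS-out la (2+ i) j e in
  inS-in {la} (s≤s z≤n) (<⇒≤ b) (<-≤-trans c (≤-trans (≤-reflexive (sym (+-suc (suc i) _)))
    (+-monoʳ-≤ (suc i) (part-strict s i (part-pos (2+ i) b c)))))

grid-product : (xs ys : List ℕ) → concatMap (λ i → map (λ j → (i , j)) ys) xs ≡ cartesianProduct xs ys
grid-product [] ys = refl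
grid-product (x ∷ xs) ys = cong (map (x ,_) ys ++_) (grid-product xs ys)

grid-unique : ∀ N → Unique (grid N)
grid-unique N = subst Unique (sym (grid-product (upTo N) (upTo N))) (Uniq.cartesianProduct⁺ (Uniq.upTo⁺ N) (Uniq.upTo⁺ N))

∈-grid : ∀ {N i j} → i < N → j < N → (i , j) ∈ grid N
∈-grid {N} {i} {j} h h' = subst ((i , j) ∈_) (sym (grid-product (upTo N) (upTo N))) (∈-cartesianProduct⁺ (∈-upTo⁺ h)
    (∈-upTo⁺ h'))

inS-grid : ∀ {la i j} → Strict la → inS la (i , j) ≡ true → (i , j) ∈ gridOf la
inS-grid {la} {suc i} {j} s e = let a , b , c = inS-out la (suc i) j e in ∈-grid (<-≤-trans (s≤s b) (s≤s (bound b c))) (s≤s (bound b c))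
  where
  bound : suc i ≤ j → j < suc i + part la (suc i) → j ≤ sum la
  bound b c = ≤-trans (≤-pred c) (part-sum s i (part-pos (suc i) b c))

LetterOrder : Set
LetterOrder = Lab → ℕ → ℕ

-- In Inv, the letters are ordered by position (ord): within one letter, a box is unprimed if it has a west neighbour with
-- the same letter, primed if it has such a south neighbour, and unprimed on the diagonal. This is equivalent to the
-- tableau conditions, as the boxes of a letter form a skew shifted shape.
record Inv (la nu : List ℕ) (n : ℕ) (init : State) (ord : LetterOrder) (st : State) : Set where
  field
    occ   : ∀ c → occupied st c ≡ inSkew la nu c
    posit : ∀ c L x → st c ≡ just (L , x) → 1 ≤ num x
    bound : ∀ c x → st c ≡ just (TL , x) → num x ≤ n
    rowO  : ∀ i j L x M y → st (i , j) ≡ just (L , x) → st (i , suc j) ≡ just (M , y) → ord L (num x) ≤ ord M (num y)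
    rowP  : ∀ i j L x y → st (i , j) ≡ just (L , x) → st (i , suc j) ≡ just (L , y) → num x ≡ num y → primed y ≡ false
    colO  : ∀ i j L x M y → st (i , j) ≡ just (L , x) → st (suc i , j) ≡ just (M , y) → ord L (num x) ≤ ord M (num y)
    colP  : ∀ i j L x y → st (i , j) ≡ just (L , x) → st (suc i , j) ≡ just (L , y) → num x ≡ num y → primed x ≡ true
    diag  : ∀ i L x → st (i , i) ≡ just (L , x) → primed x ≡ false
    cnt   : ∀ L k → count (isLN L k st) (gridOf la) ≡ count (isLN L k init) (gridOf la)

horI : ∀ {v w} → (isVoid v ≡ true → primedV w ≡ false) →
  (isVoid v ≡ false → isVoid w ≡ false × rankV v ≤ rankV w × (sameFam v w ≡ true → primedV w ≡ false)) → hor v w ≡ true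
horI {v} {w} f h with isVoid v
... | true = not-intro (f refl)
... | false = let a , b , c = h refl in ∧-i (not-intro a) (∧-i (≤⇒≤ᵇ′ b) (not-intro (¬true⇒false λ e → true≢false (∧-l e) (c (∧-r {primedV w} e)))))

verI : ∀ {v w} → (isVoid w ≡ true → primedV v ≡ false) →
  (isVoid w ≡ false → isVoid v ≡ false × rankV v ≤ rankV w × (sameFam v w ≡ true → primedV v ≡ true)) → ver v w ≡ true
verI {v} {w} f h with isVoid w
... | true = not-intro (f refl)
... | false = let a , b , c = h refl in ∧-i (not-intro a) (∧-i (≤⇒≤ᵇ′ b)
      (not-intro (¬true⇒false λ e → true≢false (c (∧-r {not (primedV v)} e)) (not-elim (∧-l e)))))

corner-idle : ∀ {a b c d} → eqB (isVoid a) (isVoid d) ≡ true → isAc b ≡ false → isAc d ≡ false → isSe d ≡ false →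
    corner a b c d ≡ true
corner-idle {a} {b} {c} {d} h p q r = sound (all any λ a → all any λ b → all any λ c → all any λ d → eqB (isVoid a)
    (isVoid d) ⇒
  not (isAc b) ⇒ not (isAc d) ⇒ not (isSe d) ⇒ end (corner a b c d)) refl
  a refl b refl c refl d refl h (not-intro p) (not-intro q) (not-intro r)

eqB-refl : ∀ b → eqB b b ≡ true
eqB-refl true = refl
eqB-refl false = refl

labEq-eq : ∀ {L M} → labEq L M ≡ true → L ≡ M
labEq-eq {SL} {SL} _ = refl
labEq-eq {TL} {TL} _ = refl

occ-just : ∀ {st : State} {c x} → st c ≡ just x → occupied st c ≡ true
occ-just e rewrite e = refl

occ-nothing : ∀ {st : State} {c} → st c ≡ nothing → occupied st c ≡ false
occ-nothing e rewrite e = refl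

not-elim-∧ : ∀ {a b} → not (a ∧ b) ≡ true → b ≡ true → a ≡ false
not-elim-∧ {false} _ _ = refl
not-elim-∧ {true} h refl = h′ h
  where
  h′ : false ≡ true → true ≡ false
  h′ ()

hor-fam : ∀ v w → hor v w ≡ true → sameFam v w ≡ true → primedV w ≡ false
hor-fam v w h s with isVoid v
... | true = not-elim h
... | false = not-elim-∧ (∧-r {rankV v ≤ᵇ rankV w} (∧-r {not (isVoid w)} h)) s

sameFam-on : ∀ v w → sameFam v w ≡ true → isVoid w ≡ false
sameFam-on v w s = not-elim (sound (all any λ v → all any λ w → sameFam v w ⇒ end (not (isVoid w))) refl v refl w refl s)

ver-fam : ∀ v w → ver v w ≡ true → sameFam v w ≡ true → primedV v ≡ true
ver-fam v w h s with isVoid w | sameFam-on v w s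
... | false | _ = flip (not-elim-∧ (∧-r {rankV v ≤ᵇ rankV w} (∧-r {not (isVoid v)} h)) s)
  where
  flip : ∀ {b} → not b ≡ false → b ≡ true
  flip {true} _ = refl

-- All that a stage knows of the global order of letters: the current two occupy the consecutive
-- positions `t` and `suc t` and exchange them, and every other letter keeps a position outside this
-- pair. This is why the other letters may be collapsed to `low` and `high`.
module Stage {la nu : List ℕ} (sla : Strict la) (snu : Strict nu) (sub : Sub nu la) (n : ℕ) (init : State) (p q : ℕ)
    (1≤p : 1 ≤ p) (1≤q : 1 ≤ q) (q≤n : q ≤ n)
  (ord ord' : LetterOrder) (t : ℕ) (ord-a : ord SL p ≡ t) (ord-b : ord TL q ≡ suc t)
  (ord'-a : ord' SL p ≡ suc t) (ord'-b : ord' TL q ≡ t)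
  (others : ∀ L k → 1 ≤ k → (L ≡ SL → k ≢ p) → (L ≡ TL → k ≢ q) → (ord L k < t ⊎ suc t < ord L k) × ord' L k ≡ ord L k)
  {st : State} (I : Inv la nu n init ord st) where

  open Inv I
  cs : List Cell
  cs = gridOf la

  skew : ∀ {i j x} → st (i , j) ≡ just x → inS la (i , j) ≡ true × inS nu (i , j) ≡ false
  skew {i} {j} e = let h = trans (sym (occ (i , j))) (occ-just {st} e) in ∧-l h , not-elim (∧-r {inS la (i , j)} h)

  noskew : ∀ {i j} → st (i , j) ≡ nothing → inS la (i , j) ≡ false ⊎ inS nu (i , j) ≡ true
  noskew {i} {j} e with inS la (i , j) | inS nu (i , j) | trans (sym (occ (i , j))) (occ-nothing {st} e)
  ... | false | _ | _ = inj₁ refl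
  ... | true | true | _ = inj₂ refl
  ... | true | false | ()

  -- Cells of ν count as smaller than all letters and cells outside λ as larger, so that the skew
  -- shape becomes part of monotonicity. Row 0 is an auxiliary row of `low` values which gives every
  -- box a northern neighbour.
  data Desc (k l : ℕ) : V → Set where
    dVoid  : l < k → Desc k l void
    dIn   : k ≤ l → st (k , l) ≡ nothing → k ≡ 0 ⊎ inS nu (k , l) ≡ true → Desc k l low
    dOut  : k ≤ l → st (k , l) ≡ nothing → 1 ≤ k → inS la (k , l) ≡ false → Desc k l high
    dLow  : ∀ L x → k ≤ l → st (k , l) ≡ just (L , x) → ord L (num x) < t → ord' L (num x) ≡ ord L (num x) → Desc k l low
    dHigh : ∀ L x → k ≤ l → st (k , l) ≡ just (L , x) → suc t < ord L (num x) → ord' L (num x) ≡ ord L (num x) →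
        Desc k l high
    dA    : ∀ r → k ≤ l → st (k , l) ≡ just (SL , mkL p r) → Desc k l (un r)
    dB    : ∀ r → k ≤ l → st (k , l) ≡ just (TL , mkL q r) → Desc k l (be r)

  describe-just : ∀ k l L x → k ≤ l → st (k , l) ≡ just (L , x) → Σ V (Desc k l)
  describe-just k l L x h e with others L (num x) (posit _ _ _ e)
  describe-just k l SL (mkL m r) h e | o with m ≟ p
  ... | yes refl = un r , dA r h e
  ... | no n with o (λ _ → n) (λ ())
  ... | inj₁ y , z = low , dLow SL _ h e y z
  ... | inj₂ y , z = high , dHigh SL _ h e y z
  describe-just k l TL (mkL m r) h e | o with m ≟ q
  ... | yes refl = be r , dB r h e
  ... | no n with o (λ ()) (λ _ → n)
  ... | inj₁ y , z = low , dLow TL _ h e y z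
  ... | inj₂ y , z = high , dHigh TL _ h e y z

  describe-nothing : ∀ k l → k ≤ l → st (k , l) ≡ nothing → Σ V (Desc k l)
  describe-nothing zero l h e = low , dIn h e (inj₁ refl)
  describe-nothing (suc k) l h e with noskew e
  ... | inj₁ x = high , dOut h e (s≤s z≤n) x
  ... | inj₂ x = low , dIn h e (inj₂ x)

  opaque
    describe : ∀ k l → Σ V (Desc k l)
    describe k l with k ≤? l
    ... | no h = void , dVoid (≰⇒> h)
    ... | yes h = go (st (k , l)) refl
      where
      go : ∀ y → st (k , l) ≡ y → Σ V (Desc k l)
      go nothing e = describe-nothing k l h e
      go (just (L , x)) e = describe-just k l L x h e

  g₀ : Grid
  g₀ k l = proj₁ (describe k l)

  desc : ∀ k l → Desc k l (g₀ k l)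
  desc k l = proj₂ (describe k l)

  nothing≢just : ∀ {A : Set} {x : A} {y : Maybe A} → y ≡ nothing → y ≡ just x → ⊥
  nothing≢just refl ()

  -- The threshold t separates the classes, so comparing ranks is comparing positions in the order of the letters.
  data Place (k l : ℕ) (v : V) : Set where
    inner  : rankV v ≡ 0 → st (k , l) ≡ nothing → k ≡ 0 ⊎ inS nu (k , l) ≡ true → Place k l v
    outer  : rankV v ≡ 4 → st (k , l) ≡ nothing → 1 ≤ k → inS la (k , l) ≡ false → Place k l v
    letter : ∀ L x → st (k , l) ≡ just (L , x) →
      (rankV v ≡ 0 × ord L (num x) < t) ⊎ (rankV v ≡ 1 × ord L (num x) ≡ t) ⊎
      (rankV v ≡ 2 × ord L (num x) ≡ suc t) ⊎ (rankV v ≡ 4 × suc t < ord L (num x)) → Place k l v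

  place : ∀ {k l v} → k ≤ l → Desc k l v → Place k l v
  place h (dVoid x) = ⊥-elim (<-irrefl refl (<-≤-trans x h))
  place h (dIn _ e z) = inner refl e z
  place h (dOut _ e a b) = outer refl e a b
  place h (dLow L x _ e o _) = letter L x e (inj₁ (refl , o))
  place h (dHigh L x _ e o _) = letter L x e (inj₂ (inj₂ (inj₂ (refl , o))))
  place h (dA r _ e) = letter SL _ e (inj₂ (inj₁ (refl , ord-a)))
  place h (dB r _ e) = letter TL _ e (inj₂ (inj₂ (inj₁ (refl , ord-b))))

  rank≤4 : ∀ v → rankV v ≤ 4
  rank≤4 v = ≤ᵇ⇒≤′ (sound (all any λ v → end (rankV v ≤ᵇ 4)) refl v refl)

  Level : ℕ → ℕ → Set
  Level r m = (r ≡ 0 × m < t) ⊎ (r ≡ 1 × m ≡ t) ⊎ (r ≡ 2 × m ≡ suc t) ⊎ (r ≡ 4 × suc t < m)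

  level-mono : ∀ {r r' m m'} → Level r m → Level r' m' → m ≤ m' → r ≤ r'
  level-mono (inj₁ (refl , _)) _ _ = z≤n
  level-mono (inj₂ (inj₁ (refl , refl))) (inj₁ (refl , b)) h = ⊥-elim (<-irrefl refl (≤-<-trans h b))
  level-mono (inj₂ (inj₁ (refl , refl))) (inj₂ (inj₁ (refl , _))) h = ≤-refl
  level-mono (inj₂ (inj₁ (refl , refl))) (inj₂ (inj₂ (inj₁ (refl , _)))) h = s≤s z≤n
  level-mono (inj₂ (inj₁ (refl , refl))) (inj₂ (inj₂ (inj₂ (refl , _)))) h = s≤s z≤n
  level-mono (inj₂ (inj₂ (inj₁ (refl , refl)))) (inj₁ (refl , b)) h = ⊥-elim (<-irrefl refl (≤-<-trans (≤-trans
      (n≤1+n _) h) b))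
  level-mono (inj₂ (inj₂ (inj₁ (refl , refl)))) (inj₂ (inj₁ (refl , refl))) h = ⊥-elim (<-irrefl refl h)
  level-mono (inj₂ (inj₂ (inj₁ (refl , refl)))) (inj₂ (inj₂ (inj₁ (refl , _)))) h = ≤-refl
  level-mono (inj₂ (inj₂ (inj₁ (refl , refl)))) (inj₂ (inj₂ (inj₂ (refl , _)))) h = s≤s (s≤s z≤n)
  level-mono (inj₂ (inj₂ (inj₂ (refl , a)))) (inj₁ (refl , b)) h = ⊥-elim (<-irrefl refl (<-trans (<-≤-trans a h)
      (<-trans b (n<1+n _))))
  level-mono (inj₂ (inj₂ (inj₂ (refl , a)))) (inj₂ (inj₁ (refl , refl))) h = ⊥-elim (<-irrefl refl (<-trans
      (<-≤-trans a h) (n<1+n _)))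
  level-mono (inj₂ (inj₂ (inj₂ (refl , a)))) (inj₂ (inj₂ (inj₁ (refl , refl)))) h = ⊥-elim (<-irrefl refl (<-≤-trans a h))
  level-mono (inj₂ (inj₂ (inj₂ (refl , a)))) (inj₂ (inj₂ (inj₂ (refl , _)))) h = ≤-refl

  -- One argument for both directions: the hypotheses list what a step to the east or to the south
  -- has to respect, namely row 0, the two shapes and the order of letters.
  rank-mono : ∀ {k l k' l' v w} → k ≤ l → Desc k l v → k' ≤ l' → Desc k' l' w →
    (k' ≡ 0 → k ≡ 0) → (1 ≤ k → 1 ≤ k') →
    (inS nu (k' , l') ≡ true → k ≡ 0 ⊎ inS nu (k , l) ≡ true) → (1 ≤ k → inS la (k' , l') ≡ true → inS la (k ,
        l) ≡ true) →
    (∀ L x M y → st (k , l) ≡ just (L , x) → st (k' , l') ≡ just (M , y) → ord L (num x) ≤ ord M (num y)) →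
    rankV v ≤ rankV w
  rank-mono {k} {l} {k'} {l'} {v} {w} h d h' d' zero′ one′ inner′ outer′ o = go (place h d) (place h' d')
    where
    row≥1 : ∀ {x} → st (k , l) ≡ just x → k ≢ 0
    row≥1 e refl with inS-out la k l (proj₁ (skew e))
    ... | () , _
    bad : ∀ {x} → st (k , l) ≡ just x → k' ≡ 0 ⊎ inS nu (k' , l') ≡ true → ⊥
    bad e (inj₁ z) = row≥1 e (zero′ z)
    bad e (inj₂ z) with inner′ z
    ... | inj₁ y = row≥1 e y
    ... | inj₂ y = true≢false y (proj₂ (skew e))
    go : Place k l v → Place k' l' w → rankV v ≤ rankV w
    go (inner r _ _) _ = ≤-trans (≤-reflexive r) z≤n
    go _ (outer r _ _ _) = ≤-trans (rank≤4 v) (≤-reflexive (sym r))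
    go (letter L x e a) (letter M y e' b) = level-mono a b (o L x M y e e')
    go (letter L x e a) (inner _ _ z) = ⊥-elim (bad e z)
    go (outer r e k≥1 z) (letter L x e' b) = ⊥-elim (true≢false (outer′ k≥1 (proj₁ (skew e'))) z)
    go (outer r e k≥1 z) (inner _ e' (inj₁ y)) with zero′ y | k≥1
    ... | refl | ()
    go (outer r e k≥1 z) (inner _ e' (inj₂ y)) with inner′ y | k≥1
    ... | inj₁ refl | ()
    ... | inj₂ y' | _ = ⊥-elim (true≢false (sub (k , l) y') z)

  desc-off : ∀ {k l v} → Desc k l v → isVoid v ≡ true → l < k
  desc-off (dVoid h) _ = h

  desc-on : ∀ {k l v} → Desc k l v → isVoid v ≡ false → k ≤ l
  desc-on (dIn h _ _) _ = h
  desc-on (dOut h _ _ _) _ = h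
  desc-on (dLow _ _ h _ _ _) _ = h
  desc-on (dHigh _ _ h _ _ _) _ = h
  desc-on (dA _ h _) _ = h
  desc-on (dB _ h _) _ = h

  desc-isOff : ∀ {k l v} → k ≤ l → Desc k l v → isVoid v ≡ false
  desc-isOff h (dVoid x) = ⊥-elim (<-irrefl refl (<-≤-trans x h))
  desc-isOff h (dIn _ _ _) = refl
  desc-isOff h (dOut _ _ _ _) = refl
  desc-isOff h (dLow _ _ _ _ _ _) = refl
  desc-isOff h (dHigh _ _ _ _ _ _) = refl
  desc-isOff h (dA _ _ _) = refl
  desc-isOff h (dB _ _ _) = refl

  desc-prim : ∀ {k l v} → k ≡ l → Desc k l v → primedV v ≡ false
  desc-prim e (dVoid _) = refl
  desc-prim e (dIn _ _ _) = refl
  desc-prim e (dOut _ _ _ _) = refl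
  desc-prim e (dLow _ _ _ _ _ _) = refl
  desc-prim e (dHigh _ _ _ _ _ _) = refl
  desc-prim refl (dA r _ e) = diag _ _ _ e
  desc-prim refl (dB r _ e) = diag _ _ _ e

  fresh : V → Bool
  fresh v = allowed early v ∧ (not (isAc v) ∧ not (isSe v))

  desc-fresh : ∀ {k l v} → Desc k l v → fresh v ≡ true
  desc-fresh (dVoid _) = refl
  desc-fresh (dIn _ _ _) = refl
  desc-fresh (dOut _ _ _ _) = refl
  desc-fresh (dLow _ _ _ _ _ _) = refl
  desc-fresh (dHigh _ _ _ _ _ _) = refl
  desc-fresh (dA _ _ _) = refl
  desc-fresh (dB _ _ _) = refl

  desc-allowed : ∀ k l → allowed early (g₀ k l) ≡ true
  desc-allowed k l = ∧-l (desc-fresh (desc k l))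

  desc-noAc : ∀ k l → isAc (g₀ k l) ≡ false
  desc-noAc k l = not-elim (∧-l (∧-r {allowed early (g₀ k l)} (desc-fresh (desc k l))))

  desc-noSe : ∀ k l → isSe (g₀ k l) ≡ false
  desc-noSe k l = not-elim (∧-r {not (isAc (g₀ k l))} (∧-r {allowed early (g₀ k l)} (desc-fresh (desc k l))))

  same-fam : ∀ {k l k' l' v w} → Desc k l v → Desc k' l' w → sameFam v w ≡ true →
    Σ Lab λ L → Σ ℕ λ m → st (k , l) ≡ just (L , mkL m (primedV v)) × st (k' , l') ≡ just (L , mkL m (primedV w))
  same-fam (dA _ _ e) (dA _ _ e') _ = SL , p , e , e'
  same-fam (dB _ _ e) (dB _ _ e') _ = TL , q , e , e'
  same-fam (dA _ _ e) (dB _ _ e') ()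
  same-fam (dA _ _ e) (dVoid _) ()
  same-fam (dA _ _ e) (dIn _ _ _) ()
  same-fam (dA _ _ e) (dOut _ _ _ _) ()
  same-fam (dA _ _ e) (dLow _ _ _ _ _ _) ()
  same-fam (dA _ _ e) (dHigh _ _ _ _ _ _) ()
  same-fam (dB _ _ e) (dVoid _) ()
  same-fam (dB _ _ e) (dIn _ _ _) ()
  same-fam (dB _ _ e) (dOut _ _ _ _) ()
  same-fam (dB _ _ e) (dLow _ _ _ _ _ _) ()
  same-fam (dB _ _ e) (dHigh _ _ _ _ _ _) ()

  below-prim : ∀ {k l v} → Desc k l v → l < k → primedV v ≡ false
  below-prim (dVoid _) _ = refl
  below-prim (dIn _ _ _) _ = refl
  below-prim (dOut _ _ _ _) _ = refl
  below-prim (dLow _ _ _ _ _ _) _ = refl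
  below-prim (dHigh _ _ _ _ _ _) _ = refl
  below-prim (dA _ x _) y = ⊥-elim (<-irrefl refl (<-≤-trans y x))
  below-prim (dB _ x _) y = ⊥-elim (<-irrefl refl (<-≤-trans y x))

  g₀-hor : ∀ k l → hor (g₀ k l) (g₀ k (suc l)) ≡ true
  g₀-hor k l = horI
    (λ o → left-off (desc-off (desc k l) o))
    (λ o → let h = desc-on (desc k l) o in
      desc-isOff (m≤n⇒m≤1+n h) (desc k (suc l)) ,
      rank-mono h (desc k l) (m≤n⇒m≤1+n h) (desc k (suc l)) (λ z → z) (λ z → z) (λ z → inj₂ (inS-left {nu} h z))
          (λ _ z → inS-left {la} h z) (rowO k l) ,
      λ f → let L , m , e , e' = same-fam (desc k l) (desc k (suc l)) f in rowP k l L _ _ e e' refl)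
    where
    left-off : l < k → primedV (g₀ k (suc l)) ≡ false
    left-off h with k ≤? suc l
    ... | yes h' = desc-prim (≤-antisym h' h) (desc k (suc l))
    ... | no h' = below-prim (desc k (suc l)) (≰⇒> h')

  g₀-ver : ∀ k l → ver (g₀ k l) (g₀ (suc k) l) ≡ true
  g₀-ver k l = verI
    (λ o → low-off (desc-off (desc (suc k) l) o))
    (λ o → let h = desc-on (desc (suc k) l) o ; h' = ≤-trans (n≤1+n k) h in
      desc-isOff h' (desc k l) ,
      rank-mono h' (desc k l) h (desc (suc k) l) (λ ()) (λ _ → s≤s z≤n) (inner-up k) (λ z → inS-up {la} {k} {l} sla z)
          (colO k l) ,
      λ f → let L , m , e , e' = same-fam (desc k l) (desc (suc k) l) f in colP k l L _ _ e e' refl)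
    where
    inner-up : ∀ k → inS nu (suc k , l) ≡ true → k ≡ 0 ⊎ inS nu (k , l) ≡ true
    inner-up zero z = inj₁ refl
    inner-up (suc k) z = inj₂ (inS-up {nu} {suc k} {l} snu (s≤s z≤n) z)
    low-off : l < suc k → primedV (g₀ k l) ≡ false
    low-off h with k ≤? l
    ... | yes h' = desc-prim (≤-antisym h' (≤-pred h)) (desc k l)
    ... | no h' = below-prim (desc k l) (≰⇒> h')

  g₀-tri : ∀ k l → isVoid (g₀ k l) ≡ (l <ᵇ k)
  g₀-tri k l with l <ᵇ k in e
  ... | true = bool (isVoid (g₀ k l)) refl
    where
    bool : ∀ b → isVoid (g₀ k l) ≡ b → isVoid (g₀ k l) ≡ true
    bool true h = h
    bool false h = ⊥-elim (<-irrefl refl (<-≤-trans (<ᵇ-true {l} e) (desc-on (desc k l) h)))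
  ... | false = desc-isOff (<ᵇ-false {l} e) (desc k l)

  -- At the start nothing is active or settled, so the conditions of `IdleE` have false premises and
  -- the exclusions in `corner` are met.
  idle₀ : Idle early g₀
  idle₀ = record
    { base = record
      { wins = λ k l → mkWin (∧-i (desc-allowed k l) (∧-i (g₀-hor k l) (∧-i (g₀-hor (suc k) l) (∧-i (g₀-ver k l) (∧-i
          (g₀-ver k (suc l))
          (corner-idle {g₀ k l} {g₀ k (suc l)} {g₀ (suc k) l} {g₀ (suc k) (suc l)}
            (trans (cong₂ eqB (g₀-tri k l) (g₀-tri (suc k) (suc l))) (eqB-refl (l <ᵇ k)))
            (desc-noAc k (suc l)) (desc-noAc (suc k) (suc l)) (desc-noSe (suc k) (suc l))))))))
      ; tri = g₀-tri }
    ; noAc = desc-noAc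
    ; ord = record
      { o2 = λ _ _ k l _ s → ⊥-elim (true≢false s (desc-noSe k l))
      ; nn = λ _ l k _ _ _ s → true≢false s (desc-noSe k (suc l)) } }

  live-skew : ∀ {k l v} → Desc k l v → live v ≡ true → inS la (k , l) ≡ true
  live-skew (dA _ _ e) _ = proj₁ (skew e)
  live-skew (dB _ _ e) _ = proj₁ (skew e)

  start₀ : Start p q st g₀ cs
  start₀ = record
    { cs-unique = grid-unique (suc (sum la))
    ; dead = λ k l h → quiet (desc k l) h
    ; live-∈ = λ k l h → inS-grid {la} sla (live-skew (desc k l) h)
    ; live-row = λ k l h → proj₁ (inS-out la k l (live-skew (desc k l) h)) }
    where
    far-a : ∀ {L x} → (ord L (num x) < t ⊎ suc t < ord L (num x)) → is′ SL p (just (L , x)) ≡ false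
    far-a {TL} o = refl
    far-a {SL} {x} o = ¬true⇒false λ e → clash (≡ᵇ⇒≡ (num x) p (subst T (sym e) _)) o
      where
      clash : num x ≡ p → (ord SL (num x) < t ⊎ suc t < ord SL (num x)) → ⊥
      clash refl (inj₁ h) = <-irrefl ord-a h
      clash refl (inj₂ h) = <-irrefl refl (<-trans (n<1+n _) (subst (suc t <_) ord-a h))
    far-b : ∀ {L x} → (ord L (num x) < t ⊎ suc t < ord L (num x)) → is′ TL q (just (L , x)) ≡ false
    far-b {SL} o = refl
    far-b {TL} {x} o = ¬true⇒false λ e → clash (≡ᵇ⇒≡ (num x) q (subst T (sym e) _)) o
      where
      clash : num x ≡ q → (ord TL (num x) < t ⊎ suc t < ord TL (num x)) → ⊥
      clash refl (inj₁ h) = <-irrefl refl (<-trans (n<1+n _) (subst (_< t) ord-b h))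
      clash refl (inj₂ h) = <-irrefl (sym ord-b) h
    quiet : ∀ {k l v} → Desc k l v → live v ≡ false → isLN SL p st (k , l) ≡ false × isLN TL q st (k , l) ≡ false
    quiet {k} {l} (dVoid h) _ = go (st (k , l)) refl
      where
      go : ∀ y → st (k , l) ≡ y → isLN SL p st (k , l) ≡ false × isLN TL q st (k , l) ≡ false
      go nothing e rewrite e = refl , refl
      go (just x) e = ⊥-elim (<-irrefl refl (<-≤-trans h (proj₁ (proj₂ (inS-out la k l (proj₁ (skew e)))))))
    quiet (dIn _ e _) _ rewrite e = refl , refl
    quiet (dOut _ e _ _) _ rewrite e = refl , refl
    quiet (dLow L x _ e o _) _ rewrite e = far-a {L} {x} (inj₁ o) , far-b {L} {x} (inj₁ o)
    quiet (dHigh L x _ e o _) _ rewrite e = far-a {L} {x} (inj₂ o) , far-b {L} {x} (inj₂ o)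

  link₀ : Link p q st g₀ cs g₀ st
  link₀ = record
    { rep = λ k l → represent (desc k l)
    ; same = λ k l → inj₁ refl
    ; cnt = λ L n → refl }
    where
    represent : ∀ {k l v} → Desc k l v → st (k , l) ≡ emb p q (st (k , l)) v
    represent (dVoid _) = refl
    represent (dIn _ _ _) = refl
    represent (dOut _ _ _ _) = refl
    represent (dLow _ _ _ _ _ _) = refl
    represent (dHigh _ _ _ _ _ _) = refl
    represent (dA _ _ e) = e
    represent (dB _ _ e) = e

  data FDesc (st' : State) (k l : ℕ) : V → Set where
    fNone : ∀ {v} → st' (k , l) ≡ st (k , l) → st (k , l) ≡ nothing → FDesc st' k l v
    fLow  : ∀ L x → st' (k , l) ≡ st (k , l) → st (k , l) ≡ just (L , x) → ord' L (num x) < t → ord' L (num x) ≡ ord L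
        (num x) → FDesc st' k l low
    fHigh : ∀ L x → st' (k , l) ≡ st (k , l) → st (k , l) ≡ just (L , x) → suc t < ord' L (num x) → ord' L
        (num x) ≡ ord L (num x) → FDesc st' k l high
    fB    : ∀ r → occupied st (k , l) ≡ true → st' (k , l) ≡ just (TL , mkL q r) → FDesc st' k l (be r)
    fA    : ∀ r → occupied st (k , l) ≡ true → st' (k , l) ≡ just (SL , mkL p r) → FDesc st' k l (se r)

  module _ {st' : State} (Fin : Process.Finished start₀ st') where
    private
      module Fi = Process.Finished Fin
      f : Grid
      f = Fi.final
    open Link Fi.link using (rep; same)
    open Base Fi.base using (wins)

    fdesc : ∀ k l → FDesc st' k l (f k l)
    fdesc k l = go (f k l) refl (same k l) (rep k l)
      where
      live-occ : ∀ {v} → Desc k l v → live v ≡ true → occupied st (k , l) ≡ true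
      live-occ (dA _ _ e) _ = occ-just {st} e
      live-occ (dB _ _ e) _ = occ-just {st} e
      dead-case : ∀ {v} → Desc k l v → live v ≡ false → st' (k , l) ≡ st (k , l) → FDesc st' k l v
      dead-case (dIn _ e _) _ r = fNone r e
      dead-case (dOut _ e _ _) _ r = fNone r e
      dead-case (dLow L x _ e o o') _ r = fLow L x r e (subst (_< t) (sym o') o) o'
      dead-case (dHigh L x _ e o o') _ r = fHigh L x r e (subst (suc t <_) (sym o') o) o'
      dead-case (dVoid h) _ r = empty (st (k , l)) refl
        where
        empty : ∀ y → st (k , l) ≡ y → FDesc st' k l void
        empty nothing e = fNone r e
        empty (just x) e = ⊥-elim (<-irrefl refl (<-≤-trans h (proj₁ (proj₂ (inS-out la k l (proj₁ (skew e)))))))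
      old : ∀ {v} → live v ≡ false → Same (g₀ k l) v → st' (k , l) ≡ st (k , l) → FDesc st' k l v
      old h (inj₁ e) r = subst (FDesc st' k l) e (dead-case (desc k l) (trans (cong live e) h) r)
      old h (inj₂ (_ , h')) r = ⊥-elim (true≢false h' h)
      was-live : ∀ {v} → live v ≡ true → Same (g₀ k l) v → occupied st (k , l) ≡ true
      was-live h s = live-occ (desc k l) (Same-live s h)
      go : ∀ v → f k l ≡ v → Same (g₀ k l) v → st' (k , l) ≡ emb p q (st (k , l)) v → FDesc st' k l v
      go void _ s r = old refl s r
      go low _ s r = old refl s r
      go high _ s r = old refl s r
      go (un _) e s r = ⊥-elim (true≢false (cong isUn e) (Fi.noUn k l))
      go (ac _) e s r = ⊥-elim (true≢false (cong isAc e) (Fi.noAc k l))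
      go (se r) _ s e = fA r (was-live refl s) e
      go (be r) _ s e = fB r (was-live refl s) e

    Kept : ℕ → ℕ → Lab → Letter → Set
    Kept k l L x = st (k , l) ≡ just (L , x) × ord' L (num x) ≡ ord L (num x)

    flevel : ∀ {k l v} L x → FDesc st' k l v → st' (k , l) ≡ just (L , x) →
      (v ≡ low × ord' L (num x) < t × Kept k l L x) ⊎ (v ≡ be (primed x) × L ≡ TL × num x ≡ q) ⊎
      (v ≡ se (primed x) × L ≡ SL × num x ≡ p) ⊎ (v ≡ high × suc t < ord' L (num x) × Kept k l L x)
    flevel L x (fNone r e) h = ⊥-elim (nothing≢just (trans r e) h)
    flevel L x (fLow M y r e o o') h with trans (sym h) (trans r e)
    ... | refl = inj₁ (refl , o , e , o')
    flevel L x (fHigh M y r e o o') h with trans (sym h) (trans r e)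
    ... | refl = inj₂ (inj₂ (inj₂ (refl , o , e , o')))
    flevel L x (fB r _ e) h with trans (sym h) e
    ... | refl = inj₂ (inj₁ (refl , refl , refl))
    flevel L x (fA r _ e) h with trans (sym h) e
    ... | refl = inj₂ (inj₂ (inj₁ (refl , refl , refl)))

    -- A pair of adjacent cells: either both entries are untouched, or the positions settle the comparison.
    adjacent : ∀ {k l k' l'} L x M y → st' (k , l) ≡ just (L , x) → st' (k' , l') ≡ just (M , y) →
      rankV (f k l) ≤ rankV (f k' l') →
      (Kept k l L x × Kept k' l' M y) ⊎
      (ord' L (num x) < ord' M (num y)) ⊎
      (L ≡ M × num x ≡ num y × sameFam (f k l) (f k' l') ≡ true × primedV (f k l) ≡ primed x × primedV
          (f k' l') ≡ primed y)
    adjacent {k} {l} {k'} {l'} L x M y e e' h with f k l | f k' l' | flevel L x (fdesc k l) e | flevel M y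
        (fdesc k' l') e'
    ... | _ | _ | inj₁ (refl , _ , a) | inj₁ (refl , _ , b) = inj₁ (a , b)
    ... | _ | _ | inj₁ (refl , o , _) | inj₂ (inj₁ (refl , refl , refl)) = inj₂ (inj₁ (<-≤-trans o (≤-reflexive
        (sym ord'-b))))
    ... | _ | _ | inj₁ (refl , o , _) | inj₂ (inj₂ (inj₁ (refl , refl , refl))) = inj₂ (inj₁ (<-≤-trans o (≤-trans
        (n≤1+n t) (≤-reflexive (sym ord'-a)))))
    ... | _ | _ | inj₁ (refl , _ , a) | inj₂ (inj₂ (inj₂ (refl , _ , b))) = inj₁ (a , b)
    ... | _ | _ | inj₂ (inj₁ (refl , _)) | inj₁ (refl , _) = ⊥-elim (<⇒≱ (s≤s z≤n) h)
    ... | _ | _ | inj₂ (inj₁ (refl , refl , refl)) | inj₂ (inj₁ (refl , refl , n)) = inj₂ (inj₂ (refl , sym n , refl ,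
        refl , refl))
    ... | _ | _ | inj₂ (inj₁ (refl , refl , refl)) | inj₂ (inj₂ (inj₁ (refl , refl , refl))) =
        inj₂ (inj₁ (≤-reflexive (trans (cong suc ord'-b) (sym ord'-a))))
    ... | _ | _ | inj₂ (inj₁ (refl , refl , refl)) | inj₂ (inj₂ (inj₂ (refl , o , _))) =
        inj₂ (inj₁ (≤-trans (≤-reflexive (cong suc ord'-b)) (≤-trans (n≤1+n _) o)))
    ... | _ | _ | inj₂ (inj₂ (inj₁ (refl , _))) | inj₁ (refl , _) = ⊥-elim (<⇒≱ (s≤s z≤n) h)
    ... | _ | _ | inj₂ (inj₂ (inj₁ (refl , _))) | inj₂ (inj₁ (refl , _)) = ⊥-elim (<⇒≱ (s≤s (s≤s (s≤s z≤n))) h)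
    ... | _ | _ | inj₂ (inj₂ (inj₁ (refl , refl , refl))) | inj₂ (inj₂ (inj₁ (refl , refl , n))) = inj₂ (inj₂ (refl ,
        sym n , refl , refl , refl))
    ... | _ | _ | inj₂ (inj₂ (inj₁ (refl , refl , refl))) | inj₂ (inj₂ (inj₂ (refl , o , _))) =
        inj₂ (inj₁ (≤-trans (≤-reflexive (cong suc ord'-a)) o))
    ... | _ | _ | inj₂ (inj₂ (inj₂ (refl , _))) | inj₁ (refl , _) = ⊥-elim (<⇒≱ (s≤s z≤n) h)
    ... | _ | _ | inj₂ (inj₂ (inj₂ (refl , _))) | inj₂ (inj₁ (refl , _)) = ⊥-elim (<⇒≱ (s≤s (s≤s (s≤s z≤n))) h)
    ... | _ | _ | inj₂ (inj₂ (inj₂ (refl , _))) | inj₂ (inj₂ (inj₁ (refl , _))) = ⊥-elim (<⇒≱ (s≤s (s≤s (s≤s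
        (s≤s z≤n)))) h)
    ... | _ | _ | inj₂ (inj₂ (inj₂ (refl , _ , a))) | inj₂ (inj₂ (inj₂ (refl , _ , b))) = inj₁ (a , b)

    occ′ : ∀ c → occupied st' c ≡ inSkew la nu c
    occ′ (k , l) = trans (go (fdesc k l)) (occ (k , l))
      where
      go : ∀ {v} → FDesc st' k l v → occupied st' (k , l) ≡ occupied st (k , l)
      go (fNone r e) = cong (maybe (λ _ → true) false) r
      go (fLow L x r e _ _) = cong (maybe (λ _ → true) false) r
      go (fHigh L x r e _ _) = cong (maybe (λ _ → true) false) r
      go (fB r o e) = trans (occ-just {st'} e) (sym o)
      go (fA r o e) = trans (occ-just {st'} e) (sym o)

    skew′ : ∀ {k l x} → st' (k , l) ≡ just x → 1 ≤ k × k ≤ l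
    skew′ {k} {l} e = let h = trans (sym (occ′ (k , l))) (occ-just {st'} e) ; a , b , _ = inS-out la k l (∧-l h) in a , b

    kept-or : ∀ k l L x → st' (k , l) ≡ just (L , x) → st (k , l) ≡ just (L , x) ⊎ (L ≡ TL × num x ≡ q × f k l ≡ be
        (primed x)) ⊎ (L ≡ SL × num x ≡ p × f k l ≡ se (primed x))
    kept-or k l L x e with flevel L x (fdesc k l) e
    ... | inj₁ (_ , _ , a , _) = inj₁ a
    ... | inj₂ (inj₁ (v , a , b)) = inj₂ (inj₁ (a , b , v))
    ... | inj₂ (inj₂ (inj₁ (v , a , b))) = inj₂ (inj₂ (a , b , v))
    ... | inj₂ (inj₂ (inj₂ (_ , _ , a , _))) = inj₁ a

    row-rank : ∀ {k l} → k ≤ l → rankV (f k l) ≤ rankV (f k (suc l))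
    row-rank h = Base.rowMono Fi.base h (n≤1+n _)

    col-rank : ∀ {k l} → suc k ≤ l → rankV (f k l) ≤ rankV (f (suc k) l)
    col-rank h = Base.colMono Fi.base (n≤1+n _) h

    stage : Inv la nu n init ord' st'
    stage = record
      { occ = occ′
      ; posit = λ { (k , l) L x e → posit′ (kept-or k l L x e) }
      ; bound = λ { (k , l) x e → bound′ (kept-or k l TL x e) }
      ; rowO = λ i j L x M y e e' → orderly (adjacent L x M y e e' (row-rank (proj₂ (skew′ e)))) (λ a b →
          rowO i j L x M y a b)
      ; rowP = λ i j L x y e e' z → row-prime i j L x y e e' z (adjacent L x L y e e' (row-rank (proj₂ (skew′ e))))
      ; colO = λ i j L x M y e e' → orderly (adjacent L x M y e e' (col-rank (proj₂ (skew′ e')))) (λ a b →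
          colO i j L x M y a b)
      ; colP = λ i j L x y e e' z → col-prime i j L x y e e' z (adjacent L x L y e e' (col-rank (proj₂ (skew′ e'))))
      ; diag = diag′
      ; cnt = λ L k → trans (Link.cnt Fi.link L k) (cnt L k) }
      where
      posit′ : ∀ {c L x} {P Q : Set} → st c ≡ just (L , x) ⊎ (L ≡ TL × num x ≡ q × P) ⊎ (L ≡ SL × num x ≡ p × Q) →
          1 ≤ num x
      posit′ (inj₁ e) = posit _ _ _ e
      posit′ (inj₂ (inj₁ (_ , e , _))) = ≤-trans 1≤q (≤-reflexive (sym e))
      posit′ (inj₂ (inj₂ (_ , e , _))) = ≤-trans 1≤p (≤-reflexive (sym e))
      bound′ : ∀ {c x} {P Q : Set} → st c ≡ just (TL , x) ⊎ (TL ≡ TL × num x ≡ q × P) ⊎ (TL ≡ SL × num x ≡ p × Q) →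
          num x ≤ n
      bound′ (inj₁ e) = bound _ _ e
      bound′ (inj₂ (inj₁ (_ , e , _))) = ≤-trans (≤-reflexive e) q≤n
      bound′ (inj₂ (inj₂ (() , _)))
      orderly : ∀ {c c' L x M y} {P : Set} →
        ((st c ≡ just (L , x) × ord' L (num x) ≡ ord L (num x)) × (st c' ≡ just (M , y) × ord' M (num y) ≡ ord M
            (num y))) ⊎
        (ord' L (num x) < ord' M (num y)) ⊎ (L ≡ M × num x ≡ num y × P) →
        (st c ≡ just (L , x) → st c' ≡ just (M , y) → ord L (num x) ≤ ord M (num y)) → ord' L (num x) ≤ ord' M (num y)
      orderly (inj₁ ((a , b) , (a' , b'))) h = ≤-trans (≤-reflexive b) (≤-trans (h a a') (≤-reflexive (sym b')))
      orderly (inj₂ (inj₁ h)) _ = <⇒≤ h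
      orderly (inj₂ (inj₂ (refl , e , _))) _ = ≤-reflexive (cong (ord' _) e)
      row-prime : ∀ i j L x y → st' (i , j) ≡ just (L , x) → st' (i , suc j) ≡ just (L , y) → num x ≡ num y → _ →
          primed y ≡ false
      row-prime i j L x y e e' z (inj₁ ((a , _) , (b , _))) = rowP i j L x y a b z
      row-prime i j L x y e e' z (inj₂ (inj₁ h)) = ⊥-elim (<-irrefl (cong (ord' L) z) h)
      row-prime i j L x y e e' z (inj₂ (inj₂ (_ , _ , s , _ , r))) = trans (sym r) (hor-fam (f i j) (f i (suc j))
          (win-hor (wins i j)) s)
      col-prime : ∀ i j L x y → st' (i , j) ≡ just (L , x) → st' (suc i , j) ≡ just (L , y) → num x ≡ num y → _ →
          primed x ≡ true
      col-prime i j L x y e e' z (inj₁ ((a , _) , (b , _))) = colP i j L x y a b z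
      col-prime i j L x y e e' z (inj₂ (inj₁ h)) = ⊥-elim (<-irrefl (cong (ord' L) z) h)
      col-prime i j L x y e e' z (inj₂ (inj₂ (_ , _ , s , r , _))) = trans (sym r) (ver-fam (f i j) (f (suc i) j)
          (win-ver (wins i j)) s)
      diag′ : ∀ i L x → st' (i , i) ≡ just (L , x) → primed x ≡ false
      diag′ zero L x e with proj₁ (skew′ e)
      ... | ()
      diag′ (suc i) L x e = go (kept-or (suc i) (suc i) L x e)
        where
        unprimed : primedV (f (suc i) (suc i)) ≡ false
        unprimed = hor-off {f (suc i) i} {f (suc i) (suc i)} (c-off Fi.base i) (win-hor (wins (suc i) i))
        go : st (suc i , suc i) ≡ just (L , x) ⊎ (L ≡ TL × num x ≡ q × f (suc i) (suc i) ≡ be (primed x)) ⊎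
             (L ≡ SL × num x ≡ p × f (suc i) (suc i) ≡ se (primed x)) → primed x ≡ false
        go (inj₁ e) = diag _ _ _ e
        go (inj₂ (inj₁ (_ , _ , v))) = trans (sym (cong primedV v)) unprimed
        go (inj₂ (inj₂ (_ , _ , v))) = trans (sym (cong primedV v)) unprimed

-- All stages

T-in : ∀ {b} → b ≡ true → T b
T-in refl = _

T-out : ∀ {b} → T b → b ≡ true
T-out {true} _ = refl

-- Needed for the weight of S, which is defined by a count over the grid of μ, whereas the invariant
-- counts over the grid of λ.
count-grids : ∀ {f xs ys} → Unique xs → Unique ys → (∀ c → f c ≡ true → c ∈ xs × c ∈ ys) → count f xs ≡ count f ys
count-grids {f} {xs} {ys} u v h = ↭-length (∼bag⇒↭ (unique∧set⇒bag (Uniq.filter⁺ (T? ∘ f) u) (Uniq.filter⁺ (T? ∘ f) v)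
  (mk⇔ (λ m → let _ , t = ∈-filter⁻ (T? ∘ f) {xs = xs} m in ∈-filter⁺ (T? ∘ f) (proj₂ (h _ (T-out t))) t)
       (λ m → let _ , t = ∈-filter⁻ (T? ∘ f) {xs = ys} m in ∈-filter⁺ (T? ∘ f) (proj₁ (h _ (T-out t))) t))))

max-bound : ∀ (f : Cell → ℕ) {c} xs → c ∈ xs → f c ≤ foldr _⊔_ 0 (map f xs)
max-bound f (x ∷ xs) (here refl) = m≤m⊔n (f x) _
max-bound f (x ∷ xs) (there m) = ≤-trans (max-bound f xs m) (m≤n⊔m (f x) _)

inSkew-inS : ∀ {la mu c} → InSkew la mu c → inS la c ≡ true × inS mu c ≡ false
inSkew-inS {la} {mu} {c} h = ∧-l h , not-elim (∧-r {inS la c} h)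

maxEntry-bound : ∀ {la mu} → Strict la → ∀ f c → InSkew la mu c → num (f c) ≤ maxEntry f la mu
maxEntry-bound {la} {mu} s f c h = max-bound (num ∘ f) (filterᵇ (inSkew la mu) (gridOf la))
  (∈-filter⁺ (T? ∘ inSkew la mu) (inS-grid s (proj₁ (inSkew-inS {la} {mu} {c} h))) (T-in h))

<ᵇ-O : ∀ {m n} → n ≤ m → (m <ᵇ n) ≡ false
<ᵇ-O h = ¬true⇒false λ e → <-irrefl refl (<-≤-trans (<ᵇ-true e) h)

-- The position of a letter when S_p has been switched with T_1, …, T_c. The order of the letters at that moment is
-- S_1 < … < S_(p-1) < T_1 < … < T_c < S_p < T_(c+1) < … < T_n < S_(p+1) < …
key : ℕ → ℕ → ℕ → Lab → ℕ → ℕ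
key n p c SL k = if k <ᵇ p then k else if k ≡ᵇ p then p + c else k + n
key n p c TL zero = 0
key n p c TL (suc l) = if l <ᵇ c then p + l else p + suc l

module _ {n p c : ℕ} where
  key-S< : ∀ {k} → k < p → key n p c SL k ≡ k
  key-S< h rewrite <ᵇ-I h = refl
  key-S≡ : key n p c SL p ≡ p + c
  key-S≡ rewrite <ᵇ-O (≤-refl {p}) | ≡ᵇ-refl p = refl
  key-S> : ∀ {k} → p < k → key n p c SL k ≡ k + n
  key-S> {k} h rewrite <ᵇ-O (<⇒≤ h) | ≡ᵇ-≢ {k} {p} (λ e → <-irrefl (sym e) h) = refl
  key-T< : ∀ {l} → l < c → key n p c TL (suc l) ≡ p + l
  key-T< h rewrite <ᵇ-I h = refl
  key-T≥ : ∀ {l} → c ≤ l → key n p c TL (suc l) ≡ p + suc l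
  key-T≥ h rewrite <ᵇ-O h = refl

key-others : ∀ {n p c} → c < n → ∀ L k → 1 ≤ k → (L ≡ SL → k ≢ p) → (L ≡ TL → k ≢ suc c) →
  (key n p c L k < p + c ⊎ suc (p + c) < key n p c L k) × key n p (suc c) L k ≡ key n p c L k
key-others {n} {p} {c} c<n SL k _ a b with <-cmp k p
... | tri< lt _ _ = inj₁ (≤-trans (s≤s (≤-reflexive (key-S< {n} {p} {c} lt))) (≤-trans lt (m≤m+n p c))) , trans
    (key-S< {n} {p} {suc c} lt) (sym (key-S< {n} {p} {c} lt))
... | tri≈ _ e _ = ⊥-elim (a refl e)
... | tri> _ _ gt = inj₂ (≤-trans (≤-trans (s≤s (≤-reflexive (sym (+-suc p c)))) (+-mono-≤ gt c<n)) (≤-reflexive (sym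
    (key-S> {n} {p} {c} gt))))
    , trans (key-S> {n} {p} {suc c} gt) (sym (key-S> {n} {p} {c} gt))
key-others {n} {p} {c} c<n TL (suc l) _ a b with <-cmp l c
... | tri< lt _ _ = inj₁ (≤-trans (s≤s (≤-reflexive (key-T< {n} {p} {c} lt))) (≤-trans (≤-reflexive (sym (+-suc p l)))
    (+-monoʳ-≤ p lt)))
    , trans (key-T< {n} {p} {suc c} (m≤n⇒m≤1+n lt)) (sym (key-T< {n} {p} {c} lt))
... | tri≈ _ e _ = ⊥-elim (b refl (cong suc e))
... | tri> _ _ gt = inj₂ (≤-trans (≤-trans (s≤s (s≤s (≤-refl))) (≤-trans (≤-reflexive (trans (cong suc (sym
    (+-suc p c))) (sym (+-suc p (suc c))))) (+-monoʳ-≤ p (s≤s gt)))) (≤-reflexive (sym (key-T≥ {n} {p} {c} (<⇒≤ gt)))))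
    , trans (key-T≥ {n} {p} {suc c} gt) (sym (key-T≥ {n} {p} {c} (<⇒≤ gt)))

-- Orders are compared only at letters that occur, and these have positive numbers, bounded by `n`
-- for the label T.
Inv-cong : ∀ {la nu n init ord ord' st} → (∀ L k → 1 ≤ k → (L ≡ TL → k ≤ n) → ord L k ≡ ord' L k) →
    Inv la nu n init ord st → Inv la nu n init ord' st
Inv-cong {ord = ord} {ord'} {st} h I = record
  { occ = occ ; posit = posit ; bound = bound
  ; rowO = λ i j L x M y e e' → subst₂ _≤_ (eq e) (eq e') (rowO i j L x M y e e')
  ; rowP = rowP
  ; colO = λ i j L x M y e e' → subst₂ _≤_ (eq e) (eq e') (colO i j L x M y e e')
  ; colP = colP ; diag = diag ; cnt = cnt }
  where
  open Inv I
  eq : ∀ {c L x} → st c ≡ just (L , x) → ord L (num x) ≡ ord' L (num x)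
  eq {c} {L} {x} e = h L (num x) (posit c L x e) (λ { refl → bound c x e })

-- When one letter of S has passed all `n` letters of T, the order is that in which the preceding
-- letter of S has passed none. The bound on T-letters matters: beyond `n` the two keys would
-- differ.
key-row : ∀ {n p} L k → 1 ≤ k → (L ≡ TL → k ≤ n) → key n (suc p) n L k ≡ key n p 0 L k
key-row {n} {p} SL k _ _ with <-cmp k (suc p)
... | tri≈ _ refl _ = trans (key-S≡ {n} {suc p} {n}) (sym (key-S> {n} {p} {0} ≤-refl))
... | tri> _ _ gt = trans (key-S> {n} {suc p} {n} gt) (sym (key-S> {n} {p} {0} (<-trans (n<1+n p) gt)))
... | tri< lt _ _ with m≤n⇒m<n∨m≡n (≤-pred lt)
... | inj₁ lt' = trans (key-S< {n} {suc p} {n} lt) (sym (key-S< {n} {p} {0} lt'))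
... | inj₂ refl = trans (key-S< {n} {suc p} {n} lt) (trans (sym (+-identityʳ p)) (sym (key-S≡ {n} {p} {0})))
key-row {n} {p} TL (suc l) _ h = trans (key-T< {n} {suc p} {n} (h refl)) (trans (sym (+-suc p l)) (sym
    (key-T≥ {n} {p} {0} z≤n)))

module Run {la nu : List ℕ} (sla : Strict la) (snu : Strict nu) (sub : Sub nu la) (n : ℕ) (init : State) where

  run-row : ∀ {p m st st'} → 1 ≤ p → m ≤ n → RunRow p m st st' → Inv la nu n init (key n p 0) st → Inv la nu n init
      (key n p m) st'
  run-row h h' row0 I = I
  run-row {p} {suc m} h h' (rowS r pr) I = S.stage (Process.process S.start₀ (idle early S.idle₀) S.link₀ pr)
    where
    module S = Stage sla snu sub n init p (suc m) h (s≤s z≤n) h' (key n p m) (key n p (suc m)) (p + m)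
      (key-S≡ {n} {p} {m}) (trans (key-T≥ {n} {p} {m} ≤-refl) (+-suc p m))
      (trans (key-S≡ {n} {p} {suc m}) (+-suc p m)) (key-T< {n} {p} {suc m} ≤-refl) (key-others h')
      (run-row h (≤-trans (n≤1+n m) h') r I)

  run-all : ∀ {m st st'} → RunAll n m st st' → Inv la nu n init (key n m 0) st → Inv la nu n init (key n 0 0) st'
  run-all all0 I = I
  run-all (allS r rs) I = run-all rs (Inv-cong key-row (run-row (s≤s z≤n) ≤-refl r I))

-- Ranks of letters in terms of numbers and primes

rank-upper : ∀ x → rank x ≤ 2 * num x
rank-upper (mkL k false) = ≤-refl
rank-upper (mkL k true) = m∸n≤m (2 * k) 1

rank-lower : ∀ x → 2 * num x ≤ suc (rank x)
rank-lower (mkL k false) = n≤1+n _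
rank-lower (mkL k true) = m≤n+m∸n (2 * k) 1

double-< : ∀ {k m} → k < m → suc (suc (2 * k)) ≤ 2 * m
double-< {k} h = ≤-trans (≤-reflexive (sym (*-suc 2 k))) (*-monoʳ-≤ 2 h)

rank-< : ∀ {x y} → num x < num y → rank x < rank y
rank-< {x} {y} h = ≤-pred (≤-trans (s≤s (s≤s (rank-upper x))) (≤-trans (double-< h) (rank-lower y)))

rank-num : ∀ {x y} → rank x ≤ rank y → num x ≤ num y
rank-num {x} {y} h = ≮⇒≥ λ lt → <-irrefl refl (<-≤-trans (rank-< {y} {x} lt) h)

rank-primed : ∀ {x y} → 1 ≤ num x → num x ≡ num y → rank x ≤ rank y → primed y ≡ true → primed x ≡ true
rank-primed {mkL (suc k) true} _ _ _ _ = refl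
rank-primed {mkL (suc k) false} {mkL .(suc k) true} _ refl h _ = ⊥-elim (<-irrefl refl h)

rank-unprimed-right : ∀ {x y} → num x ≤ num y → (num x ≡ num y → primed y ≡ false) → rank x ≤ rank y
rank-unprimed-right {x} {y} h f with m≤n⇒m<n∨m≡n h
... | inj₁ lt = <⇒≤ (rank-< {x} {y} lt)
... | inj₂ refl = ≤-trans (rank-upper x) (≤-reflexive (unprimed-rank {y} (f refl)))
  where
  unprimed-rank : ∀ {y} → primed y ≡ false → 2 * num y ≡ rank y
  unprimed-rank {mkL k false} _ = refl

rank-primed-left : ∀ {x y} → num x ≤ num y → (num x ≡ num y → primed x ≡ true) → rank x ≤ rank y
rank-primed-left {x} {y} h f with m≤n⇒m<n∨m≡n h
... | inj₁ lt = <⇒≤ (rank-< {x} {y} lt)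
rank-primed-left {mkL k true} {mkL .k false} h f | inj₂ refl = m∸n≤m (2 * k) 1
rank-primed-left {mkL k true} {mkL .k true} h f | inj₂ refl = ≤-refl
rank-primed-left {mkL k false} {mkL .k _} h f | inj₂ refl with f refl
... | ()

-- The initial state

module Initial {la mu nu : List ℕ} (sla : Strict la) (smu : Strict mu) (snu : Strict nu) (nu⊆mu : Sub nu mu)
    (mu⊆la : Sub mu la)
  {S T : Cell → Letter} (tS : SSYT S mu nu) (tT : SSYT T la mu) where

  n m : ℕ
  n = maxEntry T la mu
  m = maxEntry S mu nu

  init : State
  init = initState S T la mu nu

  module tableauS = SYT (SSYT.syt tS)
  module tableauT = SYT (SSYT.syt tT)

  data Source (c : Cell) : Set where
    fromT : InSkew la mu c → init c ≡ just (TL , T c) → Source c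
    fromS : inSkew la mu c ≡ false → InSkew mu nu c → init c ≡ just (SL , S c) → Source c
    empty : inSkew la mu c ≡ false → inSkew mu nu c ≡ false → init c ≡ nothing → Source c

  source : ∀ c → Source c
  source c with inSkew la mu c in e | inSkew mu nu c in e'
  ... | true | _ = fromT e (cong (λ b → if b then just (TL , T c) else (if inSkew mu nu c then just (SL ,
      S c) else nothing)) e)
  ... | false | true = fromS e e' (cong₂ (λ b b' → if b then just (TL , T c) else (if b' then just (SL ,
      S c) else nothing)) e e')
  ... | false | false = empty e e' (cong₂ (λ b b' → if b then just (TL , T c) else (if b' then just (SL ,
      S c) else nothing)) e e')

  Letter-of : Lab → Cell → Set
  Letter-of SL c = InSkew mu nu c
  Letter-of TL c = InSkew la mu c

  fill : Lab → Cell → Letter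
  fill SL = S
  fill TL = T

  from : ∀ c L x → init c ≡ just (L , x) → Letter-of L c × x ≡ fill L c
  from c L x e with source c
  ... | fromT h e' with trans (sym e) e'
  ... | refl = h , refl
  from c L x e | fromS _ h e' with trans (sym e) e'
  ... | refl = h , refl
  from c L x e | empty _ _ e' with trans (sym e) e'
  ... | ()

  positive : ∀ L c → Letter-of L c → 1 ≤ num (fill L c)
  positive SL c = tableauS.positive c
  positive TL c = tableauT.positive c

  at-S : ∀ {k} → k ≤ m → key n m 0 SL k ≡ k
  at-S h with m≤n⇒m<n∨m≡n h
  ... | inj₁ lt = key-S< {n} {m} {0} lt
  ... | inj₂ e = trans (cong (key n m 0 SL) e) (trans (key-S≡ {n} {m} {0}) (trans (+-identityʳ m) (sym e)))

  -- The S-letters that occur have keys up to `m`, and all T-letters have keys beyond `m`. What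
  -- remains is the comparison within one label.
  key-order : ∀ L M {k k'} → 1 ≤ k → 1 ≤ k' → (L ≡ SL → k ≤ m) → (M ≡ SL → k' ≤ m) → (L ≡ TL → M ≡ TL) → (L ≡ M →
      k ≤ k') →
    key n m 0 L k ≤ key n m 0 M k'
  key-order SL SL _ _ a b _ h = ≤-trans (≤-reflexive (at-S (a refl))) (≤-trans (h refl) (≤-reflexive (sym (at-S
      (b refl)))))
  key-order SL TL {k} {suc k'} _ _ a _ _ _ = ≤-trans (≤-trans (≤-reflexive (at-S (a refl))) (a refl)) (≤-trans
      (m≤m+n m (suc k')) (≤-reflexive (sym (key-T≥ {n} {m} {0} z≤n))))
  key-order TL SL _ _ _ _ h _ with h refl
  ... | ()
  key-order TL TL {suc k} {suc k'} _ _ _ _ _ h = ≤-trans (≤-reflexive (key-T≥ {n} {m} {0} z≤n))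
    (≤-trans (+-monoʳ-≤ m (h refl)) (≤-reflexive (sym (key-T≥ {n} {m} {0} z≤n))))

  le-m : ∀ L c → Letter-of L c → L ≡ SL → num (fill L c) ≤ m
  le-m SL c h _ = maxEntry-bound {mu} {nu} smu S c h

  row-le : ∀ L i j → Letter-of L (i , j) → Letter-of L (i , suc j) → rank (fill L (i , j)) ≤ rank (fill L (i , suc j))
  row-le SL i j h h' = tableauS.rowWeak i j (suc j) h h' (n≤1+n j)
  row-le TL i j h h' = tableauT.rowWeak i j (suc j) h h' (n≤1+n j)

  col-le : ∀ L i j → Letter-of L (i , j) → Letter-of L (suc i , j) → rank (fill L (i , j)) ≤ rank (fill L (suc i , j))
  col-le SL i j h h' = tableauS.colWeak i (suc i) j h h' (n≤1+n i)
  col-le TL i j h h' = tableauT.colWeak i (suc i) j h h' (n≤1+n i)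

  row-pr : ∀ L i j → Letter-of L (i , j) → Letter-of L (i , suc j) → primed (fill L (i , j)) ≡ true →
    primed (fill L (i , suc j)) ≡ true → num (fill L (i , j)) ≢ num (fill L (i , suc j))
  row-pr SL i j h h' = tableauS.rowPrimed i j (suc j) h h' (λ e → suc≢ (sym e))
  row-pr TL i j h h' = tableauT.rowPrimed i j (suc j) h h' (λ e → suc≢ (sym e))

  col-un : ∀ L i j → Letter-of L (i , j) → Letter-of L (suc i , j) → primed (fill L (i , j)) ≡ false →
    primed (fill L (suc i , j)) ≡ false → num (fill L (i , j)) ≢ num (fill L (suc i , j))
  col-un SL i j h h' = tableauS.colUnprimed i (suc i) j h h' (λ e → suc≢ (sym e))
  col-un TL i j h h' = tableauT.colUnprimed i (suc i) j h h' (λ e → suc≢ (sym e))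

  diag-un : ∀ L i → Letter-of L (i , i) → primed (fill L (i , i)) ≡ false
  diag-un SL i h = SSYT.diag tS i h
  diag-un TL i h = SSYT.diag tT i h

  row-TT : ∀ L M i j → Letter-of L (i , j) → Letter-of M (i , suc j) → L ≡ TL → M ≡ TL
  row-TT TL TL i j h h' _ = refl
  row-TT TL SL i j h h' _ = ⊥-elim (true≢false (inS-left {mu} {i} {j} i≤j (proj₁ (inSkew-inS {mu} {nu} {i ,
      suc j} h'))) (proj₂ (inSkew-inS {la} {mu} {i , j} h)))
    where
    i≤j : i ≤ j
    i≤j = proj₁ (proj₂ (inS-out la i j (proj₁ (inSkew-inS {la} {mu} {i , j} h))))

  col-TT : ∀ L M i j → Letter-of L (i , j) → Letter-of M (suc i , j) → L ≡ TL → M ≡ TL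
  col-TT TL TL i j h h' _ = refl
  col-TT TL SL i j h h' _ = ⊥-elim (true≢false (inS-up {mu} {i} {j} smu 1≤i (proj₁ (inSkew-inS {mu} {nu} {suc i ,
      j} h'))) (proj₂ (inSkew-inS {la} {mu} {i , j} h)))
    where
    1≤i : 1 ≤ i
    1≤i = proj₁ (inS-out la i j (proj₁ (inSkew-inS {la} {mu} {i , j} h)))

  occupied-init : ∀ c → occupied init c ≡ inSkew la nu c
  occupied-init c with source c
  ... | fromT h e = let a , b = inSkew-inS {la} {mu} {c} h in
      trans (occ-just {init} {c} e) (sym (∧-i a (not-intro (¬true⇒false λ x → true≢false (nu⊆mu c x) b))))
  ... | fromS _ h e = let a , b = inSkew-inS {mu} {nu} {c} h in
      trans (occ-just {init} {c} e) (sym (∧-i (mu⊆la c a) (not-intro b)))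
  ... | empty h h' e = trans (occ-nothing {init} {c} e) (sym (both (inS la c) (inS mu c) (inS nu c) h h'))
    where
    both : ∀ a b d → a ∧ not b ≡ false → b ∧ not d ≡ false → a ∧ not d ≡ false
    both false _ _ _ _ = refl
    both true true _ _ h = h
    both true false _ () _

  inv : Inv la nu n init (key n m 0) init
  inv = record
    { occ = occupied-init
    ; posit = λ c L x e → let h , r = from c L x e in subst (λ y → 1 ≤ num y) (sym r) (positive L c h)
    ; bound = λ c x e → let h , r = from c TL x e in subst (λ y → num y ≤ n) (sym r) (maxEntry-bound {la} {mu} sla T c h)
    ; rowO = λ i j L x M y e e' → let h , r = from (i , j) L x e ; h' , r' = from (i , suc j) M y e' in
        subst₂ (λ x y → key n m 0 L (num x) ≤ key n m 0 M (num y)) (sym r) (sym r')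
          (key-order L M (positive L (i , j) h) (positive M (i , suc j) h') (le-m L (i , j) h) (le-m M (i , suc j) h')
              (row-TT L M i j h h')
            (λ { refl → rank-num {fill L (i , j)} {fill L (i , suc j)} (row-le L i j h h') }))
    ; rowP = λ i j L x y e e' z → let h , r = from (i , j) L x e ; h' , r' = from (i , suc j) L y e' in row-primed i j L h h' x y r r' z
    ; colO = λ i j L x M y e e' → let h , r = from (i , j) L x e ; h' , r' = from (suc i , j) M y e' in
        subst₂ (λ x y → key n m 0 L (num x) ≤ key n m 0 M (num y)) (sym r) (sym r')
          (key-order L M (positive L (i , j) h) (positive M (suc i , j) h') (le-m L (i , j) h) (le-m M (suc i , j) h')
              (col-TT L M i j h h')
            (λ { refl → rank-num {fill L (i , j)} {fill L (suc i , j)} (col-le L i j h h') }))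
    ; colP = λ i j L x y e e' z → let h , r = from (i , j) L x e ; h' , r' = from (suc i , j) L y e' in col-primed i j L h h' x y r r' z
    ; diag = λ i L x e → let h , r = from (i , i) L x e in trans (cong primed r) (diag-un L i h)
    ; cnt = λ _ _ → refl }
    where
    row-primed : ∀ i j L → Letter-of L (i , j) → Letter-of L (i , suc j) → ∀ x y → x ≡ fill L (i , j) → y ≡ fill L
        (i , suc j) →
      num x ≡ num y → primed y ≡ false
    row-primed i j L h h' _ _ refl refl z = ¬true⇒false λ p → row-pr L i j h h'
      (rank-primed {fill L (i , j)} {fill L (i , suc j)} (positive L (i , j) h) z (row-le L i j h h') p) p z
    col-primed : ∀ i j L → Letter-of L (i , j) → Letter-of L (suc i , j) → ∀ x y → x ≡ fill L (i , j) → y ≡ fill L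
        (suc i , j) →
      num x ≡ num y → primed x ≡ true
    col-primed i j L h h' _ _ refl refl z = go (primed (fill L (i , j))) refl
      where
      go : ∀ b → primed (fill L (i , j)) ≡ b → primed (fill L (i , j)) ≡ true
      go true e = e
      go false e = ⊥-elim (col-un L i j h h' e (¬true⇒false λ p → true≢false
        (rank-primed {fill L (i , j)} {fill L (suc i , j)} (positive L (i , j) h) z (col-le L i j h h') p) e) z)

  weight-S : ∀ k → count (isLN SL k init) (gridOf la) ≡ wt S mu nu k
  weight-S k = trans (count-cong (gridOf la) (λ c _ → agree c)) (count-grids (grid-unique (suc (sum la))) (grid-unique
      (suc (sum mu)))
      (λ c e → let a , _ = inSkew-inS {mu} {nu} {c} (∧-l e) in inS-grid {la} {proj₁ c} {proj₂ c} sla (mu⊆la c a) , inS-grid {mu} {proj₁ c} {proj₂ c} smu a))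
    where
    agree : ∀ c → isLN SL k init c ≡ inSkew mu nu c ∧ (num (S c) ≡ᵇ k)
    agree c with source c
    ... | fromT h e = trans (cong (is′ SL k) e) (sym (cong (_∧ (num (S c) ≡ᵇ k)) (cong (_∧ not (inS nu c)) (proj₂
        (inSkew-inS {la} {mu} {c} h)))))
    ... | fromS _ h e = trans (cong (is′ SL k) e) (sym (cong (_∧ (num (S c) ≡ᵇ k)) h))
    ... | empty _ h e = trans (cong (is′ SL k) e) (sym (cong (_∧ (num (S c) ≡ᵇ k)) h))

  weight-T : ∀ k → count (isLN TL k init) (gridOf la) ≡ wt T la mu k
  weight-T k = count-cong (gridOf la) (λ c _ → agree c)
    where
    agree : ∀ c → isLN TL k init c ≡ inSkew la mu c ∧ (num (T c) ≡ᵇ k)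
    agree c with source c
    ... | fromT h e = trans (cong (is′ TL k) e) (sym (cong (_∧ (num (T c) ≡ᵇ k)) h))
    ... | fromS h _ e = trans (cong (is′ TL k) e) (sym (cong (_∧ (num (T c) ≡ᵇ k)) h))
    ... | empty h _ e = trans (cong (is′ TL k) e) (sym (cong (_∧ (num (T c) ≡ᵇ k)) h))

-- The final shape and its tableaux

bool-ext : ∀ {a b} → (a ≡ true → b ≡ true) → (b ≡ true → a ≡ true) → a ≡ b
bool-ext {true} {b} f g = sym (f refl)
bool-ext {false} {true} f g = g refl
bool-ext {false} {false} f g = refl

-- The number of leading values `true`, searched up to a bound. For a downward closed predicate
-- below the bound it recovers the predicate.
prefixLength : (ℕ → Bool) → ℕ → ℕ
prefixLength f zero = 0
prefixLength f (suc m) = if f 0 then suc (prefixLength (f ∘ suc) m) else 0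

prefixLength-spec : ∀ f m → (∀ d → f (suc d) ≡ true → f d ≡ true) → (∀ d → f d ≡ true → d < m) →
  ∀ d → f d ≡ (d <ᵇ prefixLength f m)
prefixLength-spec f zero down bnd zero = ¬true⇒false λ e → <⇒≱ (bnd 0 e) z≤n
prefixLength-spec f zero down bnd (suc d) = ¬true⇒false λ e → <⇒≱ (bnd (suc d) e) z≤n
prefixLength-spec f (suc m) down bnd d with f 0 in e
prefixLength-spec f (suc m) down bnd zero | true = e
prefixLength-spec f (suc m) down bnd (suc d) | true =
  prefixLength-spec (f ∘ suc) m (λ d → down (suc d)) (λ d h → ≤-pred (bnd (suc d) h)) d
prefixLength-spec f (suc m) down bnd zero | false = e
prefixLength-spec f (suc m) down bnd (suc d) | false = ¬true⇒false λ h → true≢false (to-zero (suc d) h) e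
  where
  to-zero : ∀ d → f d ≡ true → f 0 ≡ true
  to-zero zero h = h
  to-zero (suc d) h = to-zero d (down d h)

extend : ℕ → List ℕ → List ℕ
extend zero l = []
extend (suc x) l = suc x ∷ l

-- `extend` cuts the list at the first empty row, since a strict partition has no zero parts.
build : (ℕ → ℕ) → ℕ → List ℕ
build r zero = []
build r (suc k) = extend (r 0) (build (r ∘ suc) k)

part-build : ∀ r k → (∀ i → r i ≡ 0 → r (suc i) ≡ 0) → (∀ i → k ≤ i → r i ≡ 0) → ∀ i → part (build r k) (suc i) ≡ r i
part-build r zero z e i = sym (e i z≤n)
part-build r (suc k) z e i with r 0 in r0
part-build r (suc k) z e i | zero = sym (all-zero i)
  where
  all-zero : ∀ i → r i ≡ 0
  all-zero zero = r0
  all-zero (suc i) = z i (all-zero i)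
part-build r (suc k) z e zero | suc x = sym r0
part-build r (suc k) z e (suc i) | suc x = part-build (r ∘ suc) k (λ i → z (suc i)) (λ i h → e (suc i) (s≤s h)) i

build-strict : ∀ r k → (∀ i → 1 ≤ r (suc i) → r (suc i) < r i) → Strict (build r k)
build-strict r zero dec = nil
build-strict r (suc k) dec with r 0 in r0
... | zero = nil
... | suc x = go k (build-strict (r ∘ suc) k (λ i → dec (suc i)))
  where
  go : ∀ k → Strict (build (r ∘ suc) k) → Strict (suc x ∷ build (r ∘ suc) k)
  go zero s = one (s≤s z≤n)
  go (suc k) s with r 1 | dec 0
  ... | zero | _ = one (s≤s z≤n)
  ... | suc y | h = cons (≤-trans (h (s≤s z≤n)) (≤-reflexive r0)) s

part-beyond : ∀ la i → length la ≤ i → part la (suc i) ≡ 0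
part-beyond [] i h = refl
part-beyond (x ∷ la) (suc i) h = part-beyond la i (≤-pred h)

inS-left* : ∀ la i j d → i ≤ j → inS la (i , d + j) ≡ true → inS la (i , j) ≡ true
inS-left* la i j zero h e = e
inS-left* la i j (suc d) h e = inS-left* la i j d h (inS-left {la} {i} {d + j} (≤-trans h (m≤n+m j d)) e)

inS-up* : ∀ la i j d → Strict la → 1 ≤ i → inS la (d + i , j) ≡ true → inS la (i , j) ≡ true
inS-up* la i j zero s h e = e
inS-up* la i j (suc d) s h e = inS-up* la i j d s h (inS-up {la} {d + i} {j} s (≤-trans h (m≤n+m i d)) e)

module Extract {la nu : List ℕ} (sla : Strict la) (snu : Strict nu) (sub : Sub nu la) {n : ℕ} {init fin : State}
  (I : Inv la nu n init (key n 0 0) fin) where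
  open Inv I

  skewF : ∀ {c x} → fin c ≡ just x → inS la c ≡ true × inS nu c ≡ false
  skewF {c} e = let h = trans (sym (occ c)) (occ-just {fin} {c} e) in ∧-l h , not-elim (∧-r {inS la c} h)

  -- In the final order every T-letter precedes every S-letter. Hence no S-box stands just west or
  -- north of a T-box, and ν together with the T-boxes is closed under steps west and north inside
  -- the shifted diagram.
  key-TS : ∀ {k l} → 1 ≤ k → l ≤ n → key n 0 0 SL k ≤ key n 0 0 TL l → ⊥
  key-TS {suc k} {zero} _ _ h = <⇒≱ (s≤s z≤n) (≤-trans (≤-reflexive (sym (key-S> {n} {0} {0} {suc k} (s≤s z≤n)))) h)
  key-TS {suc k} {suc l} _ h' h = <-irrefl refl (≤-trans (s≤s (m≤n+m n k))
    (≤-trans (≤-reflexive (sym (key-S> {n} {0} {0} {suc k} (s≤s z≤n)))) (≤-trans h (≤-trans (≤-reflexive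
        (key-T≥ {n} {0} {0} {l} z≤n)) h'))))

  key-reflect : ∀ L {k k'} → 1 ≤ k → 1 ≤ k' → key n 0 0 L k ≤ key n 0 0 L k' → k ≤ k'
  key-reflect SL {k} {k'} a b h = +-cancelʳ-≤ n k k' (subst₂ _≤_ (key-S> {n} {0} {0} a) (key-S> {n} {0} {0} b) h)
  key-reflect TL {suc k} {suc k'} a b h = h

  -- The region that is to become the intermediate shape κ, given by `ka`.
  inK : Cell → Bool
  inK c = inS nu c ∨ hasLab TL fin c

  hasTL : ∀ {c} → hasLab TL fin c ≡ true → Σ Letter λ x → fin c ≡ just (TL , x)
  hasTL {c} h with fin c
  ... | just (TL , x) = x , refl

  hasTL-in : ∀ {c x} → fin c ≡ just (TL , x) → hasLab TL fin c ≡ true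
  hasTL-in e rewrite e = refl

  inK-la : ∀ c → inK c ≡ true → inS la c ≡ true
  inK-la c h with inS nu c in e
  ... | true = sub c e
  ... | false = proj₁ (skewF {c} (proj₂ (hasTL {c} h)))

  filled : ∀ {c} → inS la c ≡ true → inS nu c ≡ false → Σ Lab λ L → Σ Letter λ x → fin c ≡ just (L , x)
  filled {c} a b with fin c | occ c
  ... | just (L , x) | _ = L , x , refl
  ... | nothing | o = ⊥-elim (true≢false (∧-i a (not-intro b)) (sym o))

  inK-nu : ∀ c → inS nu c ≡ true → inK c ≡ true
  inK-nu c h rewrite h = refl

  inK-TL : ∀ c {x} → fin c ≡ just (TL , x) → inK c ≡ true
  inK-TL c e with inS nu c
  ... | true = refl
  ... | false = hasTL-in {c} e

  inK-left : ∀ i j → i ≤ j → inK (i , suc j) ≡ true → inK (i , j) ≡ true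
  inK-left i j h k = go (inS nu (i , suc j)) refl (inS nu (i , j)) refl
    where
    go : ∀ b → inS nu (i , suc j) ≡ b → ∀ b' → inS nu (i , j) ≡ b' → inK (i , j) ≡ true
    go _ _ true e' = inK-nu (i , j) e'
    go true e false e' = ⊥-elim (true≢false (inS-left {nu} {i} {j} h e) e')
    go false e false e' with hasTL {i , suc j} (trans (sym (cong (_∨ hasLab TL fin (i , suc j)) e)) k)
    ... | y , ey with filled {i , j} (inS-left {la} {i} {j} h (inK-la (i , suc j) k)) e'
    ... | TL , x , ex = inK-TL (i , j) ex
    ... | SL , x , ex = ⊥-elim (key-TS (posit (i , j) SL x ex) (bound (i , suc j) y ey) (rowO i j SL x TL y ex ey))

  inK-up : ∀ i j → 1 ≤ i → inK (suc i , j) ≡ true → inK (i , j) ≡ true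
  inK-up i j h k = go (inS nu (suc i , j)) refl (inS nu (i , j)) refl
    where
    go : ∀ b → inS nu (suc i , j) ≡ b → ∀ b' → inS nu (i , j) ≡ b' → inK (i , j) ≡ true
    go _ _ true e' = inK-nu (i , j) e'
    go true e false e' = ⊥-elim (true≢false (inS-up {nu} {i} {j} snu h e) e')
    go false e false e' with hasTL {suc i , j} (trans (sym (cong (_∨ hasLab TL fin (suc i , j)) e)) k)
    ... | y , ey with filled {i , j} (inS-up {la} {i} {j} sla h (inK-la (suc i , j) k)) e'
    ... | TL , x , ex = inK-TL (i , j) ex
    ... | SL , x , ex = ⊥-elim (key-TS (posit (i , j) SL x ex) (bound (suc i , j) y ey) (colO i j SL x TL y ex ey))

  rowLength : ℕ → ℕ
  rowLength i = prefixLength (λ d → inK (suc i , suc i + d)) (part la (suc i))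

  rowLength-spec : ∀ i d → inK (suc i , suc i + d) ≡ (d <ᵇ rowLength i)
  rowLength-spec i = prefixLength-spec _ (part la (suc i))
    (λ d h → inK-left (suc i) (suc i + d) (m≤m+n (suc i) d) (subst (λ j → inK (suc i , j) ≡ true) (+-suc (suc i) d) h))
    (λ d h → +-cancelˡ-< (suc i) d (part la (suc i)) (proj₂ (proj₂ (inS-out la (suc i) (suc i + d) (inK-la (suc i ,
        suc i + d) h)))))

  -- Rows are shifted: offset `m` from the diagonal in the lower row is the column of offset `suc m`
  -- in the upper one. So closure to the north already gives a strict decrease.
  rowLength-dec : ∀ i → 1 ≤ rowLength (suc i) → rowLength (suc i) < rowLength i
  rowLength-dec i h with rowLength (suc i) in e
  ... | suc m = <ᵇ-true (trans (sym (rowLength-spec i (suc m)))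
      (subst (λ j → inK (suc i , j) ≡ true) (sym (+-suc (suc i) m)) (inK-up (suc i) (2+ i + m) (s≤s z≤n)
        (trans (rowLength-spec (suc i) m) (trans (cong (m <ᵇ_) e) (<ᵇ-I (n<1+n m)))))))

  ka : List ℕ
  ka = build rowLength (length la)

  ka-strict : Strict ka
  ka-strict = build-strict rowLength (length la) rowLength-dec

  ka-part : ∀ i → part ka (suc i) ≡ rowLength i
  ka-part = part-build rowLength (length la) down (λ i h → cong (prefixLength (λ d → inK (suc i , suc i + d)))
      (part-beyond la i h))
    where
    down : ∀ i → rowLength i ≡ 0 → rowLength (suc i) ≡ 0
    down i e with rowLength (suc i) | rowLength-dec i
    ... | zero | _ = refl
    ... | suc m | h = ⊥-elim (<⇒≱ (h (s≤s z≤n)) (≤-trans (≤-reflexive e) z≤n))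

  ka-K : ∀ c → inS ka c ≡ inK c
  ka-K (i , j) = bool-ext (to i j) (back i j)
    where
    to : ∀ i j → inS ka (i , j) ≡ true → inK (i , j) ≡ true
    to zero j ()
    to (suc i) j h with inS-out ka (suc i) j h
    ... | _ , b , c with j ∸ suc i | m+[n∸m]≡n b
    ... | d | refl = trans (rowLength-spec i d) (<ᵇ-I (+-cancelˡ-< (suc i) d (rowLength i) (subst (λ r →
        suc i + d < suc i + r) (ka-part i) c)))
    back : ∀ i j → inK (i , j) ≡ true → inS ka (i , j) ≡ true
    back i j h with inS-out la i j (inK-la (i , j) h)
    back (suc i) j h | a , b , _ with j ∸ suc i | m+[n∸m]≡n b
    ... | d | refl = inS-in {ka} {suc i} a b (subst (λ r → suc i + d < suc i + r) (sym (ka-part i))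
        (+-monoʳ-< (suc i) (<ᵇ-true (trans (sym (rowLength-spec i d)) h))))

  nu⊆ka : Sub nu ka
  nu⊆ka c h = trans (ka-K c) (inK-nu c h)

  ka⊆la : Sub ka la
  ka⊆la c h = inK-la c (trans (sym (ka-K c)) h)

  TL-region : ∀ c → hasLab TL fin c ≡ inSkew ka nu c
  TL-region c = bool-ext
    (λ h → let _ , e = hasTL {c} h in ∧-i (trans (ka-K c) (inK-TL c e)) (not-intro (proj₂ (skewF {c} e))))
    (λ h → trans (sym (cong (_∨ hasLab TL fin c) (not-elim (∧-r {inS ka c} h)))) (trans (sym (ka-K c)) (∧-l h)))

  SL-region : ∀ c → hasLab SL fin c ≡ inSkew la ka c
  SL-region c = bool-ext to back
    where
    to : hasLab SL fin c ≡ true → inSkew la ka c ≡ true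
    to h with fin c in e
    ... | just (SL , x) = ∧-i (proj₁ (skewF {c} e)) (not-intro (trans (ka-K c) (trans (cong (_∨ hasLab TL fin c)
        (proj₂ (skewF {c} e)))
        (cong (maybe (λ x → labEq TL (proj₁ x)) false) e))))
    back : inSkew la ka c ≡ true → hasLab SL fin c ≡ true
    back h with filled {c} (∧-l h) (¬true⇒false λ v → true≢false (nu⊆ka c v) (not-elim (∧-r {inS la c} h)))
    ... | SL , x , e = cong (maybe (λ x → labEq SL (proj₁ x)) false) e
    ... | TL , x , e = ⊥-elim (true≢false (trans (ka-K c) (inK-TL c e)) (not-elim (∧-r {inS la c} h)))

  -- Used twice, for the T-boxes in κ/ν and the S-boxes in λ/κ. Both are skew shifted shapes, so two
  -- boxes of one row or column are joined by boxes in between, and the conditions on neighbours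
  -- extend to the tableau conditions.
  module Region {al be′ : List ℕ} (sal : Strict al) (sbe : Strict be′) (L : Lab)
    (region : ∀ c → hasLab L fin c ≡ inSkew al be′ c) where

    ent : Cell → Letter
    ent = entry fin

    at-cell : ∀ c → InSkew al be′ c → fin c ≡ just (L , ent c)
    at-cell c h with fin c | trans (region c) h
    ... | just (M , x) | e = cong (λ N → just (N , x)) (sym (labEq-eq e))

    num-pos : ∀ c → InSkew al be′ c → 1 ≤ num (ent c)
    num-pos c h = posit c L (ent c) (at-cell c h)

    row-between : ∀ i j d → InSkew al be′ (i , j) → InSkew al be′ (i , suc (d + j)) → InSkew al be′ (i , d + j)
    row-between i j d h h' = let a , b = inSkew-inS {al} {be′} {i , j} h ; a' , _ = inSkew-inS {al} {be′} {i , suc (d + j)} h'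
                                 _ , i≤j , _ = inS-out al i j a in
      ∧-i (inS-left {al} {i} {d + j} (≤-trans i≤j (m≤n+m j d)) a')
          (not-intro (¬true⇒false λ e → true≢false (inS-left* be′ i j d i≤j e) b))

    col-between : ∀ i j d → InSkew al be′ (i , j) → InSkew al be′ (suc (d + i) , j) → InSkew al be′ (d + i , j)
    col-between i j d h h' = let a , b = inSkew-inS {al} {be′} {i , j} h ; a' , _ = inSkew-inS {al} {be′} {suc (d + i) , j} h'
                                 1≤i , _ = inS-out al i j a in
      ∧-i (inS-up {al} {d + i} {j} sal (≤-trans 1≤i (m≤n+m i d)) a')
          (not-intro (¬true⇒false λ e → true≢false (inS-up* be′ i j d sbe 1≤i e) b))

    row-step : ∀ i j → InSkew al be′ (i , j) → InSkew al be′ (i , suc j) → num (ent (i , j)) ≤ num (ent (i , suc j))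
    row-step i j h h' = key-reflect L (num-pos (i , j) h) (num-pos (i , suc j) h') (rowO i j L _ L _ (at-cell (i ,
        j) h) (at-cell (i , suc j) h'))

    col-step : ∀ i j → InSkew al be′ (i , j) → InSkew al be′ (suc i , j) → num (ent (i , j)) ≤ num (ent (suc i , j))
    col-step i j h h' = key-reflect L (num-pos (i , j) h) (num-pos (suc i , j) h') (colO i j L _ L _ (at-cell (i ,
        j) h) (at-cell (suc i , j) h'))

    row-num : ∀ i j d → InSkew al be′ (i , j) → InSkew al be′ (i , d + j) → num (ent (i , j)) ≤ num (ent (i , d + j))
    row-num i j zero h h' = ≤-refl
    row-num i j (suc d) h h' = let b = row-between i j d h h' in ≤-trans (row-num i j d h b) (row-step i (d + j) b h')

    col-num : ∀ i j d → InSkew al be′ (i , j) → InSkew al be′ (d + i , j) → num (ent (i , j)) ≤ num (ent (d + i , j))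
    col-num i j zero h h' = ≤-refl
    col-num i j (suc d) h h' = let b = col-between i j d h h' in ≤-trans (col-num i j d h b) (col-step (d + i) j b h')

    -- Numbers increase weakly along the row, so equal ends make the last step one between equal
    -- letters, where `rowP` applies.
    row-unprimed : ∀ i j d → InSkew al be′ (i , j) → InSkew al be′ (i , suc d + j) → num (ent (i , j)) ≡ num (ent (i ,
        suc d + j)) →
      primed (ent (i , suc d + j)) ≡ false
    row-unprimed i j d h h' e = let b = row-between i j d h h' in
      rowP i (d + j) L _ _ (at-cell (i , d + j) b) (at-cell (i , suc d + j) h')
        (≤-antisym (row-step i (d + j) b h') (≤-trans (≤-reflexive (sym e)) (row-num i j d h b)))

    -- Here it is the first step of the column that decides, as `colP` speaks of the upper box. The
    -- recursion therefore shortens the segment from below.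
    col-primed : ∀ i j d → InSkew al be′ (i , j) → InSkew al be′ (suc d + i , j) → num (ent (i , j)) ≡ num (ent
        (suc d + i , j)) →
      primed (ent (i , j)) ≡ true
    col-primed i j zero h h' e = colP i j L _ _ (at-cell (i , j) h) (at-cell (suc i , j) h') e
    col-primed i j (suc d) h h' e = let b = col-between i j (suc d) h h' in
      col-primed i j d h b (≤-antisym (col-num i j (suc d) h b) (≤-trans (col-step (suc d + i) j b h') (≤-reflexive
          (sym e))))

    row-rank-≤ : ∀ i j d → InSkew al be′ (i , j) → InSkew al be′ (i , d + j) → ent (i , j) ≤L ent (i , d + j)
    row-rank-≤ i j zero h h' = ≤-refl
    row-rank-≤ i j (suc d) h h' = rank-unprimed-right {ent (i , j)} {ent (i , suc d + j)} (row-num i j (suc d) h h')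
        (row-unprimed i j d h h')

    col-rank-≤ : ∀ i j d → InSkew al be′ (i , j) → InSkew al be′ (d + i , j) → ent (i , j) ≤L ent (d + i , j)
    col-rank-≤ i j zero h h' = ≤-refl
    col-rank-≤ i j (suc d) h h' = rank-primed-left {ent (i , j)} {ent (suc d + i , j)} (col-num i j (suc d) h h')
        (col-primed i j d h h')

    row-distinct : ∀ i j d → InSkew al be′ (i , j) → InSkew al be′ (i , suc d + j) → primed (ent (i , suc d + j)) ≡ true →
      num (ent (i , j)) ≢ num (ent (i , suc d + j))
    row-distinct i j d h h' p e = true≢false p (row-unprimed i j d h h' e)

    col-distinct : ∀ i j d → InSkew al be′ (i , j) → InSkew al be′ (suc d + i , j) → primed (ent (i , j)) ≡ false →
      num (ent (i , j)) ≢ num (ent (suc d + i , j))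
    col-distinct i j d h h' p e = true≢false (col-primed i j d h h' e) p

    gap : ∀ {m k} → m < k → Σ ℕ λ d → suc d + m ≡ k
    gap {m} {k} h = k ∸ suc m , trans (sym (+-suc (k ∸ suc m) m)) (m∸n+n≡m h)

    tableau : SSYT ent al be′
    tableau = record
      { syt = record
        { positive = num-pos
        ; rowWeak = λ i j j' h h' l → row-weak i j j' h h' l
        ; colWeak = λ i i' j h h' l → col-weak i i' j h h' l
        ; colUnprimed = col-unprimed
        ; rowPrimed = row-primed′ }
      ; diag = λ i h → diag i L _ (at-cell (i , i) h) }
      where
      row-weak : ∀ i j j' → InSkew al be′ (i , j) → InSkew al be′ (i , j') → j ≤ j' → ent (i , j) ≤L ent (i , j')
      row-weak i j j' h h' l with j' ∸ j | m∸n+n≡m l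
      ... | d | refl = row-rank-≤ i j d h h'
      col-weak : ∀ i i' j → InSkew al be′ (i , j) → InSkew al be′ (i' , j) → i ≤ i' → ent (i , j) ≤L ent (i' , j)
      col-weak i i' j h h' l with i' ∸ i | m∸n+n≡m l
      ... | d | refl = col-rank-≤ i j d h h'
      col-unprimed : ∀ i i' j → InSkew al be′ (i , j) → InSkew al be′ (i' , j) → i ≢ i' →
        primed (ent (i , j)) ≡ false → primed (ent (i' , j)) ≡ false → num (ent (i , j)) ≢ num (ent (i' , j))
      col-unprimed i i' j h h' ne p p' e with <-cmp i i'
      ... | tri≈ _ x _ = ne x
      ... | tri< lt _ _ with gap lt
      ... | d , refl = col-distinct i j d h h' p e
      col-unprimed i i' j h h' ne p p' e | tri> _ _ gt with gap gt
      ... | d , refl = col-distinct i' j d h' h p' (sym e)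
      row-primed′ : ∀ i j j' → InSkew al be′ (i , j) → InSkew al be′ (i , j') → j ≢ j' →
        primed (ent (i , j)) ≡ true → primed (ent (i , j')) ≡ true → num (ent (i , j)) ≢ num (ent (i , j'))
      row-primed′ i j j' h h' ne p p' e with <-cmp j j'
      ... | tri≈ _ x _ = ne x
      ... | tri< lt _ _ with gap lt
      ... | d , refl = row-distinct i j d h h' p' e
      row-primed′ i j j' h h' ne p p' e | tri> _ _ gt with gap gt
      ... | d , refl = row-distinct i j' d h' h p (sym e)

theorem6p4 : (la mu nu : List ℕ) → Strict la → Strict mu → Strict nu
    → Sub nu mu → Sub mu la
    → (S T : Cell → Letter) → SSYT S mu nu → SSYT T la mu
    → (fin : State) → ModSwitch S T la mu nu fin
    → ((∀ c → occupied fin c ≡ inSkew la nu c)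
    × (∀ k → wtLab SL fin la k ≡ wt S mu nu k)
    × (∀ k → wtLab TL fin la k ≡ wt T la mu k))
    × Σ (List ℕ) (λ ka → Strict ka × Sub nu ka × Sub ka la
    × (∀ c → hasLab TL fin c ≡ inSkew ka nu c)
    × (∀ c → hasLab SL fin c ≡ inSkew la ka c)
    × SSYT (entry fin) la ka × SSYT (entry fin) ka nu)
theorem6p4 la mu nu sla smu snu nu⊆mu mu⊆la S T tS tT fin run =
  (Inv.occ I , (λ k → trans (Inv.cnt I SL k) (In.weight-S k)) , (λ k → trans (Inv.cnt I TL k) (In.weight-T k))) ,
  X.ka , X.ka-strict , X.nu⊆ka , X.ka⊆la , X.TL-region , X.SL-region ,
  X.Region.tableau sla X.ka-strict SL X.SL-region , X.Region.tableau X.ka-strict snu TL X.TL-region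
  where
  nu⊆la : Sub nu la
  nu⊆la c h = mu⊆la c (nu⊆mu c h)
  module In = Initial sla smu snu nu⊆mu mu⊆la tS tT
  I : Inv la nu (maxEntry T la mu) In.init (key (maxEntry T la mu) 0 0) fin
  I = Run.run-all sla snu nu⊆la (maxEntry T la mu) In.init run In.inv
  module X = Extract sla snu nu⊆la I
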